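{- Let $G$ be a graph on $n$ vertices given as a dynamic stream of edge updates (insertions and deletions, final edge multiplicities in $\{0,1\}$, stream length polynomial in $n$). There exists a streaming interactive proof for verifying the number of connected components of $G$ with $O(\log n)$ rounds of communication and cost $(\log^2 n, n\log n)$.
   Context: A streaming interactive proof (SIP) for a function $f$ of a data stream $\tau$: a randomized verifier $V$ reads $\tau$ once in a streaming fashion (as does the prover $P$); after the stream has passed, $V$ and $P$ exchange messages, after which $V$ outputs a value or $\perp$ (rejection). There must be a prover strategy causing $V$ to output $f(\tau)$ with probability at least $2/3$, and for every prover strategy $V$ must output a value in $\{f(\tau),\perp\}$ with probability at least $2/3$. Cost $(A,B)$ means verifier space $O(A)$ bits and total communication $O(B)$ bits. -}

module Defs where

open import Data.Bool using (Bool; true; false; if_then_else_; _∧_; _∨_)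
open import Data.Bool.Properties using (∨-comm)
open import Data.Empty using (⊥; ⊥-elim)
open import Data.Fin using (Fin; punchIn; punchOut)
open import Data.Fin.Properties using (_≟_; punchInᵢ≢i; punchOut-cong; punchOut-injective; punchOut-punchIn; injective⇒≤)
open import Data.Integer as ℤ using (ℤ; 0ℤ; 1ℤ; -1ℤ; +_)
open import Data.List using (List; []; _∷_; length; allFin; cartesianProduct)
open import Data.List.Membership.Propositional using (_∈_)
open import Data.List.Membership.Propositional.Properties using (∈-allFin; ∈-cartesianProduct⁺)
open import Data.List.Relation.Unary.Any using (here; there)
open import Data.Maybe using (Maybe; just; nothing)
open import Data.Nat using (ℕ; zero; suc; _≤_; _*_; _^_; _≡ᵇ_)
open import Data.Nat.Properties using (≤-antisym)
open import Data.Product using (Σ; ∃; ∃₂; _×_; _,_; proj₁; proj₂)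
open import Data.Rational as ℚ using (ℚ; 0ℚ; 1ℚ; ½)
open import Data.Sum using (_⊎_; inj₁; inj₂)
open import Data.Vec using (Vec)
open import Function using (_∘_; _⇔_; mk⇔; _↣_; Surjective; Equivalence)
open import Relation.Binary.Construct.Closure.ReflexiveTransitive using (Star; ε; _◅_; _◅◅_; reverse)
open import Relation.Binary.Definitions using (Decidable; Symmetric; Irreflexive)
open import Relation.Binary.PropositionalEquality using (_≡_; _≢_; refl; sym; trans; cong; cong₂)
open import Relation.Nullary using (yes; no; does)

infix 4 _=O_

_=O_ : (ℕ → ℕ) → (ℕ → ℕ) → Set
f =O g = ∃₂ λ K n₀ → ∀ n → n₀ ≤ n → f n ≤ K * g n

PolynomiallyBounded : (ℕ → ℕ) → Set
PolynomiallyBounded f = ∃ λ d → f =O (λ n → n ^ d)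

-- Finite randomised computations, as trees of fair coin tosses

data Rand (A : Set) : Set where
  return : A → Rand A
  toss   : (Bool → Rand A) → Rand A

infixl 1 _>>=_

_>>=_ : {A B : Set} → Rand A → (A → Rand B) → Rand B
return a >>= k = k a
toss t   >>= k = toss λ b → t b >>= k

Pr : {A : Set} → (A → Bool) → Rand A → ℚ
Pr E (return a) = if E a then 1ℚ else 0ℚ
Pr E (toss t)   = ½ ℚ.* (Pr E (t false) ℚ.+ Pr E (t true))

-- The property holds for every outcome of the coins.
Surely : {A : Set} → (A → Set) → Rand A → Set
Surely Q (return a) = Q a
Surely Q (toss t)   = ∀ b → Surely Q (t b)

data Move : Set where
  send    : Bool → Move
  receive : Move
  halt    : Maybe ℕ → Move      -- nothing is the rejection symbol ⊥

-- The state is everything the verifier remembers from one event (a stream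
-- token, the end of the stream, a communicated bit) to the next. Messages are
-- exchanged bit by bit, so a prover message may be far longer than the
-- verifier's memory. Coins are private, and must be kept in the state if they
-- are to be used again.
record Verifier (T : Set) : Set₁ where
  field
    State       : Set
    init        : Rand State
    read        : T → State → Rand State
    endOfStream : State → Rand State
    move        : State → Move
    sent        : State → Rand State
    received    : Bool → State → Rand State

  readAll : List T → State → Rand State
  readAll []      s = return s
  readAll (x ∷ τ) s = read x s >>= readAll τ

FitsIn : {T : Set} → Verifier T → ℕ → Set
FitsIn V bits = Verifier.State V ↣ Vec Bool bits

data Party : Set where
  V P : Party

-- Every communicated bit with its sender, latest bit first.
Transcript : Set
Transcript = List (Party × Bool)

-- Number of messages, i.e. of maximal blocks of bits with the same sender.
rounds : Transcript → ℕ
rounds []                            = 0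
rounds (_ ∷ [])                      = 1
rounds ((V , _) ∷ t@((V , _) ∷ _))   = rounds t
rounds ((P , _) ∷ t@((P , _) ∷ _))   = rounds t
rounds ((V , _) ∷ t@((P , _) ∷ _))   = suc (rounds t)
rounds ((P , _) ∷ t@((V , _) ∷ _))   = suc (rounds t)

-- The next bit of the prover, given the whole stream and the transcript so far.
Prover : Set → Set
Prover T = List T → Transcript → Bool

data Outcome : Set where
  halted   : Maybe ℕ → Outcome
  exceeded : Outcome            -- bit budget used up before the verifier halted

module _ {T : Set} (𝒱 : Verifier T) where
  open Verifier 𝒱

  interact : ℕ → (Transcript → Bool) → State → Transcript → Rand (Outcome × Transcript)
  interact budget p s t with move s | budget
  ... | halt o  | _     = return (halted o , t)
  ... | send _  | zero  = return (exceeded , t)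
  ... | receive | zero  = return (exceeded , t)
  ... | send b  | suc k = sent s >>= λ s′ → interact k p s′ ((V , b) ∷ t)
  ... | receive | suc k = received (p t) s >>= λ s′ → interact k p s′ ((P , p t) ∷ t)

  -- The execution on stream τ with at most `budget` bits of communication.
  execute : ℕ → Prover T → List T → Rand (Outcome × Transcript)
  execute budget 𝒫 τ =
    init >>= readAll τ >>= endOfStream >>= λ s → interact budget (𝒫 τ) s []

outputs : ℕ → Outcome × Transcript → Bool
outputs v (halted (just w) , _) = w ≡ᵇ v
outputs v (halted nothing  , _) = false
outputs v (exceeded        , _) = false

outputsOrRejects : ℕ → Outcome × Transcript → Bool
outputsOrRejects v (halted (just w) , _) = w ≡ᵇ v
outputsOrRejects v (halted nothing  , _) = true
outputsOrRejects v (exceeded        , _) = false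

HaltsWithinRounds : ℕ → Outcome × Transcript → Set
HaltsWithinRounds r (halted _ , t) = rounds t ≤ r
HaltsWithinRounds r (exceeded , _) = ⊥

⅔ : ℚ
⅔ = + 2 ℚ./ 3

-- 𝒱 is the verifier of an SIP for f on the streams satisfying the promise.
-- The cost bounds hold for every prover and all coins; the bound on the number
-- of bits is that `exceeded` never occurs. Deterministic provers suffice, as a
-- randomised prover is a mixture of deterministic ones.
record IsSIP {T : Set} (Promise : List T → Set) (f : List T → ℕ)
             (𝒱 : Verifier T) (space comm rnds : ℕ) : Set where
  field
    spaceBound    : FitsIn 𝒱 space
    communication : ∀ 𝒫 τ → Promise τ → Surely (HaltsWithinRounds rnds) (execute 𝒱 comm 𝒫 τ)
    complete      : ∃ λ 𝒫 → ∀ τ → Promise τ → ⅔ ℚ.≤ Pr (outputs (f τ)) (execute 𝒱 comm 𝒫 τ)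
    sound         : ∀ 𝒫 τ → Promise τ → ⅔ ℚ.≤ Pr (outputsOrRejects (f τ)) (execute 𝒱 comm 𝒫 τ)

-- For each n an SIP, with O(R) rounds and cost (A , B).
record HasSIP {T : ℕ → Set} (Promise : ∀ n → List (T n) → Set) (f : ∀ n → List (T n) → ℕ)
              (R A B : ℕ → ℕ) : Set₁ where
  field
    verifier        : ∀ n → Verifier (T n)
    space comm rnds : ℕ → ℕ
    isSIP           : ∀ n → IsSIP (Promise n) (f n) (verifier n) (space n) (comm n) (rnds n)
    rounds-O        : rnds =O R
    space-O         : space =O A
    comm-O          : comm =O B

record Graph (n : ℕ) : Set₁ where
  field
    Adj     : Fin n → Fin n → Set
    adj?    : Decidable Adj
    symm    : Symmetric Adj
    irrefl  : Irreflexive _≡_ Adj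

  Connected : Fin n → Fin n → Set
  Connected = Star Adj

-- A bijection between the connected components and Fin c.
ComponentLabelling : {n : ℕ} → Graph n → ℕ → Set
ComponentLabelling {n} G c = Σ (Fin n → Fin c) λ ℓ →
  Surjective _≡_ _≡_ ℓ × (∀ u v → (ℓ u ≡ ℓ v) ⇔ Graph.Connected G u v)

private
  module Merge {c : ℕ} (a b : Fin (suc c)) (a≢b : a ≢ b) where

    merge : Fin (suc c) → Fin c
    merge i with a ≟ i
    ... | yes _  = punchOut a≢b
    ... | no a≢i = punchOut a≢i

    merge-punchIn : ∀ j → merge (punchIn a j) ≡ j
    merge-punchIn j with a ≟ punchIn a j
    ... | yes e  = ⊥-elim (punchInᵢ≢i a j (sym e))
    ... | no a≢i = trans (punchOut-cong a refl) (punchOut-punchIn a)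

    merge-ab : merge a ≡ merge b
    merge-ab with a ≟ a | a ≟ b
    ... | no a≢a | _     = ⊥-elim (a≢a refl)
    ... | yes _  | yes e = ⊥-elim (a≢b e)
    ... | yes _  | no _  = punchOut-cong a refl

    merge-kernel : ∀ i k → merge i ≡ merge k →
                   i ≡ k ⊎ (a ≡ i × b ≡ k) ⊎ (a ≡ k × b ≡ i)
    merge-kernel i k e with a ≟ i | a ≟ k
    ... | yes p  | yes q  = inj₁ (trans (sym p) q)
    ... | yes p  | no a≢k = inj₂ (inj₁ (p , punchOut-injective a≢b a≢k e))
    ... | no a≢i | yes q  = inj₂ (inj₂ (q , punchOut-injective a≢b a≢i (sym e)))
    ... | no a≢i | no a≢k = inj₁ (punchOut-injective a≢i a≢k e)

  module _ {n : ℕ} (G : Graph n) where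
    open Graph G

    Partial : List (Fin n × Fin n) → Set
    Partial ps = ∃ λ c → Σ (Fin n → Fin c) λ ℓ →
      (∀ j → ∃ λ w → ℓ w ≡ j) ×
      (∀ u v → ℓ u ≡ ℓ v → Connected u v) ×
      (∀ u v → (u , v) ∈ ps → Adj u v → ℓ u ≡ ℓ v)

    extend : ∀ x y ps → Partial ps → Partial ((x , y) ∷ ps)
    extend x y ps (c , ℓ , sur , ker , adj) with adj? x y | ℓ x ≟ ℓ y
    ... | no ¬xy | _ = c , ℓ , sur , ker , λ
      { _ _ (here refl) xy → ⊥-elim (¬xy xy) ; u v (there m) uv → adj u v m uv }
    ... | yes _ | yes e = c , ℓ , sur , ker , λ
      { _ _ (here refl) _ → e ; u v (there m) uv → adj u v m uv }
    extend x y ps (zero , ℓ , sur , ker , adj) | yes xy | no a≢b with () ← ℓ x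
    extend x y ps (suc c , ℓ , sur , ker , adj) | yes xy | no a≢b =
      c , merge ∘ ℓ , sur′ , ker′ , λ
        { _ _ (here refl) _ → merge-ab ; u v (there m) uv → cong merge (adj u v m uv) }
      where
      open Merge (ℓ x) (ℓ y) a≢b
      sur′ : ∀ j → ∃ λ w → merge (ℓ w) ≡ j
      sur′ j with w , e ← sur (punchIn (ℓ x) j) = w , trans (cong merge e) (merge-punchIn j)
      ker′ : ∀ u v → merge (ℓ u) ≡ merge (ℓ v) → Connected u v
      ker′ u v e with merge-kernel (ℓ u) (ℓ v) e
      ... | inj₁ p              = ker u v p
      ... | inj₂ (inj₁ (p , q)) = ker u x (sym p) ◅◅ xy ◅ ker y v q
      ... | inj₂ (inj₂ (p , q)) = ker u y (sym q) ◅◅ symm xy ◅ ker x v p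

    partials : ∀ ps → Partial ps
    partials []             = n , (λ u → u) , (λ j → j , refl) , (λ { _ _ refl → ε }) , λ _ _ ()
    partials ((x , y) ∷ ps) = extend x y ps (partials ps)

components : {n : ℕ} (G : Graph n) → ∃ (ComponentLabelling G)
components {n} G with c , ℓ , sur , ker , adj ← partials G (cartesianProduct (allFin n) (allFin n)) =
  c , ℓ , (λ j → proj₁ (sur j) , λ e → trans (cong ℓ e) (proj₂ (sur j))) ,
  λ u v → mk⇔ (ker u v) respects
  where
  respects : ∀ {u v} → Graph.Connected G u v → ℓ u ≡ ℓ v
  respects ε        = refl
  respects (e ◅ es) = trans (adj _ _ (∈-cartesianProduct⁺ (∈-allFin _) (∈-allFin _)) e) (respects es)

numComponents : {n : ℕ} → Graph n → ℕ
numComponents G = proj₁ (components G)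

labelling-unique : {n c d : ℕ} (G : Graph n) →
                   ComponentLabelling G c → ComponentLabelling G d → c ≡ d
labelling-unique G L M = ≤-antisym (below L M) (below M L)
  where
  below : ∀ {c d} → ComponentLabelling G c → ComponentLabelling G d → c ≤ d
  below (ℓ , sur , k) (m , _ , k′) = injective⇒≤ {f = λ i → m (proj₁ (sur i))} λ {i} {j} e →
    trans (sym (proj₂ (sur i) refl))
      (trans (Equivalence.from (k _ _) (Equivalence.to (k′ _ _) e)) (proj₂ (sur j) refl))

data Op : Set where
  insert delete : Op

-- An update of the undirected edge {src, tgt}; either orientation may be used.
record EdgeUpdate (n : ℕ) : Set where
  field
    op      : Op
    src tgt : Fin n
    src≢tgt : src ≢ tgt

module _ {n : ℕ} where
  open EdgeUpdate

  isEdge : EdgeUpdate n → Fin n → Fin n → Bool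
  isEdge e u v = (does (src e ≟ u) ∧ does (tgt e ≟ v)) ∨ (does (src e ≟ v) ∧ does (tgt e ≟ u))

  change : Op → ℤ
  change insert = 1ℤ
  change delete = -1ℤ

  multiplicity : List (EdgeUpdate n) → Fin n → Fin n → ℤ
  multiplicity []      u v = 0ℤ
  multiplicity (e ∷ τ) u v = (if isEdge e u v then change (op e) else 0ℤ) ℤ.+ multiplicity τ u v

  multiplicity-sym : ∀ τ u v → multiplicity τ u v ≡ multiplicity τ v u
  multiplicity-sym []      u v = refl
  multiplicity-sym (e ∷ τ) u v = cong₂ ℤ._+_
    (cong (if_then change (op e) else 0ℤ)
      (∨-comm (does (src e ≟ u) ∧ does (tgt e ≟ v)) (does (src e ≟ v) ∧ does (tgt e ≟ u))))
    (multiplicity-sym τ u v)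

  isEdge-irrefl : ∀ e u → isEdge e u u ≡ false
  isEdge-irrefl e u with src e ≟ u | tgt e ≟ u
  ... | yes p | yes q = ⊥-elim (src≢tgt e (trans p (sym q)))
  ... | yes _ | no _  = refl
  ... | no _  | _     = refl

  multiplicity-irrefl : ∀ τ u → multiplicity τ u u ≡ 0ℤ
  multiplicity-irrefl []      u = refl
  multiplicity-irrefl (e ∷ τ) u rewrite isEdge-irrefl e u | multiplicity-irrefl τ u = refl

  FinalMultiplicities01 : List (EdgeUpdate n) → Set
  FinalMultiplicities01 τ = ∀ u v → multiplicity τ u v ≡ 0ℤ ⊎ multiplicity τ u v ≡ 1ℤ

  streamGraph : List (EdgeUpdate n) → Graph n
  streamGraph τ = record
    { Adj    = λ u v → multiplicity τ u v ≡ 1ℤ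
    ; adj?   = λ u v → multiplicity τ u v ℤ.≟ 1ℤ
    ; symm   = λ {u} {v} e → trans (multiplicity-sym τ v u) e
    ; irrefl = λ { {u} refl e → 0≢1 (trans (sym (multiplicity-irrefl τ u)) e) }
    }
    where
    0≢1 : 0ℤ ≢ 1ℤ
    0≢1 ()

DynamicGraphStream : (ℕ → ℕ) → ∀ n → List (EdgeUpdate n) → Set
DynamicGraphStream len n τ = length τ ≤ len n × FinalMultiplicities01 τ

{-# OPTIONS --safe #-}
module Submission where

-- The verifier picks two secret points s, t and, while reading the stream, maintains the bilinear
-- sketch Σ A(u,v) hₛ(u) hₜ(v) of the adjacency matrix A modulo m, where h_r(v) is the product of
-- the coordinates of r at the nonzero binary digits of v. The prover commits, for every vertex v, to
-- the representative ℓ(v) of its component, its distance d(v) from that representative, and the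
-- sums over the neighbours of v of the powers ℓ⁰, ℓ¹, ℓ², d¹, d², d³. The verifier reveals s; the
-- prover repeats its first message together with the vector y = hₛᵀ A. A hash at the still secret t
-- shows that the repetition is faithful and, compared with the sketch, that y is correct; then
-- comparing ⟨y, x⟩ with ⟨hₛ, z⟩ checks every claim z = A x made in the first message. Now the test
-- Σ (ℓ(u) - ℓ(v))² = 0 over the neighbours u of v shows that ℓ is constant on components, and
-- Σ δ (δ - 1)² < 0 with δ = d(u) - d(v) that every v ≠ ℓ(v) has a neighbour of smaller d. So each
-- component has exactly one vertex with ℓ(v) = v, and these can be counted.
--
-- The hash needs coordinates whose differences are invertible modulo m, with m polynomial in n. The
-- Fermat number m = 2^2^k + 1, with 2^k of order log n, has no prime factor below 2^k, so the 2^k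
-- numbers below 2^k are suitable, and the error of a hash is at most log n / 2^k.

open import Defs
open import Data.Bool using (Bool; true; false; if_then_else_; _∧_; _∨_; not)
import Data.Bool.Properties as Bool
open import Data.Empty using (⊥-elim)
open import Data.Fin using (Fin; zero; suc; toℕ; fromℕ; fromℕ<; inject₁; combine; remQuot)
import Data.Fin.Properties as Fin
open import Data.Integer as ℤ using (ℤ; +_; -[1+_]; 0ℤ; 1ℤ; -1ℤ; +≤+)
import Data.Integer.Divisibility.Signed as ℤ
open import Data.Integer.DivMod using (_%ℕ_; _/ℕ_; a≡a%ℕn+[a/ℕn]*n; n%ℕd<d)
import Data.Integer.Properties as ℤ
open import Data.Integer.Tactic.RingSolver using (solve-∀)
open import Data.List using (List; []; _∷_; _++_; length; drop; tabulate)
import Data.List.Properties as List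
open import Data.Maybe using (Maybe; just; nothing)
open import Data.Nat
open import Data.Nat.Coprimality as Coprimality using (Coprime)
open import Data.Nat.DivMod using (_mod_; m≡m%n+[m/n]*n; m%n<n; m<n⇒m%n≡m; [m+kn]%n≡m%n; m/n≤m; m<n⇒m/n≡0; m*n/n≡m; m<n*o⇒m/o<n; +-distrib-/-∣ʳ)
open import Data.Nat.Divisibility using (_∣_; divides; ∣-refl; ∣-trans; ∣⇒≤; ∣m+n∣m⇒∣n; m∣m*n; n∣m*n; ∣1⇒≡1)
open import Data.Nat.Induction using (<-wellFounded; Acc; acc)
open import Data.Nat.Logarithm using (⌈log₂_⌉; ⌈log₂⌉-mono-≤; ⌈log₂2^n⌉≡n; ⌈log₂⌈n/2⌉⌉≡⌈log₂n⌉∸1)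
open import Data.Nat.Properties
import Data.Nat.Tactic.RingSolver as ℕ-Solver
open import Data.Product using (∃; ∃₂; _×_; _,_; proj₁; proj₂)
open import Data.Rational as ℚ using (ℚ; 0ℚ; 1ℚ; ½)
import Data.Rational.Properties as ℚ
open import Data.Rational.Solver using (module +-*-Solver)
open import Data.Sum using (_⊎_; inj₁; inj₂)
open import Data.Vec as Vec using (Vec; []; _∷_; map; lookup; replicate; zipWith; _[_]≔_)
import Data.Vec.Properties as Vec
open import Data.Vec.Relation.Unary.All as All using (All; []; _∷_)
open import Function using (_∘_; id; _↣_; mk↣; Injection; Equivalence)
open import Relation.Binary.Construct.Closure.ReflexiveTransitive using (ε; _◅_)
open import Relation.Binary.PropositionalEquality
open import Relation.Nullary using (Dec; yes; no; does; ¬_; _×-dec_; _⊎-dec_)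
open import Relation.Nullary.Decidable using (toWitness)
open import Algebra.Properties.Semiring.Sum ℤ.+-*-semiring using (sum; sum-cong-≗; ∑-distrib-+; ∑-comm; *-distribˡ-sum; *-distribʳ-sum; sum-replicate-zero)

-- Binary digits

-- The order of the messages resolves a dilemma: y depends on s, so the prover must learn s, but a
-- prover knowing s in advance could choose wrong sums with the right hash. The verifier cannot
-- store the n symbols committed before, so it keeps their hash at t and has them repeated beside y,
-- where the product test can be accumulated symbol by symbol.
--
-- The cubic has the least possible degree. So the polynomial vanishes at 0 and 1, and a constant
-- multiple of δ (δ - 1) cannot be both negative at -1 and nonnegative at 2.
--
-- The six sums are packed into one number, and the tests are identities over the integers; so m
-- must exceed every packed value and still have only O(log n) bits. A prime would also give
-- invertible differences; a Fermat number does so without a search for one of the right size.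

bit : Bool → ℕ
bit false = 0
bit true  = 1

odd : ℕ → Bool
odd x = x % 2 ≡ᵇ 1

bit-odd+2*half : ∀ x → bit (odd x) + 2 * (x / 2) ≡ x
bit-odd+2*half x = trans (cong₂ _+_ (bit-≡ᵇ1 (x % 2) (m%n<n x 2)) (*-comm 2 (x / 2)))
                         (sym (m≡m%n+[m/n]*n x 2))
  where
  bit-≡ᵇ1 : ∀ r → r < 2 → bit (r ≡ᵇ 1) ≡ r
  bit-≡ᵇ1 0 _ = refl
  bit-≡ᵇ1 1 _ = refl
  bit-≡ᵇ1 (suc (suc _)) (s≤s (s≤s ()))

val : ∀ {k} → Vec Bool k → ℕ
val []      = 0
val (b ∷ v) = bit b + 2 * val v

bits : ∀ k → ℕ → Vec Bool k
bits zero    x = []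
bits (suc k) x = odd x ∷ bits k (x / 2)

val-bits : ∀ k x → x < 2 ^ k → val (bits k x) ≡ x
val-bits zero    zero    _ = refl
val-bits zero    (suc _) (s≤s ())
val-bits (suc k) x       x<2^k = trans
  (cong (λ y → bit (odd x) + 2 * y)
    (val-bits k (x / 2) (m<n*o⇒m/o<n (subst (x <_) (*-comm 2 (2 ^ k)) x<2^k))))
  (bit-odd+2*half x)

val-< : ∀ {k} (v : Vec Bool k) → val v < 2 ^ k
val-< []              = s≤s z≤n
val-< {suc k} (b ∷ v) = begin-strict
  bit b + 2 * val v   <⟨ +-monoˡ-< (2 * val v) (bit<2 b) ⟩
  2 + 2 * val v       ≡⟨ *-suc 2 (val v) ⟨
  2 * suc (val v)     ≤⟨ *-monoʳ-≤ 2 (val-< v) ⟩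
  2 * 2 ^ k           ∎
  where
  open ≤-Reasoning
  bit<2 : ∀ b → bit b < 2
  bit<2 false = s≤s z≤n
  bit<2 true  = s≤s (s≤s z≤n)

val-injective : ∀ {k} (v w : Vec Bool k) → val v ≡ val w → v ≡ w
val-injective []          []          _ = refl
val-injective (false ∷ v) (false ∷ w) e = cong (false ∷_) (val-injective v w (*-cancelˡ-≡ _ _ 2 e))
val-injective (false ∷ v) (true ∷ w)  e = ⊥-elim (even≢odd (val v) (val w) e)
val-injective (true ∷ v)  (false ∷ w) e = ⊥-elim (even≢odd (val w) (val v) (sym e))
val-injective (true ∷ v)  (true ∷ w)  e =
  cong (true ∷_) (val-injective v w (*-cancelˡ-≡ _ _ 2 (suc-injective e)))

-- Congruences

module Mod (m : ℕ) where

  infix 4 _≋_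

  -- A record, so that x and y can be recovered from the type; their difference alone does not
  -- determine them.
  record _≋_ (x y : ℤ) : Set where
    constructor congruent
    field difference : + m ℤ.∣ (x ℤ.- y)
  open _≋_ public

  ≋-reflexive : ∀ {x y} → x ≡ y → x ≋ y
  ≋-reflexive {x} refl = congruent (subst (+ m ℤ.∣_) (sym (ℤ.+-inverseʳ x)) (ℤ.divides 0ℤ refl))

  ≋-refl : ∀ {x} → x ≋ x
  ≋-refl = ≋-reflexive refl

  ≋-sym : ∀ {x y} → x ≋ y → y ≋ x
  ≋-sym {x} {y} (congruent p) = congruent (subst (+ m ℤ.∣_) (lemma x y) (ℤ.∣m⇒∣-m p))
    where lemma : ∀ x y → ℤ.- (x ℤ.- y) ≡ y ℤ.- x
          lemma = solve-∀

  ≋-trans : ∀ {x y z} → x ≋ y → y ≋ z → x ≋ z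
  ≋-trans {x} {y} {z} (congruent p) (congruent q) =
    congruent (subst (+ m ℤ.∣_) (lemma x y z) (ℤ.∣m∣n⇒∣m+n p q))
    where lemma : ∀ x y z → (x ℤ.- y) ℤ.+ (y ℤ.- z) ≡ x ℤ.- z
          lemma = solve-∀

  +-cong : ∀ {x x′ y y′} → x ≋ x′ → y ≋ y′ → x ℤ.+ y ≋ x′ ℤ.+ y′
  +-cong {x} {x′} {y} {y′} (congruent p) (congruent q) =
    congruent (subst (+ m ℤ.∣_) (lemma x x′ y y′) (ℤ.∣m∣n⇒∣m+n p q))
    where lemma : ∀ x x′ y y′ → (x ℤ.- x′) ℤ.+ (y ℤ.- y′) ≡ (x ℤ.+ y) ℤ.- (x′ ℤ.+ y′)
          lemma = solve-∀

  *-cong : ∀ {x x′ y y′} → x ≋ x′ → y ≋ y′ → x ℤ.* y ≋ x′ ℤ.* y′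
  *-cong {x} {x′} {y} {y′} (congruent p) (congruent q) = congruent
    (subst (+ m ℤ.∣_) (lemma x x′ y y′) (ℤ.∣m∣n⇒∣m+n (ℤ.∣n⇒∣m*n x q) (ℤ.∣m⇒∣m*n y′ p)))
    where lemma : ∀ x x′ y y′ → x ℤ.* (y ℤ.- y′) ℤ.+ (x ℤ.- x′) ℤ.* y′ ≡ x ℤ.* y ℤ.- x′ ℤ.* y′
          lemma = solve-∀

  ^-cong : ∀ {x y} n → x ≋ y → x ℤ.^ n ≋ y ℤ.^ n
  ^-cong zero    p = ≋-refl
  ^-cong (suc n) p = *-cong p (^-cong n p)

  -- The way back from residues to integers: |a - b| ≤ max(a, b) < m, and 0 is the only multiple of
  -- m of that size.
  small-≋⇒≡ : ∀ {a b} → a < m → b < m → + a ≋ + b → a ≡ b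
  small-≋⇒≡ {a} {b} a<m b<m (congruent p) = ℤ.+-injective (ℤ.i-j≡0⇒i≡j (+ a) (+ b) (ℤ.∣i∣≡0⇒i≡0 (zero-or-big ℤ.∣ + a ℤ.- + b ∣ (ℤ.∣⇒∣ᵤ p) bound)))
    where
    bound : ℤ.∣ + a ℤ.- + b ∣ < m
    bound rewrite ℤ.m-n≡m⊖n a b = ≤-<-trans (ℤ.∣m⊝n∣≤m⊔n a b) (⊔-lub a<m b<m)
    zero-or-big : ∀ x → m ∣ x → x < m → x ≡ 0
    zero-or-big zero    _ _   = refl
    zero-or-big (suc x) d x<m = ⊥-elim (<⇒≱ x<m (∣⇒≤ d))

module Reduce (m : ℕ) .{{_ : NonZero m}} where
  open Mod m

  red : ℤ → Fin m
  red x = fromℕ< (n%ℕd<d x m)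

  ⟦_⟧ : Fin m → ℤ
  ⟦ i ⟧ = + toℕ i

  ⟦red⟧ : ∀ x → ⟦ red x ⟧ ≋ x
  ⟦red⟧ x rewrite Fin.toℕ-fromℕ< (n%ℕd<d x m) =
    ≋-sym (congruent (ℤ.divides (x /ℕ m) (trans (cong (ℤ._- + (x %ℕ m)) (a≡a%ℕn+[a/ℕn]*n x m))
                                     (lemma (+ (x %ℕ m)) (x /ℕ m ℤ.* + m)))))
    where lemma : ∀ r q → r ℤ.+ q ℤ.- r ≡ q
          lemma = solve-∀

  ≋⇒≡ : ∀ {i j : Fin m} → ⟦ i ⟧ ≋ ⟦ j ⟧ → i ≡ j
  ≋⇒≡ {i} {j} p = Fin.toℕ-injective (small-≋⇒≡ (Fin.toℕ<n i) (Fin.toℕ<n j) p)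

  red-cong : ∀ {x y} → x ≋ y → red x ≡ red y
  red-cong {x} {y} p = ≋⇒≡ (≋-trans (⟦red⟧ x) (≋-trans p (≋-sym (⟦red⟧ y))))

  red-≡⇒≋ : ∀ x y → red x ≡ red y → x ≋ y
  red-≡⇒≋ x y e = ≋-trans (≋-sym (⟦red⟧ x)) (subst (λ i → ⟦ i ⟧ ≋ y) (sym e) (⟦red⟧ y))

-- Fermat numbers have no small factors

fermat : ℕ → ℕ
fermat k = suc (2 ^ 2 ^ k)

odd-part : ∀ e → 0 < e → ∃₂ λ i o → e ≡ 2 ^ i * suc (2 * o)
odd-part e = go e (<-wellFounded e)
  where
  go : ∀ e → Acc _<_ e → 0 < e → ∃₂ λ i o → e ≡ 2 ^ i * suc (2 * o)
  go e (acc rec) 0<e with odd e | bit-odd+2*half e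
  ... | true  | p = 0 , e / 2 , trans (sym p) (sym (*-identityˡ _))
  ... | false | p with e / 2
  ...   | zero  = ⊥-elim (<⇒≢ 0<e p)
  ...   | suc h with i , o , q ← go (suc h) (rec (subst (suc h <_) p (m<m+n (suc h) (s≤s z≤n)))) (s≤s z≤n)
    = suc i , o , trans (sym p) (trans (cong (2 *_) q) (sym (*-assoc 2 (2 ^ i) _)))

module _ (k d : ℕ) .{{_ : NonZero d}} (d∣F : d ∣ fermat k) (d<2^k : d < 2 ^ k) where
  open Mod d

  private
    2ℤ : ℤ
    2ℤ = + 2

    -- A common divisor of d and 2 divides both 2^2^k + 1 and the even number 2^2^k, hence 1.
    2∤ : Coprime d 2
    2∤ {c} (c∣d , c∣2) = ∣1⇒≡1 (∣m+n∣m⇒∣n (subst (c ∣_) (+-comm 1 (2 ^ 2 ^ k)) (∣-trans c∣d d∣F)) (∣-trans c∣2 2∣))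
      where
      2∣ : 2 ∣ 2 ^ 2 ^ k
      2∣ with 2 ^ k | m^n>0 2 k
      ... | suc j | _ = m∣m*n (2 ^ j)

    cancel-2^ : ∀ i x → d ∣ ℤ.∣ 2ℤ ℤ.^ i ℤ.* x ∣ → d ∣ ℤ.∣ x ∣
    cancel-2^ zero    x p = subst (λ z → d ∣ ℤ.∣ z ∣) (ℤ.*-identityˡ x) p
    cancel-2^ (suc i) x p = cancel-2^ i x (Coprimality.coprime-divisor 2∤
      (subst (d ∣_) (trans (cong ℤ.∣_∣ (ℤ.*-assoc 2ℤ (2ℤ ℤ.^ i) x)) (ℤ.abs-* 2ℤ (2ℤ ℤ.^ i ℤ.* x))) p))

    2^2^k≋-1 : 2ℤ ℤ.^ (2 ^ k) ≋ -1ℤ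
    2^2^k≋-1 = congruent (ℤ.∣ᵤ⇒∣ (subst (λ z → d ∣ ℤ.∣ z ∣) (trans (ℤ.pos-+ 1 (2 ^ 2 ^ k)) (trans (ℤ.+-comm 1ℤ (+ (2 ^ 2 ^ k))) (cong (ℤ._+ 1ℤ) (pos-^ 2 (2 ^ k))))) d∣F))
      where
      pos-^ : ∀ a n → + (a ^ n) ≡ (+ a) ℤ.^ n
      pos-^ a zero    = refl
      pos-^ a (suc n) = trans (ℤ.pos-* a (a ^ n)) (cong (+ a ℤ.*_) (pos-^ a n))

  -- By pigeonhole 2 has some order e ≤ d modulo d; raising 2^e ≡ 1 to a suitable power of two
  -- gives an odd power of 2^2^k ≡ -1.
  smallFactor≡1 : d ≡ 1
  smallFactor≡1 = 2∤ (∣-refl , ℤ.∣⇒∣ᵤ (difference 1≋-1))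
    where
    1≋-1 : 1ℤ ≋ -1ℤ
    1≋-1 with i , j , i<j , fi≡fj ← Fin.pigeonhole (n<1+n d) (λ i → Reduce.red d (2ℤ ℤ.^ toℕ i))
         with e-1 , e≡ ← m≤n⇒∃[o]m+o≡n i<j
         with a , o , e≡2^a*odd ← odd-part (suc e-1) (s≤s z≤n) = ≋-trans (≋-sym 2^[e*2^b]≋1) 2^[e*2^b]≋-1
      where
      e = suc e-1

      i+e≡j : toℕ i + e ≡ toℕ j
      i+e≡j = trans (+-suc (toℕ i) e-1) e≡

      e≤d : e ≤ d
      e≤d = ≤-trans (m≤n+m e (toℕ i)) (subst (_≤ d) (sym i+e≡j) (s≤s⁻¹ (Fin.toℕ<n j)))

      2^a≤e : 2 ^ a ≤ e
      2^a≤e = subst (2 ^ a ≤_) (sym e≡2^a*odd) (m≤m*n (2 ^ a) (suc (2 * o)))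

      a<k : a < k
      a<k = ≰⇒> λ k≤a → <⇒≱ d<2^k (≤-trans (^-monoʳ-≤ 2 k≤a) (≤-trans 2^a≤e e≤d))

      -- Since 2^a ≤ e ≤ d < 2^k, the exponent a is below k, and the factor 2^b raises the power of
      -- two in e to exactly 2^k.
      b = k ∸ a

      e*2^b : e * 2 ^ b ≡ 2 ^ k * suc (2 * o)
      e*2^b = begin
        e * 2 ^ b                         ≡⟨ cong (_* 2 ^ b) e≡2^a*odd ⟩
        2 ^ a * suc (2 * o) * 2 ^ b       ≡⟨ *-assoc (2 ^ a) _ _ ⟩
        2 ^ a * (suc (2 * o) * 2 ^ b)     ≡⟨ cong (2 ^ a *_) (*-comm (suc (2 * o)) (2 ^ b)) ⟩
        2 ^ a * (2 ^ b * suc (2 * o))     ≡⟨ *-assoc (2 ^ a) _ _ ⟨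
        2 ^ a * 2 ^ b * suc (2 * o)       ≡⟨ cong (_* suc (2 * o)) (^-distribˡ-+-* 2 a b) ⟨
        2 ^ (a + b) * suc (2 * o)         ≡⟨ cong (λ c → 2 ^ c * suc (2 * o)) (m+[n∸m]≡n (<⇒≤ a<k)) ⟩
        2 ^ k * suc (2 * o)               ∎
        where open ≡-Reasoning

      2^e≋1 : 2ℤ ℤ.^ e ≋ 1ℤ
      2^e≋1 = congruent (ℤ.∣ᵤ⇒∣ (cancel-2^ (toℕ i) _
        (subst (λ z → d ∣ ℤ.∣ z ∣) factor (ℤ.∣⇒∣ᵤ (difference (≋-sym (Reduce.red-≡⇒≋ d (2ℤ ℤ.^ toℕ i) (2ℤ ℤ.^ toℕ j) fi≡fj)))))))
        where
        lemma : ∀ x y → x ℤ.* y ℤ.- x ≡ x ℤ.* (y ℤ.- 1ℤ)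
        lemma = solve-∀
        factor : 2ℤ ℤ.^ toℕ j ℤ.- 2ℤ ℤ.^ toℕ i ≡ 2ℤ ℤ.^ toℕ i ℤ.* (2ℤ ℤ.^ e ℤ.- 1ℤ)
        factor = trans (cong (ℤ._- 2ℤ ℤ.^ toℕ i)
          (trans (cong (2ℤ ℤ.^_) (sym i+e≡j)) (ℤ.^-distribˡ-+-* 2ℤ (toℕ i) e)))
          (lemma (2ℤ ℤ.^ toℕ i) (2ℤ ℤ.^ e))

      2^[e*2^b]≋1 : 2ℤ ℤ.^ (e * 2 ^ b) ≋ 1ℤ
      2^[e*2^b]≋1 = subst₂ _≋_ (ℤ.^-*-assoc 2ℤ e (2 ^ b)) (ℤ.^-zeroˡ (2 ^ b)) (^-cong (2 ^ b) 2^e≋1)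

      2^[e*2^b]≋-1 : 2ℤ ℤ.^ (e * 2 ^ b) ≋ -1ℤ
      2^[e*2^b]≋-1 = subst₂ _≋_
        (trans (ℤ.^-*-assoc 2ℤ (2 ^ k) (suc (2 * o))) (cong (2ℤ ℤ.^_) (sym e*2^b)))
        (cong (-1ℤ ℤ.*_) (trans (sym (ℤ.^-*-assoc -1ℤ 2 o)) (ℤ.^-zeroˡ o)))
        (^-cong (suc (2 * o)) 2^2^k≋-1)

-- A common divisor is at most a, hence a factor of the Fermat number below 2^k.
fermat-coprime : ∀ k a .{{_ : NonZero a}} → a < 2 ^ k → Coprime (fermat k) a
fermat-coprime k a a<2^k {d} (d∣F , d∣a) =
  smallFactor≡1 k d {{∣⇒nonZero d∣a}} d∣F (≤-<-trans (∣⇒≤ d∣a) a<2^k)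
  where
  ∣⇒nonZero : ∀ {d a} .{{_ : NonZero a}} → d ∣ a → NonZero d
  ∣⇒nonZero {suc _}         _             = _
  ∣⇒nonZero {zero}  {suc _} (divides q e) with () ← trans e (*-zeroʳ q)

-- Probability

0≤1 : 0ℚ ℚ.≤ 1ℚ
0≤1 = ℚ.<⇒≤ (ℚ.positive⁻¹ 1ℚ)

mean : ℚ → ℚ → ℚ
mean p q = ½ ℚ.* (p ℚ.+ q)

mean-mono : ∀ {p p′ q q′} → p ℚ.≤ p′ → q ℚ.≤ q′ → mean p q ℚ.≤ mean p′ q′
mean-mono p≤ q≤ = ℚ.*-monoˡ-≤-nonNeg ½ (ℚ.+-mono-≤ p≤ q≤)

mean-idem : ∀ p → mean p p ≡ p
mean-idem p = begin
  ½ ℚ.* (p ℚ.+ p)            ≡⟨ ℚ.*-distribˡ-+ ½ p p ⟩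
  ½ ℚ.* p ℚ.+ ½ ℚ.* p        ≡⟨ ℚ.*-distribʳ-+ p ½ ½ ⟨
  (½ ℚ.+ ½) ℚ.* p            ≡⟨ ℚ.*-identityˡ p ⟩
  p                          ∎
  where open ≡-Reasoning

mean-+ : ∀ a b c d → mean (a ℚ.+ b) (c ℚ.+ d) ≡ mean a c ℚ.+ mean b d
mean-+ = solve 4 (λ a b c d → con ½ :* (a :+ b :+ (c :+ d)) := con ½ :* (a :+ c) :+ con ½ :* (b :+ d)) refl
  where open +-*-Solver

module _ {A : Set} where

  Pr-cong : {E F : A → Bool} → (∀ a → E a ≡ F a) → ∀ r → Pr E r ≡ Pr F r
  Pr-cong E≗F (return a) = cong (if_then 1ℚ else 0ℚ) (E≗F a)
  Pr-cong E≗F (toss t)   = cong₂ mean (Pr-cong E≗F (t false)) (Pr-cong E≗F (t true))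

  Pr-true : {E : A → Bool} → (∀ a → E a ≡ true) → ∀ r → Pr E r ≡ 1ℚ
  Pr-true E≗true (return a) = cong (if_then 1ℚ else 0ℚ) (E≗true a)
  Pr-true E≗true (toss t)   = cong₂ mean (Pr-true E≗true (t false)) (Pr-true E≗true (t true))

  Pr-false : {E : A → Bool} → (∀ a → E a ≡ false) → ∀ r → Pr E r ≡ 0ℚ
  Pr-false E≗false (return a) = cong (if_then 1ℚ else 0ℚ) (E≗false a)
  Pr-false E≗false (toss t)   = cong₂ mean (Pr-false E≗false (t false)) (Pr-false E≗false (t true))

  Pr-mono : {E F : A → Bool} → (∀ a → E a ≡ true → F a ≡ true) → ∀ r → Pr E r ℚ.≤ Pr F r
  Pr-mono {E} {F} E⇒F (return a) with E a | F a | E⇒F a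
  ... | false | false | _ = ℚ.≤-refl
  ... | false | true  | _ = 0≤1
  ... | true  | true  | _ = ℚ.≤-refl
  ... | true  | false | f with () ← f refl
  Pr-mono E⇒F (toss t) = mean-mono (Pr-mono E⇒F (t false)) (Pr-mono E⇒F (t true))

  Pr≤1 : (E : A → Bool) → ∀ r → Pr E r ℚ.≤ 1ℚ
  Pr≤1 E r = subst (Pr E r ℚ.≤_) (Pr-true (λ _ → refl) r) (Pr-mono (λ _ _ → refl) r)

  Pr-not : (E : A → Bool) → ∀ r → Pr E r ℚ.+ Pr (not ∘ E) r ≡ 1ℚ
  Pr-not E (return a) with E a
  ... | false = refl
  ... | true  = refl
  Pr-not E (toss t) = trans
    (sym (mean-+ (Pr E (t false)) (Pr (not ∘ E) (t false)) (Pr E (t true)) (Pr (not ∘ E) (t true))))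
    (cong₂ mean (Pr-not E (t false)) (Pr-not E (t true)))

  Pr-∨ : (E F : A → Bool) → ∀ r → Pr (λ a → E a ∨ F a) r ℚ.≤ Pr E r ℚ.+ Pr F r
  Pr-∨ E F (return a) with E a | F a
  ... | false | false = ℚ.≤-refl
  ... | false | true  = ℚ.≤-refl
  ... | true  | false = ℚ.≤-refl
  ... | true  | true  = ℚ.+-monoʳ-≤ 1ℚ 0≤1
  Pr-∨ E F (toss t) = ℚ.≤-trans (mean-mono (Pr-∨ E F (t false)) (Pr-∨ E F (t true)))
    (ℚ.≤-reflexive (mean-+ (Pr E (t false)) (Pr F (t false)) (Pr E (t true)) (Pr F (t true))))

module _ {A B : Set} where

  Pr-map : (E : B → Bool) (f : A → Rand B) (g : A → B) → (∀ a → f a ≡ return (g a)) →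
           ∀ r → Pr E (r >>= f) ≡ Pr (E ∘ g) r
  Pr-map E f g f≗ (return a) = cong (Pr E) (f≗ a)
  Pr-map E f g f≗ (toss t)   = cong₂ mean (Pr-map E f g f≗ (t false)) (Pr-map E f g f≗ (t true))

  -- Union bound for a computation that goes wrong either because of an event of its first part,
  -- or with small probability afterwards.
  Pr-bind : (E : B → Bool) (f : A → Rand B) (Z : A → Bool) {δ : ℚ} → 0ℚ ℚ.≤ δ →
            (∀ a → Z a ≡ false → Pr E (f a) ℚ.≤ δ) → ∀ r → Pr E (r >>= f) ℚ.≤ Pr Z r ℚ.+ δ
  Pr-bind E f Z {δ} 0≤δ bound (return a) with Z a | bound a
  ... | false | b = ℚ.≤-trans (b refl) (ℚ.≤-reflexive (sym (ℚ.+-identityˡ δ)))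
  ... | true  | _ = ℚ.≤-trans (Pr≤1 E (f a))
    (ℚ.≤-trans (ℚ.≤-reflexive (sym (ℚ.+-identityʳ 1ℚ))) (ℚ.+-monoʳ-≤ 1ℚ 0≤δ))
  Pr-bind E f Z {δ} 0≤δ bound (toss t) = ℚ.≤-trans
    (mean-mono (Pr-bind E f Z 0≤δ bound (t false)) (Pr-bind E f Z 0≤δ bound (t true)))
    (ℚ.≤-reflexive (trans (mean-+ (Pr Z (t false)) δ (Pr Z (t true)) δ) (cong (Pr Z (toss t) ℚ.+_) (mean-idem δ))))

  Surely-bind : {Q : B → Set} (f : A → Rand B) → (∀ a → Surely Q (f a)) → ∀ r → Surely Q (r >>= f)
  Surely-bind f q (return a) = q a
  Surely-bind f q (toss t) b = Surely-bind f q (t b)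

Pr-assoc : {A B C : Set} (E : C → Bool) (f : A → Rand B) (g : B → Rand C) → ∀ r →
               Pr E (r >>= f >>= g) ≡ Pr E (r >>= λ a → f a >>= g)
Pr-assoc E f g (return a) = refl
Pr-assoc E f g (toss t)   = cong₂ mean (Pr-assoc E f g (t false)) (Pr-assoc E f g (t true))

Surely-assoc : {A B C : Set} {Q : C → Set} (f : A → Rand B) (g : B → Rand C) → ∀ r →
               Surely Q (r >>= λ a → f a >>= g) → Surely Q (r >>= f >>= g)
Surely-assoc f g (return a) q   = q
Surely-assoc f g (toss t)   q b = Surely-assoc f g (t b) (q b)

½^ : ℕ → ℚ
½^ zero    = 1ℚ
½^ (suc k) = ½ ℚ.* ½^ k

0≤½^ : ∀ k → 0ℚ ℚ.≤ ½^ k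
0≤½^ zero    = 0≤1
0≤½^ (suc k) = ℚ.≤-trans (ℚ.≤-reflexive (sym (ℚ.*-zeroʳ ½))) (ℚ.*-monoˡ-≤-nonNeg ½ (0≤½^ k))

infix 8 _×½^_

-- Errors are counted in units of 2^-k: bounds then add as natural numbers, and comparing an error
-- with 1/3 amounts to 3 j ≤ 2^k.
_×½^_ : ℕ → ℕ → ℚ
zero  ×½^ k = 0ℚ
suc j ×½^ k = ½^ k ℚ.+ j ×½^ k

0≤×½^ : ∀ j k → 0ℚ ℚ.≤ j ×½^ k
0≤×½^ zero    k = ℚ.≤-refl
0≤×½^ (suc j) k = ℚ.+-mono-≤ (0≤½^ k) (0≤×½^ j k)

×½^-+ : ∀ i j k → (i + j) ×½^ k ≡ i ×½^ k ℚ.+ j ×½^ k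
×½^-+ zero    j k = sym (ℚ.+-identityˡ _)
×½^-+ (suc i) j k = trans (cong (½^ k ℚ.+_) (×½^-+ i j k)) (sym (ℚ.+-assoc (½^ k) _ _))

×½^-mono : ∀ {i j} k → i ≤ j → i ×½^ k ℚ.≤ j ×½^ k
×½^-mono k (z≤n {j}) = 0≤×½^ j k
×½^-mono k (s≤s i≤j) = ℚ.+-monoʳ-≤ (½^ k) (×½^-mono k i≤j)

2^×½^ : ∀ k → (2 ^ k) ×½^ k ≡ 1ℚ
2^×½^ zero    = refl
2^×½^ (suc k) = begin
  (2 * 2 ^ k) ×½^ suc k                          ≡⟨ cong (λ j → (2 ^ k + j) ×½^ suc k) (+-identityʳ _) ⟩
  (2 ^ k + 2 ^ k) ×½^ suc k                    ≡⟨ ×½^-+ (2 ^ k) (2 ^ k) (suc k) ⟩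
  (2 ^ k) ×½^ suc k ℚ.+ (2 ^ k) ×½^ suc k        ≡⟨ cong (λ p → p ℚ.+ p) (halve (2 ^ k)) ⟩
  ½ ℚ.* (2 ^ k) ×½^ k ℚ.+ ½ ℚ.* (2 ^ k) ×½^ k    ≡⟨ cong (λ p → ½ ℚ.* p ℚ.+ ½ ℚ.* p) (2^×½^ k) ⟩
  1ℚ                                                 ∎
  where
  open ≡-Reasoning
  halve : ∀ j → j ×½^ suc k ≡ ½ ℚ.* j ×½^ k
  halve zero    = sym (ℚ.*-zeroʳ ½)
  halve (suc j) = trans (cong (½^ (suc k) ℚ.+_) (halve j)) (sym (ℚ.*-distribˡ-+ ½ (½^ k) _))

third : ∀ {j k} → 3 * j ≤ 2 ^ k → ⅔ ℚ.+ j ×½^ k ℚ.≤ 1ℚ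
third {j} {k} 3j≤2^k = begin
  ⅔ ℚ.+ p                             ≡⟨ cong (⅔ ℚ.+_) (thrice p) ⟩
  ⅔ ℚ.+ ⅓ ℚ.* (p ℚ.+ (p ℚ.+ p))       ≡⟨ cong (λ q → ⅔ ℚ.+ ⅓ ℚ.* q) (trans (cong (p ℚ.+_) (sym (×½^-+ j j k))) (sym (×½^-+ j (j + j) k))) ⟩
  ⅔ ℚ.+ ⅓ ℚ.* ((j + (j + j)) ×½^ k) ≤⟨ ℚ.+-monoʳ-≤ ⅔ (ℚ.*-monoˡ-≤-nonNeg ⅓ (×½^-mono k (subst (_≤ 2 ^ k) (cong (λ i → j + (j + i)) (+-identityʳ j)) 3j≤2^k))) ⟩
  ⅔ ℚ.+ ⅓ ℚ.* ((2 ^ k) ×½^ k)       ≡⟨ cong (λ q → ⅔ ℚ.+ ⅓ ℚ.* q) (2^×½^ k) ⟩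
  1ℚ                                  ∎
  where
  open ℚ.≤-Reasoning
  ⅓ = + 1 ℚ./ 3
  p = j ×½^ k
  thrice : ∀ p → p ≡ ⅓ ℚ.* (p ℚ.+ (p ℚ.+ p))
  thrice = solve 1 (λ p → p := con ⅓ :* (p :+ (p :+ p))) refl
    where open +-*-Solver

sampleBits : ∀ k → Rand (Vec Bool k)
sampleBits zero    = return []
sampleBits (suc k) = toss λ b → sampleBits k >>= λ v → return (b ∷ v)

-- An exhaustive search tells which half of the cube may contain the unique point. The other half
-- contributes nothing, so the mean halves the inductive bound.
Pr-unique : ∀ k (Z : Vec Bool k → Bool) → (∀ v w → Z v ≡ true → Z w ≡ true → v ≡ w) →
            Pr Z (sampleBits k) ℚ.≤ ½^ k
Pr-unique zero    Z unique = Pr≤1 Z (sampleBits zero)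
Pr-unique (suc k) Z unique = ℚ.≤-trans
  (ℚ.≤-reflexive (cong₂ mean (Pr-map Z _ _ (λ _ → refl) (sampleBits k)) (Pr-map Z _ _ (λ _ → refl) (sampleBits k))))
  (bound (search k (Z ∘ (false ∷_))))
  where
  search : ∀ k (Y : Vec Bool k → Bool) → (∃ λ v → Y v ≡ true) ⊎ (∀ v → Y v ≡ false)
  search zero Y with Y [] in e
  ... | true  = inj₁ ([] , e)
  ... | false = inj₂ λ { [] → e }
  search (suc k) Y with search k (Y ∘ (false ∷_)) | search k (Y ∘ (true ∷_))
  ... | inj₁ (v , e) | _            = inj₁ (false ∷ v , e)
  ... | inj₂ _       | inj₁ (v , e) = inj₁ (true ∷ v , e)
  ... | inj₂ f       | inj₂ g       = inj₂ λ { (false ∷ v) → f v ; (true ∷ v) → g v }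

  half : Bool → ℚ
  half b = Pr (Z ∘ (b ∷_)) (sampleBits k)

  half≤ : ∀ b → half b ℚ.≤ ½^ k
  half≤ b = Pr-unique k (Z ∘ (b ∷_)) λ v w p q → Vec.∷-injectiveʳ (unique (b ∷ v) (b ∷ w) p q)

  bound : (∃ λ v → Z (false ∷ v) ≡ true) ⊎ (∀ v → Z (false ∷ v) ≡ false) →
          mean (half false) (half true) ℚ.≤ ½^ (suc k)
  bound (inj₁ (v , e)) = ℚ.≤-trans
    (mean-mono (half≤ false) (ℚ.≤-reflexive (Pr-false none (sampleBits k))))
    (ℚ.≤-reflexive (cong (½ ℚ.*_) (ℚ.+-identityʳ (½^ k))))
    where
    none : ∀ w → Z (true ∷ w) ≡ false
    none w with Z (true ∷ w) in e′
    ... | false = refl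
    ... | true with () ← unique (false ∷ v) (true ∷ w) e e′
  bound (inj₂ none) = ℚ.≤-trans
    (mean-mono (ℚ.≤-reflexive (Pr-false none (sampleBits k))) (half≤ true))
    (ℚ.≤-reflexive (cong (½ ℚ.*_) (ℚ.+-identityˡ (½^ k))))

-- Hashing

true≢false : true ≢ false
true≢false ()

sum-single : ∀ {n x} (f : Fin n → ℤ) v → (∀ u → u ≢ v → f u ≡ 0ℤ) → f v ≡ x → sum f ≡ x
sum-single {suc n} f zero    others e = trans
  (cong₂ ℤ._+_ e (trans (sum-cong-≗ (λ u → others (suc u) λ ())) (sum-replicate-zero n))) (ℤ.+-identityʳ _)
sum-single {suc n} f (suc v) others e = trans
  (cong₂ ℤ._+_ (others zero λ ()) (sum-single (f ∘ suc) v (λ u ne → others (suc u) (ne ∘ Fin.suc-injective)) e))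
  (ℤ.+-identityˡ _)

Point : ℕ → ℕ → Set
Point k L = Vec (Vec Bool k) L

samplePoint : ∀ k L → Rand (Point k L)
samplePoint k zero    = return []
samplePoint k (suc L) = sampleBits k >>= λ r → samplePoint k L >>= λ rs → return (r ∷ rs)

coordinate : ℕ → Bool → ℤ
coordinate r false = 1ℤ
coordinate r true  = + r

-- The multilinear monomial of a digit vector. A hash is thus the multilinear polynomial whose
-- coefficients are the hashed vector, evaluated at a random point with only L coordinates.
weight : ∀ {L} → Vec ℕ L → Vec Bool L → ℤ
weight []       []       = 1ℤ
weight (r ∷ rs) (b ∷ bs) = coordinate r b ℤ.* weight rs bs

-- The sum runs over the whole cube, not only over codes of vertices, so that variables can be split
-- off one by one.
cubeSum : ∀ {L} → (Vec Bool L → ℤ) → ℤ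
cubeSum {zero}  f = f []
cubeSum {suc L} f = cubeSum (f ∘ (false ∷_)) ℤ.+ cubeSum (f ∘ (true ∷_))

cubeSum-cong : ∀ {L} {f g : Vec Bool L → ℤ} → (∀ w → f w ≡ g w) → cubeSum f ≡ cubeSum g
cubeSum-cong {zero}  f≗g = f≗g []
cubeSum-cong {suc L} f≗g = cong₂ ℤ._+_ (cubeSum-cong (f≗g ∘ (false ∷_))) (cubeSum-cong (f≗g ∘ (true ∷_)))

cubeSum-+ : ∀ {L} (f g : Vec Bool L → ℤ) → cubeSum (λ w → f w ℤ.+ g w) ≡ cubeSum f ℤ.+ cubeSum g
cubeSum-+ {zero}  f g = refl
cubeSum-+ {suc L} f g = trans
  (cong₂ ℤ._+_ (cubeSum-+ (f ∘ (false ∷_)) (g ∘ (false ∷_))) (cubeSum-+ (f ∘ (true ∷_)) (g ∘ (true ∷_))))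
  (lemma (cubeSum (f ∘ (false ∷_))) (cubeSum (g ∘ (false ∷_))) (cubeSum (f ∘ (true ∷_))) (cubeSum (g ∘ (true ∷_))))
  where lemma : ∀ a b c d → (a ℤ.+ b) ℤ.+ (c ℤ.+ d) ≡ (a ℤ.+ c) ℤ.+ (b ℤ.+ d)
        lemma = solve-∀

cubeSum-sum : ∀ {L n} (f : Vec Bool L → Fin n → ℤ) → cubeSum (λ w → sum (f w)) ≡ sum (λ v → cubeSum (λ w → f w v))
cubeSum-sum {zero}  f = refl
cubeSum-sum {suc L} f = trans
  (cong₂ ℤ._+_ (cubeSum-sum (f ∘ (false ∷_))) (cubeSum-sum (f ∘ (true ∷_))))
  (sym (∑-distrib-+ (λ v → cubeSum (λ w → f (false ∷ w) v)) (λ v → cubeSum (λ w → f (true ∷ w) v))))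

-- The Kronecker delta of the cube.
same : ∀ {L} → Vec Bool L → Vec Bool L → ℤ
same []          []          = 1ℤ
same (false ∷ u) (false ∷ w) = same u w
same (true ∷ u)  (true ∷ w)  = same u w
same (false ∷ u) (true ∷ w)  = 0ℤ
same (true ∷ u)  (false ∷ w) = 0ℤ

same-refl : ∀ {L} (u : Vec Bool L) → same u u ≡ 1ℤ
same-refl []          = refl
same-refl (false ∷ u) = same-refl u
same-refl (true ∷ u)  = same-refl u

same-≢ : ∀ {L} (u w : Vec Bool L) → u ≢ w → same u w ≡ 0ℤ
same-≢ []          []          ne = ⊥-elim (ne refl)
same-≢ (false ∷ u) (false ∷ w) ne = same-≢ u w (ne ∘ cong (false ∷_))
same-≢ (true ∷ u)  (true ∷ w)  ne = same-≢ u w (ne ∘ cong (true ∷_))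
same-≢ (false ∷ u) (true ∷ w)  ne = refl
same-≢ (true ∷ u)  (false ∷ w) ne = refl

cubeSum-0 : ∀ {L} → cubeSum {L} (λ _ → 0ℤ) ≡ 0ℤ
cubeSum-0 {zero}  = refl
cubeSum-0 {suc L} = cong₂ ℤ._+_ (cubeSum-0 {L}) (cubeSum-0 {L})

cubeSum-same : ∀ {L} (u : Vec Bool L) (f : Vec Bool L → ℤ) → cubeSum (λ w → f w ℤ.* same u w) ≡ f u
cubeSum-same []          f = ℤ.*-identityʳ (f [])
cubeSum-same {suc L} (false ∷ u) f = trans
  (cong₂ ℤ._+_ (cubeSum-same u (f ∘ (false ∷_)))
    (trans (cubeSum-cong (λ w → ℤ.*-zeroʳ (f (true ∷ w)))) (cubeSum-0 {L})))
  (ℤ.+-identityʳ (f (false ∷ u)))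
cubeSum-same {suc L} (true ∷ u)  f = trans
  (cong₂ ℤ._+_ (trans (cubeSum-cong (λ w → ℤ.*-zeroʳ (f (false ∷ w)))) (cubeSum-0 {L}))
    (cubeSum-same u (f ∘ (true ∷_))))
  (ℤ.+-identityˡ (f (true ∷ u)))

module Hash (k : ℕ) where

  m : ℕ
  m = fermat k

  open Mod m public
  open Reduce m public

  isZero : ℤ → Bool
  isZero z = does (red z Fin.≟ red 0ℤ)

  isZero-sound : ∀ z → isZero z ≡ true → z ≋ 0ℤ
  isZero-sound z e with red z Fin.≟ red 0ℤ
  ... | yes p = red-≡⇒≋ z 0ℤ p

  isZero-complete : ∀ z → z ≋ 0ℤ → isZero z ≡ true
  isZero-complete z p with red z Fin.≟ red 0ℤ
  ... | yes _ = refl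
  ... | no ne = ⊥-elim (ne (red-cong p))

  -- This is what the Fermat modulus is for: |a - b| is nonzero and below 2^k, hence coprime to m.
  cancel : ∀ {a b} x → a < 2 ^ k → b < 2 ^ k → a ≢ b → (+ a ℤ.- + b) ℤ.* x ≋ 0ℤ → x ≋ 0ℤ
  cancel {a} {b} x a< b< a≢b (congruent p) = congruent (subst (+ m ℤ.∣_) (sym (ℤ.+-identityʳ x))
    (ℤ.∣ᵤ⇒∣ (Coprimality.coprime-divisor (fermat-coprime k d {{≢-nonZero d≢0}} d<)
      (subst (m ∣_) (trans (cong ℤ.∣_∣ (ℤ.+-identityʳ ((+ a ℤ.- + b) ℤ.* x))) (ℤ.abs-* (+ a ℤ.- + b) x)) (ℤ.∣⇒∣ᵤ p)))))
    where
    d = ℤ.∣ + a ℤ.- + b ∣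
    d≢0 : d ≢ 0
    d≢0 e = a≢b (ℤ.+-injective (ℤ.i-j≡0⇒i≡j (+ a) (+ b) (ℤ.∣i∣≡0⇒i≡0 e)))
    d< : d < 2 ^ k
    d< rewrite ℤ.m-n≡m⊖n a b = ≤-<-trans (ℤ.∣m⊝n∣≤m⊔n a b) (⊔-lub a< b<)

  cubeHash : ∀ {L} → (Vec Bool L → ℤ) → Point k L → ℤ
  cubeHash E rs = cubeSum λ w → weight (map val rs) w ℤ.* E w

  -- The coefficients of the polynomial that remains when the first variable takes the value of r.
  substitute : ∀ {L} → (Vec Bool (suc L) → ℤ) → Vec Bool k → Vec Bool L → ℤ
  substitute E r w = E (false ∷ w) ℤ.+ + val r ℤ.* E (true ∷ w)

  cubeHash-∷ : ∀ {L} (E : Vec Bool (suc L) → ℤ) r rs → cubeHash E (r ∷ rs) ≡ cubeHash (substitute E r) rs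
  cubeHash-∷ E r rs = trans
    (sym (cubeSum-+ (λ w → weight (map val (r ∷ rs)) (false ∷ w) ℤ.* E (false ∷ w))
                    (λ w → weight (map val (r ∷ rs)) (true ∷ w) ℤ.* E (true ∷ w))))
    (cubeSum-cong λ w → lemma (weight (map val rs) w) (E (false ∷ w)) (+ val r) (E (true ∷ w)))
    where lemma : ∀ h e r e′ → 1ℤ ℤ.* h ℤ.* e ℤ.+ r ℤ.* h ℤ.* e′ ≡ h ℤ.* (e ℤ.+ r ℤ.* e′)
          lemma = solve-∀

  -- The value of the first coordinate making the tracked coefficient vanish is unique,
  -- because distinct coordinates have an invertible difference.
  cubeHash-zero : ∀ {L} (E : Vec Bool L → ℤ) w → ¬ (E w ≋ 0ℤ) →
                  Pr (isZero ∘ cubeHash E) (samplePoint k L) ℚ.≤ L ×½^ k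
  cubeHash-zero E [] ne with isZero (cubeHash E []) in e
  ... | false = ℚ.≤-refl
  ... | true  = ⊥-elim (ne (subst (_≋ 0ℤ) (ℤ.*-identityˡ (E [])) (isZero-sound _ e)))
  cubeHash-zero {suc L} E (b ∷ w) ne = ℚ.≤-trans
    (Pr-bind (isZero ∘ cubeHash E) _ Z (0≤×½^ L k) rest (sampleBits k))
    (ℚ.+-monoˡ-≤ (L ×½^ k) (Pr-unique k Z unique))
    where
    Z : Vec Bool k → Bool
    Z r = isZero (substitute E r w)

    rest : ∀ r → Z r ≡ false → Pr (isZero ∘ cubeHash E) (samplePoint k L >>= λ rs → return (r ∷ rs)) ℚ.≤ L ×½^ k
    rest r e = ℚ.≤-trans
      (ℚ.≤-reflexive (trans (Pr-map (isZero ∘ cubeHash E) _ (r ∷_) (λ _ → refl) (samplePoint k L))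
                            (Pr-cong (λ rs → cong isZero (cubeHash-∷ E r rs)) (samplePoint k L))))
      (cubeHash-zero (substitute E r) w λ p → true≢false (trans (sym (isZero-complete _ p)) e))

    unique : ∀ r r′ → Z r ≡ true → Z r′ ≡ true → r ≡ r′
    unique r r′ e e′ with val r ≟ val r′
    ... | yes p = val-injective r r′ p
    ... | no  p = ⊥-elim (ne (both b))
      where
      E₀ = E (false ∷ w)
      E₁ = E (true ∷ w)
      difference-lemma : ∀ e a b f → (e ℤ.+ a ℤ.* f) ℤ.+ ℤ.- 1ℤ ℤ.* (e ℤ.+ b ℤ.* f) ≡ (a ℤ.- b) ℤ.* f
      difference-lemma = solve-∀
      remainder-lemma : ∀ e a f → (e ℤ.+ a ℤ.* f) ℤ.+ ℤ.- a ℤ.* f ≡ e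
      remainder-lemma = solve-∀
      -- Subtracting the two vanishing values leaves (r - r′) E₁. So E₁ vanishes and with it E₀,
      -- whichever of them is the tracked coefficient.
      E₁≋0 : E₁ ≋ 0ℤ
      E₁≋0 = cancel E₁ (val-< r) (val-< r′) p
        (subst (_≋ 0ℤ) (difference-lemma E₀ (+ val r) (+ val r′) E₁)
          (+-cong (isZero-sound (substitute E r w) e) (*-cong (≋-refl {ℤ.- 1ℤ}) (isZero-sound (substitute E r′ w) e′))))
      both : ∀ b → E (b ∷ w) ≋ 0ℤ
      both true  = E₁≋0
      both false = subst₂ _≋_ (remainder-lemma E₀ (+ val r) E₁) (cong (ℤ._+_ 0ℤ) (ℤ.*-zeroʳ (ℤ.- (+ val r))))
        (+-cong (isZero-sound (substitute E r w) e) (*-cong (≋-refl {ℤ.- (+ val r)}) E₁≋0))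

  module _ {n L : ℕ} where

    hashWeight : Vec ℕ L → Fin n → ℤ
    hashWeight rs v = weight rs (bits L (toℕ v))

    hash : (Fin n → ℤ) → Vec ℕ L → ℤ
    hash D rs = sum λ v → hashWeight rs v ℤ.* D v

    -- Since n ≤ 2^L, distinct vertices have distinct codes. So D extends by zero to a function E on
    -- the cube that has the same hash and the value D v at the code of v.
    hash-zero : n ≤ 2 ^ L → (D : Fin n → ℤ) (v : Fin n) → ¬ (D v ≋ 0ℤ) →
                Pr (isZero ∘ hash D ∘ map val) (samplePoint k L) ℚ.≤ L ×½^ k
    hash-zero n≤2^L D v ne = ℚ.≤-trans
      (ℚ.≤-reflexive (Pr-cong (λ rs → cong isZero (spread (map val rs))) (samplePoint k L)))
      (cubeHash-zero E (β v) (ne ∘ subst (_≋ 0ℤ) Eβ))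
      where
      β : Fin n → Vec Bool L
      β v = bits L (toℕ v)

      β-injective : ∀ {u v} → β u ≡ β v → u ≡ v
      β-injective {u} {v} e = Fin.toℕ-injective (trans (sym (val-bits L _ (small u))) (trans (cong val e) (val-bits L _ (small v))))
        where small : ∀ u → toℕ u < 2 ^ L
              small u = <-≤-trans (Fin.toℕ<n u) n≤2^L

      E : Vec Bool L → ℤ
      E w = sum λ v → same (β v) w ℤ.* D v

      spread : ∀ rs → hash D rs ≡ cubeSum (λ w → weight rs w ℤ.* E w)
      spread rs = sym (begin
        cubeSum (λ w → weight rs w ℤ.* E w)
          ≡⟨ cubeSum-cong (λ w → *-distribˡ-sum (weight rs w) (λ u → same (β u) w ℤ.* D u)) ⟩
        cubeSum (λ w → sum λ u → weight rs w ℤ.* (same (β u) w ℤ.* D u))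
          ≡⟨ cubeSum-sum (λ w u → weight rs w ℤ.* (same (β u) w ℤ.* D u)) ⟩
        sum (λ u → cubeSum λ w → weight rs w ℤ.* (same (β u) w ℤ.* D u))
          ≡⟨ sum-cong-≗ (λ u → trans (cubeSum-cong (λ w → lemma (weight rs w) (same (β u) w) (D u))) (cubeSum-same (β u) (λ w → weight rs w ℤ.* D u))) ⟩
        hash D rs ∎)
        where
        open ≡-Reasoning
        lemma : ∀ a b c → a ℤ.* (b ℤ.* c) ≡ a ℤ.* c ℤ.* b
        lemma = solve-∀

      Eβ : E (β v) ≡ D v
      Eβ = sum-single _ v (λ u u≢v → trans (cong (ℤ._* D u) (same-≢ (β u) (β v) (u≢v ∘ β-injective))) (ℤ.*-zeroˡ (D u)))
        (trans (cong (ℤ._* D v) (same-refl (β v))) (ℤ.*-identityˡ (D v)))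

-- Transcripts

rounds-∷ : ∀ x t → rounds t ≤ rounds (x ∷ t) × rounds (x ∷ t) ≤ suc (rounds t)
rounds-∷ (V , _) []            = z≤n , ≤-refl
rounds-∷ (P , _) []            = z≤n , ≤-refl
rounds-∷ (V , _) ((V , _) ∷ t) = ≤-refl , n≤1+n _
rounds-∷ (P , _) ((P , _) ∷ t) = ≤-refl , n≤1+n _
rounds-∷ (V , _) ((P , _) ∷ t) = n≤1+n _ , ≤-refl
rounds-∷ (P , _) ((V , _) ∷ t) = n≤1+n _ , ≤-refl

-- Stated one bit ahead, so that it is invariant while c keeps speaking, however long the message; a
-- change of speaker then costs one round by `rounds≤⇒within`.
WithinRounds : Party → ℕ → Transcript → Set
WithinRounds c r t = ∀ b → rounds ((c , b) ∷ t) ≤ r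

within-∷ : ∀ c t b {r} → WithinRounds c r t → WithinRounds c r ((c , b) ∷ t)
within-∷ V t b h _ = h b
within-∷ P t b h _ = h b

within⇒rounds≤ : ∀ c t {r} → WithinRounds c r t → rounds t ≤ r
within⇒rounds≤ c t h = ≤-trans (proj₁ (rounds-∷ (c , true) t)) (h true)

rounds≤⇒within : ∀ c t {r} → rounds t ≤ r → WithinRounds c (suc r) t
rounds≤⇒within c t h b = ≤-trans (proj₂ (rounds-∷ (c , b) t)) (s≤s h)

module _ {T : Set} (𝒱 : Verifier T) where
  open Verifier 𝒱

  interact-halt : ∀ k p s t {o} → move s ≡ halt o → interact 𝒱 k p s t ≡ return (halted o , t)
  interact-halt k p s t e rewrite e = refl

  interact-receive : ∀ k p s t {s′} → move s ≡ receive → received (p t) s ≡ return s′ →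
                     interact 𝒱 (suc k) p s t ≡ interact 𝒱 k p s′ ((P , p t) ∷ t)
  interact-receive k p s t e e′ rewrite e | e′ = refl

  interact-send : ∀ k p s t {b s′} → move s ≡ send b → sent s ≡ return s′ →
                  interact 𝒱 (suc k) p s t ≡ interact 𝒱 k p s′ ((V , b) ∷ t)
  interact-send k p s t e e′ rewrite e | e′ = refl

-- Machines that exchange words, most significant bit first

foldFin : ∀ {A : Set} n → (Fin n → A → A) → A → A
foldFin zero    g a = a
foldFin (suc n) g a = foldFin n (g ∘ suc) (g zero a)

infixl 8 _≫_

-- A right shift with the last halving outermost: x ≫ c is bit c followed onto 2 (x ≫ suc c), which
-- is one step of receiving x from its top bit.
_≫_ : ℕ → ℕ → ℕ
x ≫ zero  = x
x ≫ suc c = (x ≫ c) / 2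

≫-zero : ∀ c x → x < 2 ^ c → x ≫ c ≡ 0
≫-zero c x x< = n<1⇒n≡0 (subst (λ e → x ≫ c < 2 ^ e) (n∸n≡0 c) (go c ≤-refl))
  where
  go : ∀ d → d ≤ c → x ≫ d < 2 ^ (c ∸ d)
  go zero    _   = x<
  go (suc d) d<c = m<n*o⇒m/o<n (subst (x ≫ d <_) (trans (cong (2 ^_) (sym (suc[m]∸n d c d<c))) (*-comm 2 (2 ^ (c ∸ suc d)))) (go d (<⇒≤ d<c)))
    where
    suc[m]∸n : ∀ d c → d < c → suc (c ∸ suc d) ≡ c ∸ d
    suc[m]∸n d c d<c = sym (+-∸-assoc 1 d<c)

drop-∷ : ∀ {A : Set} i (l : List A) {x xs} → drop i l ≡ x ∷ xs → i < length l × drop (suc i) l ≡ xs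
drop-∷ zero    (y ∷ l) refl = s≤s z≤n , refl
drop-∷ (suc i) (y ∷ l) e with i< , e′ ← drop-∷ i l e = s≤s i< , e′

bitAt : ℕ → ℕ → Bool
bitAt c x = odd (x ≫ c)

module Machine (Item : Set) (sched : List Item) (w K : ℕ) .{{_ : NonZero K}} (K≤2^W : K ≤ 2 ^ suc w) where

  N : ℕ
  N = length sched

  -- `ctr` is the index of the next bit of the current word, counting down from w; `word` collects
  -- the bits that have passed. The extra position N means that the schedule is finished.
  record MState (D : Set) : Set where
    constructor state
    field
      pos  : Fin (suc N)
      ctr  : Fin (suc w)
      word : Fin K
      dat  : D

  0# : Fin K
  0# = 0 mod K

  -- Reduced modulo K so that every bit string of a dishonest prover still yields a word. Prefixes
  -- of a genuine word are below K and are not altered.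
  push : Bool → Fin K → Fin K
  push b a = (bit b + 2 * toℕ a) mod K

  todo : Fin (suc N) → List Item
  todo pos = drop (toℕ pos) sched

  -- The wrap-around does not occur in a run, because the machine halts at position N.
  next : Fin (suc N) → Fin (suc N)
  next pos = suc (toℕ pos) mod suc N

  atBlock : {D : Set} → Fin (suc N) → D → MState D
  atBlock pos d = state pos (fromℕ w) 0# d

  module _ {D : Set} (update : Item → Fin K → D → D) where

    finish : List Item → Fin K → D → D
    finish []      a d = d
    finish (x ∷ _) a d = update x a d

    -- One transition for both directions: a word that is sent is reassembled as well. So replaying
    -- the bits of a transcript needs no knowledge of who spoke.
    advance : Bool → MState D → MState D
    advance b (state pos zero    a d) = atBlock (next pos) (finish (todo pos) (push b a) d)
    advance b (state pos (suc c) a d) = state pos (inject₁ c) (push b a) d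

  todo-next : ∀ pos {x xs} → todo pos ≡ x ∷ xs → todo (next pos) ≡ xs
  todo-next pos {x} {xs} e with pos<N , e′ ← drop-∷ (toℕ pos) sched e =
    trans (cong (λ i → drop i sched) (trans (Fin.toℕ-fromℕ< (m%n<n (suc (toℕ pos)) (suc N))) (m<n⇒m%n≡m (s≤s pos<N)))) e′

  toℕ-0# : toℕ 0# ≡ 0
  toℕ-0# = trans (Fin.toℕ-fromℕ< (m%n<n 0 K)) (m<n⇒m%n≡m (>-nonZero⁻¹ K))

  -- The invariant of a transmission: before bit c passes, the accumulator holds x ≫ suc c.
  push-bitAt : ∀ c (x a : Fin K) → toℕ a ≡ toℕ x ≫ suc c → toℕ (push (bitAt c (toℕ x)) a) ≡ toℕ x ≫ c
  push-bitAt c x a e = begin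
    toℕ ((bit (bitAt c (toℕ x)) + 2 * toℕ a) mod K)   ≡⟨ Fin.toℕ-fromℕ< (m%n<n _ K) ⟩
    (bit (bitAt c (toℕ x)) + 2 * toℕ a) % K           ≡⟨ cong (λ y → (bit (bitAt c (toℕ x)) + 2 * y) % K) e ⟩
    (bit (odd (toℕ x ≫ c)) + 2 * (toℕ x ≫ c / 2)) % K ≡⟨ cong (_% K) (bit-odd+2*half (toℕ x ≫ c)) ⟩
    (toℕ x ≫ c) % K                                   ≡⟨ m<n⇒m%n≡m (≤-<-trans (≫-≤ c) (Fin.toℕ<n x)) ⟩
    toℕ x ≫ c                                         ∎
    where
    open ≡-Reasoning
    ≫-≤ : ∀ c → toℕ x ≫ c ≤ toℕ x
    ≫-≤ zero    = ≤-refl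
    ≫-≤ (suc c) = ≤-trans (m/n≤m (toℕ x ≫ c) 2) (≫-≤ c)

  0#≫ : (x : Fin K) → toℕ 0# ≡ toℕ x ≫ suc w
  0#≫ x = trans toℕ-0# (sym (≫-zero (suc w) (toℕ x) (<-≤-trans (Fin.toℕ<n x) K≤2^W)))

  readWord : (Transcript → Bool) → ℕ → Fin K → Transcript → Fin K × Transcript
  readWord p zero    a t = push (p t) a , (P , p t) ∷ t
  readWord p (suc c) a t = readWord p c (push (p t) a) ((P , p t) ∷ t)

  writeWord : ℕ → Fin K → Transcript → Transcript
  writeWord zero    x t = (V , bitAt zero (toℕ x)) ∷ t
  writeWord (suc c) x t = writeWord c x ((V , bitAt (suc c) (toℕ x)) ∷ t)

  within-readWord : ∀ p c a t {r} → WithinRounds P r t → WithinRounds P r (proj₂ (readWord p c a t))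
  within-readWord p zero    a t h = within-∷ P t (p t) h
  within-readWord p (suc c) a t h = within-readWord p c _ _ (within-∷ P t (p t) h)

  within-writeWord : ∀ c x t {r} → WithinRounds V r t → WithinRounds V r (writeWord c x t)
  within-writeWord zero    x t h = within-∷ V t (bitAt zero (toℕ x)) h
  within-writeWord (suc c) x t h = within-writeWord c x _ (within-∷ V t (bitAt (suc c) (toℕ x)) h)

  afterWords : (Transcript → Bool) → ℕ → Transcript → Transcript
  afterWords p zero    t = t
  afterWords p (suc i) t = afterWords p i (proj₂ (readWord p w 0# t))

  wordAt : (Transcript → Bool) → Transcript → ℕ → Fin K
  wordAt p t i = proj₁ (readWord p w 0# (afterWords p i t))

  writeWords : ∀ {n} → (Fin n → Fin K) → Transcript → Transcript
  writeWords {n} msg = foldFin n (λ i → writeWord w (msg i))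

  within-afterWords : ∀ p i t {r} → WithinRounds P r t → WithinRounds P r (afterWords p i t)
  within-afterWords p zero    t h = h
  within-afterWords p (suc i) t h = within-afterWords p i _ (within-readWord p w 0# t h)

  within-writeWords : ∀ {n} (msg : Fin n → Fin K) t {r} → WithinRounds V r t → WithinRounds V r (writeWords msg t)
  within-writeWords {zero}  msg t h = h
  within-writeWords {suc n} msg t h = within-writeWords (msg ∘ suc) _ (within-writeWord w (msg zero) t h)

  module Verify {T Key D : Set} (initial : Rand Key) (start : Key → D) (readD : T → D → D) (update : Item → Fin K → D → D)
                (speak : Item → Maybe (D → Fin K)) (verdict : D → Maybe ℕ) where

    moveAt : List Item → ℕ → D → Move
    moveAt []      c d = halt (verdict d)
    moveAt (x ∷ _) c d with speak x
    ... | nothing  = receive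
    ... | just msg = send (bitAt c (toℕ (msg d)))

    sentBit : Move → Bool
    sentBit (send b) = b
    sentBit receive  = false
    sentBit (halt _) = false

    moveM : MState D → Move
    moveM (state pos c a d) = moveAt (todo pos) (toℕ c) d

    verifier : Verifier T
    verifier = record
      { State       = MState D
      ; init        = initial >>= λ κ → return (atBlock zero (start κ))
      ; read        = λ e (state pos c a d) → return (state pos c a (readD e d))
      ; endOfStream = return
      ; move        = moveM
      ; sent        = λ s → return (advance update (sentBit (moveM s)) s)
      ; received    = λ b s → return (advance update b s)
      }

    run : (Transcript → Bool) → List Item → D → Transcript → D × Transcript
    run p []       d t = d , t
    run p (x ∷ xs) d t with speak x
    ... | nothing  = run p xs (update x (proj₁ (readWord p w 0# t)) d) (proj₂ (readWord p w 0# t))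
    ... | just msg = run p xs (update x (msg d) d) (writeWord w (msg d) t)

    private
      receiveWord : ∀ p k c {pos ctr} a d t {x xs} → toℕ ctr ≡ c → todo pos ≡ x ∷ xs → speak x ≡ nothing →
        interact verifier (suc c + k) p (state pos ctr a d) t
        ≡ interact verifier k p (atBlock (next pos) (update x (proj₁ (readWord p c a t)) d)) (proj₂ (readWord p c a t))
      receiveWord p k zero    {pos} {zero}    a d t {x} {xs} e todo≡ speak≡ =
        interact-receive verifier k p (state pos zero a d) t moves stepped
        where
        moves : moveAt (todo pos) 0 d ≡ receive
        moves rewrite todo≡ | speak≡ = refl
        stepped : return (advance update (p t) (state pos zero a d)) ≡ return (atBlock (next pos) (update x (push (p t) a) d))
        stepped rewrite todo≡ = refl
      receiveWord p k (suc c) {pos} {suc ctr} a d t {x} {xs} e todo≡ speak≡ = trans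
        (interact-receive verifier (suc c + k) p (state pos (suc ctr) a d) t moves refl)
        (receiveWord p k c (push (p t) a) d ((P , p t) ∷ t) (trans (Fin.toℕ-inject₁ ctr) (suc-injective e)) todo≡ speak≡)
        where
        moves : moveAt (todo pos) (suc (toℕ ctr)) d ≡ receive
        moves rewrite todo≡ | speak≡ = refl

      sendWord : ∀ p k c {pos ctr} a d t {x xs msg} → toℕ ctr ≡ c → todo pos ≡ x ∷ xs → speak x ≡ just msg →
        toℕ a ≡ toℕ (msg d) ≫ suc c →
        interact verifier (suc c + k) p (state pos ctr a d) t
        ≡ interact verifier k p (atBlock (next pos) (update x (msg d) d)) (writeWord c (msg d) t)
      sendWord p k zero    {pos} {zero}    a d t {x} {xs} {msg} e todo≡ speak≡ a≡ =
        interact-send verifier k p (state pos zero a d) t moves stepped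
        where
        moves : moveAt (todo pos) 0 d ≡ send (bitAt 0 (toℕ (msg d)))
        moves rewrite todo≡ | speak≡ = refl
        stepped : return (advance update (sentBit (moveAt (todo pos) 0 d)) (state pos zero a d)) ≡ return (atBlock (next pos) (update x (msg d) d))
        stepped rewrite moves | todo≡ = cong (λ y → return (atBlock (next pos) (update x y d)))
          (Fin.toℕ-injective (push-bitAt 0 (msg d) a a≡))
      sendWord p k (suc c) {pos} {suc ctr} a d t {x} {xs} {msg} e todo≡ speak≡ a≡ = trans
        (interact-send verifier (suc c + k) p (state pos (suc ctr) a d) t moves (cong (λ b → return (advance update (sentBit b) (state pos (suc ctr) a d))) moves))
        (sendWord p k c (push (bitAt (suc c) (toℕ (msg d))) a) d ((V , bitAt (suc c) (toℕ (msg d))) ∷ t)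
          (trans (Fin.toℕ-inject₁ ctr) (suc-injective e)) todo≡ speak≡ (push-bitAt (suc c) (msg d) a a≡))
        where
        moves : moveAt (todo pos) (suc (toℕ ctr)) d ≡ send (bitAt (suc c) (toℕ (msg d)))
        moves rewrite todo≡ | speak≡ | suc-injective e = refl

    -- Every item consumes exactly w + 1 bits, so the budget is exhausted just when the schedule
    -- ends; halting then needs no further budget.
    interact-run : ∀ p xs pos d t → todo pos ≡ xs →
      interact verifier (length xs * suc w) p (atBlock pos d) t
      ≡ return (halted (verdict (proj₁ (run p xs d t))) , proj₂ (run p xs d t))
    interact-run p []       pos d t todo≡ = interact-halt verifier 0 p (atBlock pos d) t moves
      where
      moves : moveAt (todo pos) (toℕ (fromℕ w)) d ≡ halt (verdict d)
      moves rewrite todo≡ = refl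
    interact-run p (x ∷ xs) pos d t todo≡ with speak x in speak≡
    ... | nothing  = trans
      (receiveWord p (length xs * suc w) w 0# d t (Fin.toℕ-fromℕ w) todo≡ speak≡)
      (interact-run p xs (next pos) _ _ (todo-next pos todo≡))
    ... | just msg = trans
      (sendWord p (length xs * suc w) w 0# d t (Fin.toℕ-fromℕ w) todo≡ speak≡ (0#≫ (msg d)))
      (interact-run p xs (next pos) _ _ (todo-next pos todo≡))

    run-receive : ∀ p {n} (f : Fin n → Item) → (∀ i → speak (f i) ≡ nothing) → ∀ ys d t →
      run p (tabulate f ++ ys) d t
      ≡ run p ys (foldFin n (λ i → update (f i) (wordAt p t (toℕ i))) d) (afterWords p n t)
    run-receive p {zero}  f silent ys d t = refl
    run-receive p {suc n} f silent ys d t rewrite silent zero =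
      run-receive p (f ∘ suc) (silent ∘ suc) ys _ (proj₂ (readWord p w 0# t))

    run-send : ∀ p {n} (f : Fin n → Item) (msg : Fin n → D → Fin K) → (∀ i → speak (f i) ≡ just (msg i)) →
      (∀ i a d → update (f i) a d ≡ d) → ∀ ys d t →
      run p (tabulate f ++ ys) d t ≡ run p ys d (writeWords (λ i → msg i d) t)
    run-send p {zero}  f msg loud keeps ys d t = refl
    run-send p {suc n} f msg loud keeps ys d t rewrite loud zero | keeps zero (msg zero d) d =
      run-send p (f ∘ suc) (msg ∘ suc) (loud ∘ suc) (keeps ∘ suc) ys d (writeWord w (msg zero d) t)

    reads : List T → D → D
    reads []      d = d
    reads (e ∷ τ) d = reads τ (readD e d)

    outcome : (Transcript → Bool) → D → Outcome × Transcript
    outcome p d = halted (verdict (proj₁ (run p sched d []))) , proj₂ (run p sched d [])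

    private
      afterInit : Prover T → List T → Key → Rand (Outcome × Transcript)
      afterInit 𝒫 τ κ = Verifier.readAll verifier τ (atBlock zero (start κ)) >>= λ s →
        interact verifier (N * suc w) (𝒫 τ) s []

      readAll-reads : ∀ τ d → Verifier.readAll verifier τ (atBlock zero d) ≡ return (atBlock zero (reads τ d))
      readAll-reads []      d = refl
      readAll-reads (e ∷ τ) d = readAll-reads τ (readD e d)

      afterInit-outcome : ∀ 𝒫 τ κ → afterInit 𝒫 τ κ ≡ return (outcome (𝒫 τ) (reads τ (start κ)))
      afterInit-outcome 𝒫 τ κ = trans
        (cong (_>>= λ s → interact verifier (N * suc w) (𝒫 τ) s []) (readAll-reads τ (start κ)))
        (interact-run (𝒫 τ) sched zero (reads τ (start κ)) [] refl)

    -- After the key has been drawn everything is deterministic, so events of the execution are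
    -- events of the key.
    execute-Pr : ∀ E 𝒫 τ →
      Pr E (execute verifier (N * suc w) 𝒫 τ) ≡ Pr (λ κ → E (outcome (𝒫 τ) (reads τ (start κ)))) initial
    execute-Pr E 𝒫 τ = begin
      Pr E (init >>= readAll τ >>= return >>= I)     ≡⟨ Pr-assoc E return I (init >>= readAll τ) ⟩
      Pr E (init >>= readAll τ >>= I)                ≡⟨ Pr-assoc E (readAll τ) I init ⟩
      Pr E (init >>= λ s → readAll τ s >>= I)        ≡⟨ Pr-assoc E (λ κ → return (atBlock zero (start κ))) (λ s → readAll τ s >>= I) initial ⟩
      Pr E (initial >>= afterInit 𝒫 τ)               ≡⟨ Pr-map E _ _ (afterInit-outcome 𝒫 τ) initial ⟩
      Pr (λ κ → E (outcome (𝒫 τ) (reads τ (start κ)))) initial ∎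
      where
      open ≡-Reasoning
      open Verifier verifier using (init; readAll)
      I = λ s → interact verifier (N * suc w) (𝒫 τ) s []

    execute-Surely : ∀ {Q} 𝒫 τ → (∀ d → Q (outcome (𝒫 τ) d)) → Surely Q (execute verifier (N * suc w) 𝒫 τ)
    execute-Surely {Q} 𝒫 τ q =
      Surely-assoc return I (init >>= readAll τ) (Surely-assoc (readAll τ) I init
        (Surely-assoc (λ κ → return (atBlock zero (start κ))) (λ s → readAll τ s >>= I) initial
          (Surely-bind (afterInit 𝒫 τ) (λ κ → subst (Surely Q) (sym (afterInit-outcome 𝒫 τ κ)) (q _)) initial)))
      where
      open Verifier verifier using (init; readAll)
      I = λ s → interact verifier (N * suc w) (𝒫 τ) s []

  -- A prover that replays the transcript on its own copy of the machine.
  module Prove {D : Set} (d₀ : D) (update : Item → Fin K → D → D) (say : Item → D → Fin K) where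

    mirror : Transcript → MState D
    mirror []            = atBlock zero d₀
    mirror ((_ , b) ∷ t) = advance update b (mirror t)

    reply : List Item → ℕ → D → Bool
    reply []      c d = false
    reply (x ∷ _) c d = bitAt c (toℕ (say x d))

    replyM : MState D → Bool
    replyM (state pos c a d) = reply (todo pos) (toℕ c) d

    prover : Transcript → Bool
    prover t = replyM (mirror t)

    Awaits : Transcript → List Item → D → Set
    Awaits t xs d = ∃ λ pos → mirror t ≡ atBlock pos d × todo pos ≡ xs

    awaits-[] : Awaits [] sched d₀
    awaits-[] = zero , refl , refl

    private
      readWord-reply : ∀ c {pos ctr a d t x xs} → toℕ ctr ≡ c → todo pos ≡ x ∷ xs → mirror t ≡ state pos ctr a d →
        toℕ a ≡ toℕ (say x d) ≫ suc c →
        proj₁ (readWord prover c a t) ≡ say x d ×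
        mirror (proj₂ (readWord prover c a t)) ≡ atBlock (next pos) (update x (say x d) d)
      readWord-reply zero    {pos} {zero}    {a} {d} {t} {x} e todo≡ mirror≡ a≡ =
        word≡ , trans (cong (λ s → advance update (prover t) s) mirror≡) stepped
        where
        bit≡ : prover t ≡ bitAt 0 (toℕ (say x d))
        bit≡ rewrite mirror≡ | todo≡ = refl
        word≡ : push (prover t) a ≡ say x d
        word≡ = trans (cong (λ b → push b a) bit≡) (Fin.toℕ-injective (push-bitAt 0 (say x d) a a≡))
        stepped : advance update (prover t) (state pos zero a d) ≡ atBlock (next pos) (update x (say x d) d)
        stepped rewrite todo≡ = cong (λ y → atBlock (next pos) (update x y d)) word≡
      readWord-reply (suc c) {pos} {suc ctr} {a} {d} {t} {x} e todo≡ mirror≡ a≡ =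
        readWord-reply c (trans (Fin.toℕ-inject₁ ctr) (suc-injective e)) todo≡
          (cong (λ s → advance update (prover t) s) mirror≡)
          (trans (cong (λ b → toℕ (push b a)) bit≡) (push-bitAt (suc c) (say x d) a a≡))
        where
        bit≡ : prover t ≡ bitAt (suc c) (toℕ (say x d))
        bit≡ rewrite mirror≡ | todo≡ | suc-injective e = refl

      mirror-writeWord : ∀ c {pos ctr a d t x xs} y → toℕ ctr ≡ c → todo pos ≡ x ∷ xs → mirror t ≡ state pos ctr a d →
        toℕ a ≡ toℕ y ≫ suc c → mirror (writeWord c y t) ≡ atBlock (next pos) (update x y d)
      mirror-writeWord zero    {pos} {zero}    {a} {d} {t} {x} y e todo≡ mirror≡ a≡ =
        trans (cong (advance update (bitAt 0 (toℕ y))) mirror≡) stepped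
        where
        stepped : advance update (bitAt 0 (toℕ y)) (state pos zero a d) ≡ atBlock (next pos) (update x y d)
        stepped rewrite todo≡ = cong (λ z → atBlock (next pos) (update x z d)) (Fin.toℕ-injective (push-bitAt 0 y a a≡))
      mirror-writeWord (suc c) {pos} {suc ctr} {a} {d} {t} {x} y e todo≡ mirror≡ a≡ =
        mirror-writeWord c y (trans (Fin.toℕ-inject₁ ctr) (suc-injective e)) todo≡
          (cong (advance update (bitAt (suc c) (toℕ y))) mirror≡) (push-bitAt (suc c) y a a≡)

    awaits-receive : ∀ {n} (f : Fin n → Item) d → (∀ i a → update (f i) a d ≡ d) → ∀ {ys t} →
      Awaits t (tabulate f ++ ys) d →
      (∀ i → wordAt prover t (toℕ i) ≡ say (f i) d) × Awaits (afterWords prover n t) ys d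
    awaits-receive {zero}  f d keeps aw = (λ ()) , aw
    awaits-receive {suc n} f d keeps {ys} {t} (pos , mirror≡ , todo≡)
      with word≡ , mirror′ ← readWord-reply w (Fin.toℕ-fromℕ w) todo≡ mirror≡ (0#≫ (say (f zero) d))
      with words≡ , aw ← awaits-receive (f ∘ suc) d (keeps ∘ suc) {ys} {proj₂ (readWord prover w 0# t)}
             (next pos , trans mirror′ (cong (atBlock (next pos)) (keeps zero (say (f zero) d))) , todo-next pos todo≡)
      = (λ { zero → word≡ ; (suc i) → words≡ i }) , aw

    awaits-send : ∀ {n} (f : Fin n → Item) (msg : Fin n → Fin K) {d ys t} → Awaits t (tabulate f ++ ys) d →
      Awaits (writeWords msg t) ys (foldFin n (λ i → update (f i) (msg i)) d)
    awaits-send {zero}  f msg aw = aw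
    awaits-send {suc n} f msg (pos , mirror≡ , todo≡) = awaits-send (f ∘ suc) (msg ∘ suc)
      (next pos , mirror-writeWord w (msg zero) (Fin.toℕ-fromℕ w) todo≡ mirror≡ (0#≫ (msg zero)) , todo-next pos todo≡)

-- Packing several numbers into one

module Packing (B : ℕ) .{{_ : NonZero B}} where

  pack : ∀ {k} → Vec ℕ k → ℕ
  pack []       = 0
  pack (x ∷ xs) = x + B * pack xs

  unpack : ∀ k → ℕ → Vec ℕ k
  unpack zero    z = []
  unpack (suc k) z = z % B ∷ unpack k (z / B)

  module _ {x : ℕ} (y : ℕ) (x<B : x < B) where

    low : (x + B * y) % B ≡ x
    low = trans (cong (λ z → (x + z) % B) (*-comm B y)) (trans ([m+kn]%n≡m%n x y B) (m<n⇒m%n≡m x<B))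

    high : (x + B * y) / B ≡ y
    high = trans (cong (λ z → (x + z) / B) (*-comm B y))
      (trans (+-distrib-/-∣ʳ x (n∣m*n y)) (cong₂ _+_ (m<n⇒m/n≡0 x<B) (m*n/n≡m y B)))

    below : ∀ {C} → y < C → x + B * y < B * C
    below {C} y<C = begin-strict
      x + B * y   <⟨ +-monoˡ-< (B * y) x<B ⟩
      B + B * y   ≡⟨ *-suc B y ⟨
      B * suc y   ≤⟨ *-monoʳ-≤ B y<C ⟩
      B * C       ∎
      where open ≤-Reasoning

  unpack-pack : ∀ {k} {xs : Vec ℕ k} → All (_< B) xs → unpack k (pack xs) ≡ xs
  unpack-pack []                      = refl
  unpack-pack {xs = x ∷ xs} (x< ∷ xs<) =
    cong₂ _∷_ (low (pack xs) x<) (trans (cong (unpack _) (high (pack xs) x<)) (unpack-pack xs<))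

  pack-< : ∀ {k} {xs : Vec ℕ k} → All (_< B) xs → pack xs < B ^ k
  pack-< []                       = s≤s z≤n
  pack-< {xs = x ∷ xs} (x< ∷ xs<) = below (pack xs) x< (pack-< xs<)

  -- No bound on the entries is required: packing is evaluation of a polynomial at B, which is
  -- linear even when digits overflow. Bounds matter only for unpacking.
  pack-zipWith : ∀ {k} (xs ys : Vec ℕ k) → pack (zipWith _+_ xs ys) ≡ pack xs + pack ys
  pack-zipWith []       []       = refl
  pack-zipWith (x ∷ xs) (y ∷ ys) = trans (cong (λ z → x + y + B * z) (pack-zipWith xs ys))
    (lemma x y (pack xs) (pack ys) B)
    where
    lemma : ∀ x y s t B → x + y + B * (s + t) ≡ x + B * s + (y + B * t)
    lemma = ℕ-Solver.solve-∀

  pack-map : ∀ {k} a (xs : Vec ℕ k) → pack (map (a *_) xs) ≡ a * pack xs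
  pack-map a []       = sym (*-zeroʳ a)
  pack-map a (x ∷ xs) = trans (cong (λ z → a * x + B * z) (pack-map a xs)) (lemma a x (pack xs) B)
    where
    lemma : ∀ a x s B → a * x + B * (a * s) ≡ a * (x + B * s)
    lemma = ℕ-Solver.solve-∀

  pack-replicate : ∀ k → pack (replicate k 0) ≡ 0
  pack-replicate zero    = refl
  pack-replicate (suc k) = trans (cong (B *_) (pack-replicate k)) (*-zeroʳ B)

dot : ∀ {k} → Vec ℤ k → Vec ℕ k → ℤ
dot []       []       = 0ℤ
dot (c ∷ cs) (x ∷ xs) = c ℤ.* + x ℤ.+ dot cs xs

dot-zipWith : ∀ {k} (cs : Vec ℤ k) xs ys → dot cs (zipWith _+_ xs ys) ≡ dot cs xs ℤ.+ dot cs ys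
dot-zipWith []       []       []       = refl
dot-zipWith (c ∷ cs) (x ∷ xs) (y ∷ ys) = trans (cong₂ (λ s t → c ℤ.* s ℤ.+ t) (ℤ.pos-+ x y) (dot-zipWith cs xs ys))
  (lemma c (+ x) (+ y) (dot cs xs) (dot cs ys))
  where lemma : ∀ c x y s t → c ℤ.* (x ℤ.+ y) ℤ.+ (s ℤ.+ t) ≡ c ℤ.* x ℤ.+ s ℤ.+ (c ℤ.* y ℤ.+ t)
        lemma = solve-∀

dot-map : ∀ {k} (cs : Vec ℤ k) a xs → dot cs (map (a *_) xs) ≡ + a ℤ.* dot cs xs
dot-map []       a []       = sym (ℤ.*-zeroʳ (+ a))
dot-map (c ∷ cs) a (x ∷ xs) = trans (cong₂ (λ s t → c ℤ.* s ℤ.+ t) (ℤ.pos-* a x) (dot-map cs a xs))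
  (lemma c (+ a) (+ x) (dot cs xs))
  where lemma : ∀ c a x s → c ℤ.* (a ℤ.* x) ℤ.+ a ℤ.* s ≡ a ℤ.* (c ℤ.* x ℤ.+ s)
        lemma = solve-∀

dot-replicate : ∀ {k} (cs : Vec ℤ k) → dot cs (replicate k 0) ≡ 0ℤ
dot-replicate []       = refl
dot-replicate (c ∷ cs) = cong₂ ℤ._+_ (ℤ.*-zeroʳ c) (dot-replicate cs)

weightedSum : ∀ {n k} → (Fin n → ℕ) → (Fin n → Vec ℕ k) → Vec ℕ k
weightedSum {zero}  a x = replicate _ 0
weightedSum {suc n} a x = zipWith _+_ (map (a zero *_) (x zero)) (weightedSum (a ∘ suc) (x ∘ suc))

-- By linearity a test applied to the claimed moments of v is a sum of one test value per neighbour.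
dot-weightedSum : ∀ {n k} (cs : Vec ℤ k) (a : Fin n → ℕ) x →
                  dot cs (weightedSum a x) ≡ sum (λ u → + a u ℤ.* dot cs (x u))
dot-weightedSum {zero}  cs a x = dot-replicate cs
dot-weightedSum {suc n} cs a x = trans (dot-zipWith cs (map (a zero *_) (x zero)) (weightedSum (a ∘ suc) (x ∘ suc)))
  (cong₂ ℤ._+_ (dot-map cs (a zero) (x zero)) (dot-weightedSum cs (a ∘ suc) (x ∘ suc)))

-- Lets a single matrix-vector product, with the packed features, stand for all six.
pack-weightedSum : ∀ B .{{_ : NonZero B}} {n k} (a : Fin n → ℕ) (x : Fin n → Vec ℕ k) → let open Packing B in
                   + pack (weightedSum a x) ≡ sum (λ u → + a u ℤ.* + pack (x u))
pack-weightedSum B {zero}  {k} a x = cong +_ (Packing.pack-replicate B k)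
pack-weightedSum B {suc n} a x = trans
  (cong +_ (trans (pack-zipWith (map (a zero *_) (x zero)) (weightedSum (a ∘ suc) (x ∘ suc)))
                  (cong (_+ pack (weightedSum (a ∘ suc) (x ∘ suc))) (pack-map (a zero) (x zero)))))
  (trans (ℤ.pos-+ (a zero * pack (x zero)) _)
         (cong₂ ℤ._+_ (ℤ.pos-* (a zero) (pack (x zero))) (pack-weightedSum B (a ∘ suc) (x ∘ suc))))
  where open Packing B

weightedSum-≤ : ∀ {n k} (a : Fin n → ℕ) (x : Fin n → Vec ℕ k) {C} → (∀ u → a u ≤ 1) → (∀ u → All (_≤ C) (x u)) →
                All (_≤ n * C) (weightedSum a x)
weightedSum-≤ {zero}  {k} a x     a≤ x≤ = zeros k
  where
  zeros : ∀ k → All (_≤ 0) (replicate k 0)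
  zeros zero    = []
  zeros (suc k) = z≤n ∷ zeros k
weightedSum-≤ {suc n} a x {C} a≤ x≤ = add (x≤ zero) (weightedSum-≤ (a ∘ suc) (x ∘ suc) (a≤ ∘ suc) (x≤ ∘ suc))
  where
  add : ∀ {k} {xs ys : Vec ℕ k} → All (_≤ C) xs → All (_≤ n * C) ys → All (_≤ C + n * C) (zipWith _+_ (map (a zero *_) xs) ys)
  add []       []       = []
  add (p ∷ ps) (q ∷ qs) = +-mono-≤ (≤-trans (*-mono-≤ (a≤ zero) p) (≤-reflexive (*-identityˡ C))) q ∷ add ps qs

-- Sums of signed terms

sum-nonneg : ∀ {n} (f : Fin n → ℤ) → (∀ u → 0ℤ ℤ.≤ f u) → 0ℤ ℤ.≤ sum f
sum-nonneg {zero}  f f≥0 = ℤ.≤-refl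
sum-nonneg {suc n} f f≥0 = ℤ.+-mono-≤ (f≥0 zero) (sum-nonneg (f ∘ suc) (f≥0 ∘ suc))

sum-zero⇒zero : ∀ {n} (f : Fin n → ℤ) → (∀ u → 0ℤ ℤ.≤ f u) → sum f ≡ 0ℤ → ∀ u → f u ≡ 0ℤ
sum-zero⇒zero {suc n} f f≥0 e = λ { zero → head≡0 ; (suc u) → sum-zero⇒zero (f ∘ suc) (f≥0 ∘ suc) tail≡0 u }
  where
  tail≥0 = sum-nonneg (f ∘ suc) (f≥0 ∘ suc)
  head≡0 : f zero ≡ 0ℤ
  head≡0 = ℤ.≤-antisym (subst (f zero ℤ.≤_) e (subst (ℤ._≤ sum f) (ℤ.+-identityʳ (f zero)) (ℤ.+-monoʳ-≤ (f zero) tail≥0))) (f≥0 zero)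
  tail≡0 : sum (f ∘ suc) ≡ 0ℤ
  tail≡0 = trans (sym (ℤ.+-identityˡ _)) (trans (cong (ℤ._+ sum (f ∘ suc)) (sym head≡0)) e)

sum-neg⇒neg : ∀ {n} (f : Fin n → ℤ) → sum f ℤ.< 0ℤ → ∃ λ u → f u ℤ.< 0ℤ
sum-neg⇒neg f f<0 with Fin.any? (λ u → f u ℤ.<? 0ℤ)
... | yes neg  = neg
... | no  none = ⊥-elim (ℤ.<⇒≱ f<0 (sum-nonneg f (λ u → ℤ.≮⇒≥ (none ∘ (u ,_)))))

sum-nonpos : ∀ {n} (f : Fin n → ℤ) → (∀ u → f u ℤ.≤ 0ℤ) → sum f ℤ.≤ 0ℤ
sum-nonpos {zero}  f f≤0 = ℤ.≤-refl
sum-nonpos {suc n} f f≤0 = ℤ.+-mono-≤ (f≤0 zero) (sum-nonpos (f ∘ suc) (f≤0 ∘ suc))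

neg⇒sum-neg : ∀ {n} (f : Fin n → ℤ) → (∀ u → f u ℤ.≤ 0ℤ) → ∀ u → f u ℤ.< 0ℤ → sum f ℤ.< 0ℤ
neg⇒sum-neg f f≤0 zero    f<0 = ℤ.+-mono-<-≤ f<0 (sum-nonpos (f ∘ suc) (f≤0 ∘ suc))
neg⇒sum-neg f f≤0 (suc u) f<0 = ℤ.+-mono-≤-< (f≤0 zero) (neg⇒sum-neg (f ∘ suc) (f≤0 ∘ suc) u f<0)

-- Breadth-first search

least : (Q : ℕ → Set) → (∀ k → Dec (Q k)) → ∀ k → Q k → ∃ λ j → Q j × (∀ i → Q i → j ≤ i)
least Q Q? zero    p = 0 , p , λ _ _ → z≤n
least Q Q? (suc k) p with Q? 0
... | yes p₀ = 0 , p₀ , λ _ _ → z≤n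
... | no ¬p₀ with j , pj , min ← least (Q ∘ suc) (Q? ∘ suc) k p =
  suc j , pj , λ { zero p₀ → ⊥-elim (¬p₀ p₀) ; (suc i) pi → s≤s (min i pi) }

module BFS {n : ℕ} (G : Graph n) {R : Fin n → Set} (R? : ∀ v → Dec (R v))
           (represented : ∀ v → ∃ λ r → R r × Graph.Connected G v r) where
  open Graph G

  -- Cumulative in k and decided by searching neighbours, so that a minimal k can be found without
  -- enumerating paths.
  Reach : ℕ → Fin n → Set
  Reach zero    v = R v
  Reach (suc k) v = Reach k v ⊎ ∃ λ u → Adj v u × Reach k u

  reach? : ∀ k v → Dec (Reach k v)
  reach? zero    v = R? v
  reach? (suc k) v = reach? k v ⊎-dec Fin.any? λ u → adj? v u ×-dec reach? k u

  reachable : ∀ {v r} → Connected v r → R r → ∃ λ k → Reach k v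
  reachable ε        Rr = 0 , Rr
  reachable (e ◅ es) Rr with k , p ← reachable es Rr = suc k , inj₂ (_ , e , p)

  nearest : ∀ v → ∃ λ k → Reach k v × (∀ i → Reach i v → k ≤ i)
  nearest v with r , Rr , v~r ← represented v with k , p ← reachable v~r Rr =
    least (λ k → Reach k v) (λ k → reach? k v) k p

  depth : Fin n → ℕ
  depth v = proj₁ (nearest v)

  depth-minimal : ∀ v i → Reach i v → depth v ≤ i
  depth-minimal v = proj₂ (proj₂ (nearest v))

  depth-adjacent : ∀ {v u} → Adj v u → depth v ≤ suc (depth u)
  depth-adjacent {v} {u} vu = depth-minimal v _ (inj₂ (u , vu , proj₁ (proj₂ (nearest u))))

  parent : ∀ v {k} → depth v ≡ suc k → ∃ λ u → Adj v u × depth u ≡ k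
  parent v {k} e with subst (λ i → Reach i v) e (proj₁ (proj₂ (nearest v)))
  ... | inj₁ p            = ⊥-elim (<⇒≱ (≤-reflexive (sym e)) (depth-minimal v k p))
  ... | inj₂ (u , vu , p) = u , vu , ≤-antisym (depth-minimal u k p)
    (s≤s⁻¹ (subst (_≤ suc (depth u)) e (depth-adjacent vu)))

  parent-≢root : ∀ v → ¬ R v → ∃ λ u → Adj v u × depth v ≡ suc (depth u)
  parent-≢root v ¬Rv with depth v in e
  ... | zero  = ⊥-elim (¬Rv (subst (λ i → Reach i v) e (proj₁ (proj₂ (nearest v)))))
  ... | suc k with u , vu , e′ ← parent v e = u , vu , cong suc (sym e′)

  level : ∀ k v → depth v ≡ k → ∀ {i} → i ≤ k → ∃ λ u → depth u ≡ i
  level zero    v e z≤n = v , e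
  level (suc k) v e {i} i≤ with m≤n⇒m<n∨m≡n i≤
  ... | inj₂ refl = v , e
  ... | inj₁ i<   with u , _ , e′ ← parent v e = level k u e′ (s≤s⁻¹ i<)

  -- Walking to parents meets a vertex at each of the depths 0, ..., `depth v`, and these vertices
  -- are distinct.
  depth<n : ∀ v → depth v < n
  depth<n v = Fin.injective⇒≤ {f = λ i → proj₁ (at i)} λ {i} {j} e →
    Fin.toℕ-injective (trans (sym (proj₂ (at i))) (trans (cong depth e) (proj₂ (at j))))
    where
    at : (i : Fin (suc (depth v))) → ∃ λ u → depth u ≡ toℕ i
    at i = level (depth v) v refl (s≤s⁻¹ (Fin.toℕ<n i))

-- Certificates

indicator : {P : Set} → Dec P → ℕ
indicator P? = if does P? then 1 else 0

indicator-yes : {P : Set} (P? : Dec P) → P → indicator P? ≡ 1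
indicator-yes (yes _) p = refl
indicator-yes (no ¬p) p = ⊥-elim (¬p p)

indicator-no : {P : Set} (P? : Dec P) → ¬ P → indicator P? ≡ 0
indicator-no (yes p) ¬p = ⊥-elim (¬p p)
indicator-no (no _)  ¬p = refl

indicator≤1 : {P : Set} (P? : Dec P) → indicator P? ≤ 1
indicator≤1 (yes _) = ≤-refl
indicator≤1 (no _)  = z≤n

masked-≡0 : {Q : Set} (Q? : Dec Q) (x : ℤ) → (Q → x ≡ 0ℤ) → + indicator Q? ℤ.* x ≡ 0ℤ
masked-≡0 (yes q) x h = trans (ℤ.*-identityˡ x) (h q)
masked-≡0 (no _)  x h = ℤ.*-zeroˡ x

masked-≤0 : {Q : Set} (Q? : Dec Q) (x : ℤ) → (Q → x ℤ.≤ 0ℤ) → + indicator Q? ℤ.* x ℤ.≤ 0ℤ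
masked-≤0 (yes q) x h = subst (ℤ._≤ 0ℤ) (sym (ℤ.*-identityˡ x)) (h q)
masked-≤0 (no _)  x h = ℤ.≤-reflexive (ℤ.*-zeroˡ x)

masked-<0 : {Q : Set} (Q? : Dec Q) (x : ℤ) → Q → x ℤ.< 0ℤ → + indicator Q? ℤ.* x ℤ.< 0ℤ
masked-<0 Q? x q x<0 = subst (ℤ._< 0ℤ) (sym (trans (cong (λ i → + i ℤ.* x) (indicator-yes Q? q)) (ℤ.*-identityˡ x))) x<0

masked-<0⁻¹ : {Q : Set} (Q? : Dec Q) (x : ℤ) → + indicator Q? ℤ.* x ℤ.< 0ℤ → Q × x ℤ.< 0ℤ
masked-<0⁻¹ (yes q) x neg = q , subst (ℤ._< 0ℤ) (ℤ.*-identityˡ x) neg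
masked-<0⁻¹ (no _)  x neg = ⊥-elim (ℤ.<-irrefl (ℤ.*-zeroˡ x) neg)

features : ℕ → ℕ → Vec ℕ 6
features ℓ d = 1 ∷ ℓ ∷ ℓ * ℓ ∷ d ∷ d * d ∷ d * (d * d) ∷ []

-- Coefficients expressing (ℓ′ - ℓ)² as a combination of the features of (ℓ′ , d′).
spread : ℕ → Vec ℤ 6
spread ℓ = + ℓ ℤ.* + ℓ ∷ ℤ.- (+ 2 ℤ.* + ℓ) ∷ 1ℤ ∷ 0ℤ ∷ 0ℤ ∷ 0ℤ ∷ []

-- Coefficients expressing δ (δ - 1)² for δ = d′ - d, which is negative exactly for δ < 0 and
-- vanishes for δ ∈ {0 , 1}.
descent : ℕ → Vec ℤ 6
descent d = ℤ.- (+ d ℤ.* (+ d⁺ ℤ.* + d⁺)) ∷ 0ℤ ∷ 0ℤ ∷ + d⁺ ℤ.* + d⁺ ℤ.+ + 2 ℤ.* (+ d ℤ.* + d⁺) ∷ ℤ.- (+ d⁺ ℤ.+ + d⁺ ℤ.+ + d) ∷ 1ℤ ∷ []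
  where d⁺ = suc d

square : ℤ → ℤ
square x = x ℤ.* x

fall : ℤ → ℤ
fall δ = δ ℤ.* square (δ ℤ.- 1ℤ)

dot-spread : ∀ ℓ ℓ′ d′ → dot (spread ℓ) (features ℓ′ d′) ≡ square (+ ℓ′ ℤ.- + ℓ)
dot-spread ℓ ℓ′ d′ = trans
  (cong (λ q → + ℓ ℤ.* + ℓ ℤ.* 1ℤ ℤ.+ (ℤ.- (+ 2 ℤ.* + ℓ) ℤ.* + ℓ′ ℤ.+ (1ℤ ℤ.* q ℤ.+ dot (0ℤ ∷ 0ℤ ∷ 0ℤ ∷ []) (d′ ∷ d′ * d′ ∷ d′ * (d′ * d′) ∷ []))))
    (ℤ.pos-* ℓ′ ℓ′))
  (lemma (+ ℓ) (+ ℓ′) (+ d′) (+ (d′ * d′)) (+ (d′ * (d′ * d′))))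
  where
  lemma : ∀ l l′ d dd ddd → l ℤ.* l ℤ.* 1ℤ ℤ.+ (ℤ.- (+ 2 ℤ.* l) ℤ.* l′ ℤ.+ (1ℤ ℤ.* (l′ ℤ.* l′) ℤ.+ (0ℤ ℤ.* d ℤ.+ (0ℤ ℤ.* dd ℤ.+ (0ℤ ℤ.* ddd ℤ.+ 0ℤ)))))
          ≡ (l′ ℤ.- l) ℤ.* (l′ ℤ.- l)
  lemma = solve-∀

dot-descent : ∀ d ℓ′ d′ → dot (descent d) (features ℓ′ d′) ≡ fall (+ d′ ℤ.- + d)
dot-descent d ℓ′ d′ = trans
  (cong₂ (λ q r → ℤ.- (+ d ℤ.* (+ suc d ℤ.* + suc d)) ℤ.* 1ℤ ℤ.+ (0ℤ ℤ.* + ℓ′ ℤ.+ (0ℤ ℤ.* + (ℓ′ * ℓ′) ℤ.+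
      ((+ suc d ℤ.* + suc d ℤ.+ + 2 ℤ.* (+ d ℤ.* + suc d)) ℤ.* + d′ ℤ.+
      (ℤ.- (+ suc d ℤ.+ + suc d ℤ.+ + d) ℤ.* q ℤ.+ (1ℤ ℤ.* r ℤ.+ 0ℤ))))))
    (ℤ.pos-* d′ d′) (trans (ℤ.pos-* d′ (d′ * d′)) (cong (+ d′ ℤ.*_) (ℤ.pos-* d′ d′))))
  (lemma (+ d) (+ ℓ′) (+ (ℓ′ * ℓ′)) (+ d′))
  where
  lemma : ∀ d l ll e → ℤ.- (d ℤ.* ((1ℤ ℤ.+ d) ℤ.* (1ℤ ℤ.+ d))) ℤ.* 1ℤ ℤ.+ (0ℤ ℤ.* l ℤ.+ (0ℤ ℤ.* ll ℤ.+
            (((1ℤ ℤ.+ d) ℤ.* (1ℤ ℤ.+ d) ℤ.+ + 2 ℤ.* (d ℤ.* (1ℤ ℤ.+ d))) ℤ.* e ℤ.+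
            (ℤ.- ((1ℤ ℤ.+ d) ℤ.+ (1ℤ ℤ.+ d) ℤ.+ d) ℤ.* (e ℤ.* e) ℤ.+ (1ℤ ℤ.* (e ℤ.* (e ℤ.* e)) ℤ.+ 0ℤ)))))
          ≡ (e ℤ.- d) ℤ.* ((e ℤ.- d ℤ.- 1ℤ) ℤ.* (e ℤ.- d ℤ.- 1ℤ))
  lemma = solve-∀

square-nonneg : ∀ x → 0ℤ ℤ.≤ square x
square-nonneg (+ n)     = subst (0ℤ ℤ.≤_) (ℤ.pos-* n n) (+≤+ z≤n)
square-nonneg (-[1+ n ]) = +≤+ z≤n

*-nonneg : ∀ {x y} → 0ℤ ℤ.≤ x → 0ℤ ℤ.≤ y → 0ℤ ℤ.≤ x ℤ.* y
*-nonneg {+ a} {+ b} _ _ = subst (0ℤ ℤ.≤_) (ℤ.pos-* a b) (+≤+ z≤n)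

fall-neg : ∀ x → fall x ℤ.< 0ℤ → x ℤ.< 0ℤ
fall-neg x fall<0 = ℤ.≰⇒> λ x≥0 → ℤ.<⇒≱ fall<0 (*-nonneg x≥0 (square-nonneg (x ℤ.- 1ℤ)))

module Certificate {n : ℕ} (G : Graph n) where
  open Graph G

  adjacency : Fin n → Fin n → ℕ
  adjacency v u = indicator (adj? v u)

  moments : (ℓ d : Fin n → ℕ) → Fin n → Vec ℕ 6
  moments ℓ d v = weightedSum (adjacency v) (λ u → features (ℓ u) (d u))

-- A condition on the symbol of v alone, so the verifier can check it as the symbol passes. The
-- bounds by n keep the packed digits from overflowing; a representative is exempt from the descent.
LocallyValid : ∀ {n} → Fin n → ℕ → ℕ → Vec ℕ 6 → Set
LocallyValid {n} v ℓ d z = ℓ < n × d < n × dot (spread ℓ) z ≡ 0ℤ × (ℓ ≡ toℕ v ⊎ dot (descent d) z ℤ.< 0ℤ)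

locallyValid? : ∀ {n} (v : Fin n) ℓ d z → Dec (LocallyValid v ℓ d z)
locallyValid? {n} v ℓ d z = ℓ <? n ×-dec d <? n ×-dec dot (spread ℓ) z ℤ.≟ 0ℤ ×-dec
  (ℓ ≟ toℕ v ⊎-dec dot (descent d) z ℤ.<? 0ℤ)

module _ {n : ℕ} (G : Graph n) where
  open Graph G
  open Certificate G

  -- Double counting: the sum over vertices is regrouped by component, and each component
  -- contributes exactly one.
  count-representatives : ∀ {c} → ComponentLabelling G c → {R : Fin n → Set} (R? : ∀ v → Dec (R v)) →
    (∀ v → ∃ λ r → R r × Connected v r) → (∀ {r r′} → R r → R r′ → Connected r r′ → r ≡ r′) →
    sum (λ v → + indicator (R? v)) ≡ + c
  count-representatives {c} (lab , surj , kernel) {R} R? represented unique = begin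
    sum (λ v → + indicator (R? v))                                       ≡⟨ sum-cong-≗ (λ v → sym (sum-single _ (lab v) (other v) (own v))) ⟩
    sum (λ v → sum λ j → + indicator (lab v Fin.≟ j) ℤ.* + indicator (R? v))  ≡⟨ ∑-comm (λ v j → + indicator (lab v Fin.≟ j) ℤ.* + indicator (R? v)) ⟩
    sum (λ j → sum λ v → + indicator (lab v Fin.≟ j) ℤ.* + indicator (R? v))  ≡⟨ sum-cong-≗ one ⟩
    sum (λ (j : Fin c) → 1ℤ)                                             ≡⟨ ones c ⟩
    + c                                                                  ∎
    where
    open ≡-Reasoning
    other : ∀ v j → j ≢ lab v → + indicator (lab v Fin.≟ j) ℤ.* + indicator (R? v) ≡ 0ℤ
    other v j j≢ rewrite indicator-no (lab v Fin.≟ j) (j≢ ∘ sym) = refl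
    own : ∀ v → + indicator (lab v Fin.≟ lab v) ℤ.* + indicator (R? v) ≡ + indicator (R? v)
    own v rewrite indicator-yes (lab v Fin.≟ lab v) refl = ℤ.*-identityˡ _
    one : ∀ j → sum (λ v → + indicator (lab v Fin.≟ j) ℤ.* + indicator (R? v)) ≡ 1ℤ
    one j with w , lab-w ← surj j with r , Rr , w~r ← represented w =
      sum-single (λ v → + indicator (lab v Fin.≟ j) ℤ.* + indicator (R? v)) r (rest j r Rr lab-r) at-r
      where
      lab-r : lab r ≡ j
      lab-r = trans (sym (Equivalence.from (kernel w r) w~r)) (lab-w refl)
      at-r : + indicator (lab r Fin.≟ j) ℤ.* + indicator (R? r) ≡ 1ℤ
      at-r rewrite indicator-yes (lab r Fin.≟ j) lab-r | indicator-yes (R? r) Rr = refl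
      rest : ∀ j r → R r → lab r ≡ j → ∀ v → v ≢ r → + indicator (lab v Fin.≟ j) ℤ.* + indicator (R? v) ≡ 0ℤ
      rest j r Rr lab-r v v≢r with lab v Fin.≟ j | R? v
      ... | no _      | _      = ℤ.*-zeroˡ (+ indicator (R? v))
      ... | yes _     | no _   = refl
      ... | yes lab-v | yes Rv = ⊥-elim (v≢r (unique Rv Rr (Equivalence.to (kernel v r) (trans lab-v (sym lab-r)))))
    ones : ∀ c → sum (λ (j : Fin c) → 1ℤ) ≡ + c
    ones zero    = refl
    ones (suc c) = cong (ℤ._+_ 1ℤ) (ones c)

  module _ (ℓ d : Fin n → ℕ) (valid : ∀ v → LocallyValid v (ℓ v) (d v) (moments ℓ d v)) where

    private
      adjacent-label : ∀ {v u} → Adj v u → ℓ v ≡ ℓ u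
      adjacent-label {v} {u} vu with _ , _ , spread≡0 , _ ← valid v =
        sym (ℤ.+-injective (ℤ.i-j≡0⇒i≡j (+ ℓ u) (+ ℓ v) (square≡0 (trans (sym (ℤ.*-identityˡ _))
          (trans (cong (λ a → + a ℤ.* square (+ ℓ u ℤ.- + ℓ v)) (sym (indicator-yes (adj? v u) vu))) (terms≡0 u))))))
        where
        terms≡0 : ∀ u → + adjacency v u ℤ.* square (+ ℓ u ℤ.- + ℓ v) ≡ 0ℤ
        terms≡0 = sum-zero⇒zero _ (λ u → *-nonneg {+ adjacency v u} (+≤+ z≤n) (square-nonneg (+ ℓ u ℤ.- + ℓ v)))
          (trans (sum-cong-≗ (λ u → cong (+ adjacency v u ℤ.*_) (sym (dot-spread (ℓ v) (ℓ u) (d u)))))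
            (trans (sym (dot-weightedSum (spread (ℓ v)) (adjacency v) (λ u → features (ℓ u) (d u)))) spread≡0))
        square≡0 : ∀ {x} → square x ≡ 0ℤ → x ≡ 0ℤ
        square≡0 {x} e with ℤ.i*j≡0⇒i≡0∨j≡0 x e
        ... | inj₁ p = p
        ... | inj₂ p = p

      connected-label : ∀ {v u} → Connected v u → ℓ v ≡ ℓ u
      connected-label ε        = refl
      connected-label (e ◅ es) = trans (adjacent-label e) (connected-label es)

      descend : ∀ v → ℓ v ≢ toℕ v → ∃ λ u → Adj v u × d u < d v
      descend v ℓv≢v with valid v
      ... | _ , _ , _ , inj₁ ℓv≡v = ⊥-elim (ℓv≢v ℓv≡v)
      ... | _ , _ , _ , inj₂ neg
        with u , term<0 ← sum-neg⇒neg (λ u → + adjacency v u ℤ.* fall (+ d u ℤ.- + d v))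
               (subst (ℤ._< 0ℤ) (trans (dot-weightedSum (descent (d v)) (adjacency v) (λ u → features (ℓ u) (d u)))
                 (sum-cong-≗ (λ u → cong (+ adjacency v u ℤ.*_) (dot-descent (d v) (ℓ u) (d u))))) neg)
        with vu , fall<0 ← masked-<0⁻¹ (adj? v u) (fall (+ d u ℤ.- + d v)) term<0 =
        u , vu , ≰⇒> λ dv≤du → ℤ.<⇒≱ (fall-neg (+ d u ℤ.- + d v) fall<0) (ℤ.i≤j⇒0≤j-i (+≤+ dv≤du))

      -- The claimed d need not be a distance: it drops at every step of `descend`, which is enough
      -- for the walk to end at a representative.
      represented : ∀ v → Acc _<_ (d v) → ∃ λ r → ℓ r ≡ toℕ r × Connected v r
      represented v (acc rec) with ℓ v ≟ toℕ v
      ... | yes root = v , root , ε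
      ... | no  ℓv≢v with u , vu , du<dv ← descend v ℓv≢v with r , root , u~r ← represented u (rec du<dv) =
        r , root , vu ◅ u~r

    certified-count : sum (λ v → + indicator (ℓ v ≟ toℕ v)) ≡ + numComponents G
    certified-count = count-representatives (proj₂ (components G)) (λ v → ℓ v ≟ toℕ v)
      (λ v → represented v (<-wellFounded (d v)))
      (λ r r′ c → Fin.toℕ-injective (trans (sym r) (trans (connected-label c) r′)))

  module Honest where

    private
      lab  = proj₁ (proj₂ (components G))
      surj = proj₁ (proj₂ (proj₂ (components G)))
      kernel = proj₂ (proj₂ (proj₂ (components G)))

    -- Chosen through the label of the component, so that connected vertices have the same root.
    root : Fin n → Fin n
    root v = proj₁ (surj (lab v))

    lab-root : ∀ v → lab (root v) ≡ lab v
    lab-root v = proj₂ (surj (lab v)) refl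

    root-cong : ∀ {v u} → Connected v u → root v ≡ root u
    root-cong {v} {u} v~u = cong (λ j → proj₁ (surj j)) (Equivalence.from (kernel v u) v~u)

    open BFS G (λ v → root v Fin.≟ v)
      (λ v → root v , cong (λ j → proj₁ (surj j)) (lab-root v) , Equivalence.to (kernel v (root v)) (sym (lab-root v))) public
      using (depth; depth<n; depth-adjacent; parent-≢root)

    label : Fin n → ℕ
    label v = toℕ (root v)

    -- Along an edge, breadth-first depths differ by δ in {1, 0, -1}, where `fall` takes the values
    -- 0, 0 and -4.
    fall-level : ∀ y → fall (+ suc y ℤ.- + y) ≡ 0ℤ × fall (+ y ℤ.- + y) ≡ 0ℤ × fall (+ y ℤ.- + suc y) ≡ -[1+ 3 ]
    fall-level y = up (+ y) , flat (+ y) , down (+ y)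
      where
      up : ∀ y → (1ℤ ℤ.+ y ℤ.- y) ℤ.* ((1ℤ ℤ.+ y ℤ.- y ℤ.- 1ℤ) ℤ.* (1ℤ ℤ.+ y ℤ.- y ℤ.- 1ℤ)) ≡ 0ℤ
      up = solve-∀
      flat : ∀ y → (y ℤ.- y) ℤ.* ((y ℤ.- y ℤ.- 1ℤ) ℤ.* (y ℤ.- y ℤ.- 1ℤ)) ≡ 0ℤ
      flat = solve-∀
      down : ∀ y → (y ℤ.- (1ℤ ℤ.+ y)) ℤ.* ((y ℤ.- (1ℤ ℤ.+ y) ℤ.- 1ℤ) ℤ.* (y ℤ.- (1ℤ ℤ.+ y) ℤ.- 1ℤ)) ≡ -[1+ 3 ]
      down = solve-∀

    fall≤0 : ∀ {x y} → x ≤ suc y → y ≤ suc x → fall (+ x ℤ.- + y) ℤ.≤ 0ℤ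
    fall≤0 {x} {y} x≤ y≤ with m≤n⇒m<n∨m≡n x≤
    ... | inj₂ refl = ℤ.≤-reflexive (proj₁ (fall-level y))
    ... | inj₁ (s≤s x≤y) with m≤n⇒m<n∨m≡n x≤y
    ...   | inj₂ refl = ℤ.≤-reflexive (proj₁ (proj₂ (fall-level x)))
    ...   | inj₁ x<y with refl ← ≤-antisym y≤ x<y =
      ℤ.≤-trans (ℤ.≤-reflexive (proj₂ (proj₂ (fall-level x)))) ℤ.-≤+

    locallyValid : ∀ v → LocallyValid v (label v) (depth v) (moments label depth v)
    locallyValid v = Fin.toℕ<n (root v) , depth<n v , no-spread , descends
      where
      x : Fin n → Vec ℕ 6
      x u = features (label u) (depth u)

      no-spread : dot (spread (label v)) (moments label depth v) ≡ 0ℤ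
      no-spread = trans (dot-weightedSum (spread (label v)) (adjacency v) x)
        (trans (sum-cong-≗ term) (sum-replicate-zero n))
        where
        term : ∀ u → + adjacency v u ℤ.* dot (spread (label v)) (x u) ≡ 0ℤ
        term u = masked-≡0 (adj? v u) (dot (spread (label v)) (x u)) λ vu →
          trans (dot-spread (label v) (label u) (depth u))
            (cong square (ℤ.i≡j⇒i-j≡0 (cong (λ r → + toℕ r) (sym (root-cong (vu ◅ ε))))))

      falls : Fin n → ℤ
      falls u = + adjacency v u ℤ.* fall (+ depth u ℤ.- + depth v)

      falls≤0 : ∀ u → falls u ℤ.≤ 0ℤ
      falls≤0 u = masked-≤0 (adj? v u) (fall (+ depth u ℤ.- + depth v)) λ vu →
        fall≤0 (depth-adjacent (symm vu)) (depth-adjacent vu)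

      descends : label v ≡ toℕ v ⊎ dot (descent (depth v)) (moments label depth v) ℤ.< 0ℤ
      descends = descends′ (root v Fin.≟ v)
        where
        descends′ : Dec (root v ≡ v) → label v ≡ toℕ v ⊎ dot (descent (depth v)) (moments label depth v) ℤ.< 0ℤ
        descends′ (yes r) = inj₁ (cong toℕ r)
        descends′ (no ¬r) with u , vu , e ← parent-≢root v ¬r = inj₂ (subst (ℤ._< 0ℤ)
          (sym (trans (dot-weightedSum (descent (depth v)) (adjacency v) x)
            (sum-cong-≗ (λ u → cong (+ adjacency v u ℤ.*_) (dot-descent (depth v) (label u) (depth u))))))
          (neg⇒sum-neg falls falls≤0 u
            (masked-<0 (adj? v u) (fall (+ depth u ℤ.- + depth v)) vu (subst (ℤ._< 0ℤ)
              (sym (trans (cong (λ y → fall (+ depth u ℤ.- + y)) e) (proj₂ (proj₂ (fall-level (depth u)))))) ℤ.-<+))))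

-- Truth values and a bound on powers of two

does-true : {Q : Set} (Q? : Dec Q) → does Q? ≡ true → Q
does-true (yes q) _ = q

true-does : {Q : Set} (Q? : Dec Q) → Q → does Q? ≡ true
true-does (yes _) _ = refl
true-does (no ¬q) q = ⊥-elim (¬q q)

∧-true : ∀ {a b} → a ∧ b ≡ true → a ≡ true × b ≡ true
∧-true {true} {true} _ = refl , refl

∧-intro : ∀ {a b} → a ≡ true → b ≡ true → a ∧ b ≡ true
∧-intro refl refl = refl

∨-false : ∀ {a b} → a ∨ b ≡ false → a ≡ false × b ≡ false
∨-false {false} {false} _ = refl , refl

n<2^n : ∀ n → n < 2 ^ n
n<2^n zero    = s≤s z≤n
n<2^n (suc n) = begin-strict
  suc n           ≤⟨ n<2^n n ⟩
  2 ^ n           <⟨ m<m+n (2 ^ n) (m^n>0 2 n) ⟩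
  2 ^ n + 2 ^ n   ≡⟨ cong (λ x → 2 ^ n + x) (+-identityʳ _) ⟨
  2 * 2 ^ n       ∎
  where open ≤-Reasoning

-- Folds

-- Fusion. It isolates single entries of a tally, and it moves the reduction modulo m from every
-- step to the end.
foldFin-proj : ∀ {A B : Set} {n} (π : A → B) {g : Fin n → A → A} (h : Fin n → B → B) →
               (∀ i a → π (g i a) ≡ h i (π a)) → ∀ a → π (foldFin n g a) ≡ foldFin n h (π a)
foldFin-proj {n = zero}  π h e a = refl
foldFin-proj {n = suc n} π h e a = trans (foldFin-proj π (h ∘ suc) (e ∘ suc) _) (cong (foldFin n (h ∘ suc)) (e zero a))

foldFin-constant : ∀ {A B : Set} {n} (π : A → B) {g : Fin n → A → A} → (∀ i a → π (g i a) ≡ π a) →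
                   ∀ a → π (foldFin n g a) ≡ π a
foldFin-constant {n = zero}  π e a = refl
foldFin-constant {n = suc n} π e a = trans (foldFin-constant π (e ∘ suc) _) (e zero a)

foldFin-+ : ∀ {n} (x : Fin n → ℤ) z → foldFin n (λ i z → z ℤ.+ x i) z ≡ z ℤ.+ sum x
foldFin-+ {zero}  x z = sym (ℤ.+-identityʳ z)
foldFin-+ {suc n} x z = trans (foldFin-+ (x ∘ suc) (z ℤ.+ x zero)) (ℤ.+-assoc z (x zero) (sum (x ∘ suc)))

foldFin-∧ : ∀ {n} (o : Fin n → Bool) b → foldFin n (λ i b → b ∧ o i) b ≡ true → ∀ i → o i ≡ true
foldFin-∧ {suc n} o b e = λ { zero → proj₂ (∧-true {b} (head _ (o ∘ suc) e)) ; (suc i) → foldFin-∧ (o ∘ suc) (b ∧ o zero) e i }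
  where
  head : ∀ {n} b (o : Fin n → Bool) → foldFin n (λ i b → b ∧ o i) b ≡ true → b ≡ true
  head {zero}  b o e = e
  head {suc n} b o e = proj₁ (∧-true (head (b ∧ o zero) (o ∘ suc) e))

foldFin-∧-true : ∀ {n} (o : Fin n → Bool) → (∀ i → o i ≡ true) → foldFin n (λ i b → b ∧ o i) true ≡ true
foldFin-∧-true {zero}  o e = refl
foldFin-∧-true {suc n} o e = trans (cong (foldFin n (λ i b → b ∧ o (suc i))) (e zero)) (foldFin-∧-true (o ∘ suc) (e ∘ suc))

foldFin-[]≔ : ∀ {A : Set} {n} (s v : Vec A n) → foldFin n (λ i v → v [ i ]≔ lookup s i) v ≡ s
foldFin-[]≔ []      []      = refl
foldFin-[]≔ (x ∷ s) (y ∷ v) = trans (under s v) (cong (x ∷_) (foldFin-[]≔ s v))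
  where
  under : ∀ {n} (s v : Vec _ n) → foldFin n (λ i v → v [ suc i ]≔ lookup s i) (x ∷ v) ≡ x ∷ foldFin n (λ i v → v [ i ]≔ lookup s i) v
  under s v = sym (foldFin-proj (x ∷_) {λ i v → v [ i ]≔ lookup s i} (λ i v → v [ suc i ]≔ lookup s i) (λ _ _ → refl) v)

sum-indicator-≤ : ∀ {n} {R : Fin n → Set} (R? : ∀ v → Dec (R v)) → sum (λ v → + indicator (R? v)) ℤ.≤ + n
sum-indicator-≤ {zero}  R? = ℤ.≤-refl
sum-indicator-≤ {suc n} R? = ℤ.+-mono-≤ (+≤+ (indicator≤1 (R? zero))) (sum-indicator-≤ (R? ∘ suc))

-- The protocol

data Item (n L : ℕ) : Set where
  commit : Fin n → Item n L
  reveal : Fin L → Item n L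
  answer : Fin n → Item n L

-- Instantiated with residues in the memory of the verifier and with integers in the analysis. The
-- first three entries must end at zero, and `roots` is the answer.
record Tally (A : Set) : Set where
  constructor tally
  field
    commitment product sketch roots : A
    valid : Bool
open Tally

-- The bound on 2^k is what makes packed symbols residues (B⁸<m) and the total error at most 1/3 (9L≤2^k).
module Protocol (n L k : ℕ) (n≤2^L : n ≤ 2 ^ L) (large : 32 * suc L ≤ 2 ^ k) where

  open Hash k

  -- M is both the number of values of a hash coordinate and the exponent in m = 2^M + 1, so it
  -- governs the error and the word length together.
  M : ℕ
  M = 2 ^ k

  -- A moment has at most n terms of size at most n³, and n⁴ ≤ 2^(4L) < B, so digits never carry.
  B : ℕ
  B = 2 ^ suc (L * 4)

  instance
    B≢0 : NonZero B
    B≢0 = m^n≢0 2 (suc (L * 4))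

  open Packing B

  -- Two residues per word, because an answer joins a repeated symbol with an entry of y. In the
  -- other messages only the first residue carries information.
  K : ℕ
  K = m * m

  -- One less than the word length: a residue modulo m needs M + 1 bits, and a word holds two.
  w : ℕ
  w = suc (2 * M)

  m≤2^[1+M] : m ≤ 2 ^ suc M
  m≤2^[1+M] = ≤-trans (+-monoˡ-≤ (2 ^ M) (m^n>0 2 M)) (≤-reflexive (cong (λ x → 2 ^ M + x) (sym (+-identityʳ (2 ^ M)))))

  K≤2^W : K ≤ 2 ^ suc w
  K≤2^W = ≤-trans (*-mono-≤ m≤2^[1+M] m≤2^[1+M]) (≤-reflexive (trans (sym (^-distribˡ-+-* 2 (suc M) (suc M)))
    (cong (2 ^_) (cong suc (trans (+-suc M M) (cong (λ x → suc (M + x)) (sym (+-identityʳ M))))))))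

  n⁴<B : n ^ 4 < B
  n⁴<B = begin-strict
    n ^ 4             ≤⟨ ^-monoˡ-≤ 4 n≤2^L ⟩
    (2 ^ L) ^ 4       ≡⟨ ^-*-assoc 2 L 4 ⟩
    2 ^ (L * 4)       <⟨ ^-monoʳ-< 2 ≤-refl (n<1+n (L * 4)) ⟩
    B                 ∎
    where open ≤-Reasoning

  -- A symbol has eight digits of 4L + 1 bits each, 32L + 8 bits in all; this is the origin of the
  -- 32 in `large`.
  B⁸<m : B ^ 8 < m
  B⁸<m = s≤s (begin
    B ^ 8                    ≡⟨ ^-*-assoc 2 (suc (L * 4)) 8 ⟩
    2 ^ (suc (L * 4) * 8)    ≤⟨ ^-monoʳ-≤ 2 (≤-trans (≤-trans (≤-reflexive (exponent L)) (m≤m+n _ 24)) (≤-trans (≤-reflexive (exponent′ L)) large)) ⟩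
    2 ^ M                    ∎)
    where
    open ≤-Reasoning
    exponent : ∀ L → suc (L * 4) * 8 ≡ 8 + 32 * L
    exponent = ℕ-Solver.solve-∀
    exponent′ : ∀ L → 8 + 32 * L + 24 ≡ 32 * suc L
    exponent′ = ℕ-Solver.solve-∀

  n≤B : n ≤ B
  n≤B = ≤-trans n≤2^L (^-monoʳ-≤ 2 (≤-trans (m≤m*n L 4) (n≤1+n (L * 4))))

  B^j<m : ∀ {j} → j ≤ 8 → B ^ j < m
  B^j<m j≤8 = ≤-<-trans (^-monoʳ-≤ B j≤8) B⁸<m

  n<m : n < m
  n<m = ≤-<-trans n≤B (subst (_< m) (^-identityʳ B) (B^j<m (s≤s z≤n)))

  -- A committed symbol packs label, depth and the six moments of the neighbourhood.
  labelOf depthOf momentOf : Fin m → ℕ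
  labelOf b  = toℕ b % B
  depthOf b  = toℕ b / B % B
  momentOf b = toℕ b / B / B

  featureOf : Fin m → ℕ
  featureOf b = pack (features (labelOf b) (depthOf b))

  Valid? : (v : Fin n) (b : Fin m) → Dec (LocallyValid v (labelOf b) (depthOf b) (unpack 6 (momentOf b)))
  Valid? v b = locallyValid? v (labelOf b) (depthOf b) (unpack 6 (momentOf b))

  Key : Set
  Key = Point k L × Point k L

  publicWeight secretWeight : Key → Fin n → ℤ
  publicWeight (s , t) v = hashWeight (map val s) v
  secretWeight (s , t) v = hashWeight (map val t) v

  first second : Fin K → Fin m
  first a  = proj₁ (remQuot {m} m a)
  second a = proj₂ (remQuot {m} m a)

  pair : Fin m → Fin m → Fin K
  pair = combine

  infixl 6 _⊞_
  _⊞_ : Tally ℤ → Tally ℤ → Tally ℤ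
  tally f g y c o ⊞ tally f′ g′ y′ c′ o′ = tally (f ℤ.+ f′) (g ℤ.+ g′) (y ℤ.+ y′) (c ℤ.+ c′) (o ∧ o′)

  ⟪_⟫ : Tally ℤ → Tally (Fin m)
  ⟪ tally f g y c o ⟫ = tally (red f) (red g) (red y) (red c) o

  lift : Tally (Fin m) → Tally ℤ
  lift (tally f g y c o) = tally ⟦ f ⟧ ⟦ g ⟧ ⟦ y ⟧ ⟦ c ⟧ o

  red-absorb : ∀ x y → red (⟦ red x ⟧ ℤ.+ y) ≡ red (x ℤ.+ y)
  red-absorb x y = red-cong (+-cong (⟦red⟧ x) (≋-refl {y}))

  -- Reducing after every update agrees with reducing once at the end, so a run can be analysed over
  -- the integers.
  absorb : ∀ z δ → ⟪ lift ⟪ z ⟫ ⊞ δ ⟫ ≡ ⟪ z ⊞ δ ⟫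
  absorb (tally f g y c o) (tally f′ g′ y′ c′ o′) =
    tally-cong (red-absorb f f′) (red-absorb g g′) (red-absorb y y′) (red-absorb c c′)
    where
    tally-cong : ∀ {f f′ g g′ y y′ c c′ : Fin m} {o} → f ≡ f′ → g ≡ g′ → y ≡ y′ → c ≡ c′ →
                 tally f g y c o ≡ tally f′ g′ y′ c′ o
    tally-cong refl refl refl refl = refl

  zeroTally : Tally ℤ
  zeroTally = tally 0ℤ 0ℤ 0ℤ 0ℤ true

  -- Only the two orientations of the edge contribute. The double sum makes it evident that the
  -- terms of a stream add up to the bilinear form of its multiplicities.
  edgeTerm : Key → EdgeUpdate n → ℤ
  edgeTerm κ e = sum λ u → sum λ v →
    (if isEdge e u v then change {n} (EdgeUpdate.op e) else 0ℤ) ℤ.* (publicWeight κ u ℤ.* secretWeight κ v)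

  streamDelta : Key → EdgeUpdate n → Tally ℤ
  streamDelta κ e = tally 0ℤ 0ℤ (edgeTerm κ e) 0ℤ true

  commitDelta : Key → Fin n → Fin m → Tally ℤ
  commitDelta κ v b = tally (secretWeight κ v ℤ.* ⟦ b ⟧) 0ℤ 0ℤ 0ℤ true

  -- The signs turn the first three entries into differences that vanish for honest messages:
  -- committed minus repeated symbols, ⟨y, x⟩ minus ⟨hₛ, z⟩, and sketch minus the hash of y.
  answerDelta : Key → Fin n → Fin m → Fin m → Tally ℤ
  answerDelta κ v b y = tally
    (ℤ.- (secretWeight κ v ℤ.* ⟦ b ⟧))
    (⟦ y ⟧ ℤ.* + featureOf b ℤ.- publicWeight κ v ℤ.* + momentOf b)
    (ℤ.- (secretWeight κ v ℤ.* ⟦ y ⟧))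
    (+ indicator (labelOf b ≟ toℕ v))
    (does (Valid? v b))

  Data : Set
  Data = Key × Tally (Fin m)

  update : Item n L → Fin K → Data → Data
  update (reveal i) a d       = d
  update (commit v) a (κ , z) = κ , ⟪ lift z ⊞ commitDelta κ v (first a) ⟫
  update (answer v) a (κ , z) = κ , ⟪ lift z ⊞ answerDelta κ v (first a) (second a) ⟫

  coordinateSymbol : Vec Bool k → Fin K
  coordinateSymbol r = pair (red (+ val r)) (red 0ℤ)

  speak : Item n L → Maybe (Data → Fin K)
  speak (commit v) = nothing
  speak (reveal i) = just λ d → coordinateSymbol (lookup (proj₁ (proj₁ d)) i)
  speak (answer v) = nothing

  vanishes : Fin m → Bool
  vanishes a = does (a Fin.≟ red 0ℤ)

  accepts : Tally (Fin m) → Bool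
  accepts z = valid z ∧ (vanishes (commitment z) ∧ (vanishes (product z) ∧ vanishes (sketch z)))

  verdict : Data → Maybe ℕ
  verdict (κ , z) = if accepts z then just (toℕ (roots z)) else nothing

  sampleKey : Rand Key
  sampleKey = samplePoint k L >>= λ s → samplePoint k L >>= λ t → return (s , t)

  readEdge : EdgeUpdate n → Data → Data
  readEdge e (κ , z) = κ , ⟪ lift z ⊞ streamDelta κ e ⟫

  sched : List (Item n L)
  sched = tabulate commit ++ tabulate reveal ++ tabulate answer ++ []

  open Machine (Item n L) sched w K K≤2^W public
  open Verify {EdgeUpdate n} sampleKey (λ κ → κ , ⟪ zeroTally ⟫) readEdge update speak verdict public

-- The final tally as hashes of differences

sum-− : ∀ {n} (f g : Fin n → ℤ) → sum (λ v → f v ℤ.- g v) ≡ sum f ℤ.- sum g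
sum-− f g = trans (∑-distrib-+ f (λ v → ℤ.- g v)) (cong (λ x → sum f ℤ.+ x) (sum-neg g))
  where
  sum-neg : ∀ {n} (g : Fin n → ℤ) → sum (λ v → ℤ.- g v) ≡ ℤ.- sum g
  sum-neg {zero}  g = refl
  sum-neg {suc n} g = trans (cong (λ x → ℤ.- g zero ℤ.+ x) (sum-neg (g ∘ suc))) (sym (ℤ.neg-distrib-+ (g zero) (sum (g ∘ suc))))

module Correctness (n L k : ℕ) (n≤2^L : n ≤ 2 ^ L) (large : 32 * suc L ≤ 2 ^ k) where

  open Protocol n L k n≤2^L large
  open Hash k
  open Packing B

  sum-≋ : ∀ {j} {f g : Fin j → ℤ} → (∀ v → f v ≋ g v) → sum f ≋ sum g
  sum-≋ {zero}  f≋g = ≋-refl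
  sum-≋ {suc j} f≋g = +-cong (f≋g zero) (sum-≋ (f≋g ∘ suc))

  difference≋0⇒≋ : ∀ {x y} → x ℤ.- y ≋ 0ℤ → x ≋ y
  difference≋0⇒≋ {x} {y} p = subst₂ _≋_ (lemma x y) (ℤ.+-identityˡ y) (+-cong p (≋-refl {y}))
    where lemma : ∀ x y → x ℤ.- y ℤ.+ y ≡ x
          lemma = solve-∀

  neg-≋0 : ∀ {x} → x ≋ 0ℤ → ℤ.- x ≋ 0ℤ
  neg-≋0 {x} p = subst (_≋ 0ℤ) (ℤ.-1*i≡-i x) (*-cong (≋-refl {ℤ.- 1ℤ}) p)

  nonzero : (Fin n → ℤ) → Bool
  nonzero D = does (Fin.any? λ v → isZero (D v) Bool.≟ false)

  -- The bad event of a hash test: a vector that is nonzero modulo m hashes to zero. Outside it, a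
  -- vanishing hash proves that the vector vanishes.
  hit : (Fin n → ℤ) → Point k L → Bool
  hit D r = nonzero D ∧ isZero (hash D (map val r))

  hit-bound : ∀ D → Pr (hit D) (samplePoint k L) ℚ.≤ L ×½^ k
  hit-bound D = bound (Fin.any? λ v → isZero (D v) Bool.≟ false) refl
    where
    bound : (nz : Dec (∃ λ v → isZero (D v) ≡ false)) → does nz ≡ nonzero D → Pr (hit D) (samplePoint k L) ℚ.≤ L ×½^ k
    bound (no _) e = ℚ.≤-trans
      (ℚ.≤-reflexive (Pr-false (λ r → cong (_∧ isZero (hash D (map val r))) (sym e)) (samplePoint k L)))
      (0≤×½^ L k)
    bound (yes (v , z)) e = ℚ.≤-trans
      (Pr-mono (λ r h → proj₂ (∧-true {nonzero D} h)) (samplePoint k L))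
      (hash-zero {n} {L} n≤2^L D v λ p → true≢false (trans (sym (isZero-complete (D v) p)) z))

  no-hit : ∀ D r → hit D r ≡ false → hash D (map val r) ≋ 0ℤ → ∀ v → D v ≋ 0ℤ
  no-hit D r h p v = isZero-sound (D v) (all-zero (Fin.any? λ v → isZero (D v) Bool.≟ false) refl)
    where
    all-zero : (nz : Dec (∃ λ v → isZero (D v) ≡ false)) → does nz ≡ nonzero D → isZero (D v) ≡ true
    all-zero (yes _) e = ⊥-elim (true≢false (trans (sym (∧-intro {nonzero D} (sym e) (isZero-complete (hash D (map val r)) p))) h))
    all-zero (no none) e = Bool.¬-not (none ∘ (v ,_))

  rowHash : List (EdgeUpdate n) → Vec ℕ L → Fin n → ℤ
  rowHash τ rs v = sum λ u → multiplicity τ u v ℤ.* hashWeight rs u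

  -- The error at v in the packed claim z = A x. It depends on the first message alone, hence is
  -- fixed before s is revealed.
  defect : List (EdgeUpdate n) → (Fin n → Fin m) → Fin n → ℤ
  defect τ b v = + momentOf (b v) ℤ.- sum λ u → multiplicity τ v u ℤ.* + featureOf (b u)

  module Algebra (τ : List (EdgeUpdate n)) (κ : Key) (b b′ y : Fin n → Fin m) where

    A : Fin n → Fin n → ℤ
    A = multiplicity τ

    readTally : List (EdgeUpdate n) → Tally ℤ → Tally ℤ
    readTally []      z = z
    readTally (e ∷ τ) z = readTally τ (z ⊞ streamDelta κ e)

    committed : Tally ℤ
    committed = foldFin n (λ v z → z ⊞ commitDelta κ v (b v)) (readTally τ zeroTally)

    final : Tally ℤ
    final = foldFin n (λ v z → z ⊞ answerDelta κ v (b′ v) (y v)) committed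

    s = proj₁ κ
    t = proj₂ κ

    row : Fin n → ℤ
    row = rowHash τ (map val s)

    readTally-constant : ∀ {X : Set} (π : Tally ℤ → X) → (∀ z e → π (z ⊞ streamDelta κ e) ≡ π z) →
                         ∀ τ z → π (readTally τ z) ≡ π z
    readTally-constant π const []      z = refl
    readTally-constant π const (e ∷ τ) z = trans (readTally-constant π const τ _) (const z e)

    committed-constant : ∀ {X : Set} (π : Tally ℤ → X) → (∀ v z → π (z ⊞ commitDelta κ v (b v)) ≡ π z) →
                         π committed ≡ π (readTally τ zeroTally)
    committed-constant π const =
      foldFin-constant {n = n} π {λ v z → z ⊞ commitDelta κ v (b v)} const (readTally τ zeroTally)

    commitment-final : commitment final ≡ hash (λ v → ⟦ b v ⟧ ℤ.- ⟦ b′ v ⟧) (map val t)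
    commitment-final = begin
      commitment final
        ≡⟨ foldFin-proj commitment (λ v x → x ℤ.- secretWeight κ v ℤ.* ⟦ b′ v ⟧) (λ _ _ → refl) committed ⟩
      foldFin n (λ v x → x ℤ.- secretWeight κ v ℤ.* ⟦ b′ v ⟧) (commitment committed)
        ≡⟨ foldFin-+ (λ v → ℤ.- (secretWeight κ v ℤ.* ⟦ b′ v ⟧)) _ ⟩
      commitment committed ℤ.+ sum (λ v → ℤ.- (secretWeight κ v ℤ.* ⟦ b′ v ⟧))
        ≡⟨ cong (ℤ._+ sum (λ v → ℤ.- (secretWeight κ v ℤ.* ⟦ b′ v ⟧))) before ⟩
      sum (λ v → secretWeight κ v ℤ.* ⟦ b v ⟧) ℤ.+ sum (λ v → ℤ.- (secretWeight κ v ℤ.* ⟦ b′ v ⟧))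
        ≡⟨ ∑-distrib-+ (λ v → secretWeight κ v ℤ.* ⟦ b v ⟧) (λ v → ℤ.- (secretWeight κ v ℤ.* ⟦ b′ v ⟧)) ⟨
      sum (λ v → secretWeight κ v ℤ.* ⟦ b v ⟧ ℤ.- secretWeight κ v ℤ.* ⟦ b′ v ⟧)
        ≡⟨ sum-cong-≗ (λ v → lemma (secretWeight κ v) ⟦ b v ⟧ ⟦ b′ v ⟧) ⟩
      hash (λ v → ⟦ b v ⟧ ℤ.- ⟦ b′ v ⟧) (map val t) ∎
      where
      open ≡-Reasoning
      lemma : ∀ h x y → h ℤ.* x ℤ.- h ℤ.* y ≡ h ℤ.* (x ℤ.- y)
      lemma = solve-∀
      before : commitment committed ≡ sum (λ v → secretWeight κ v ℤ.* ⟦ b v ⟧)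
      before = trans (foldFin-proj commitment (λ v x → x ℤ.+ secretWeight κ v ℤ.* ⟦ b v ⟧) (λ _ _ → refl) _)
        (trans (foldFin-+ (λ v → secretWeight κ v ℤ.* ⟦ b v ⟧) _)
          (trans (cong (ℤ._+ sum (λ v → secretWeight κ v ℤ.* ⟦ b v ⟧))
                   (readTally-constant commitment (λ z e → ℤ.+-identityʳ (commitment z)) τ zeroTally))
                 (ℤ.+-identityˡ _)))

    product-final : product final ≡ sum (λ v → ⟦ y v ⟧ ℤ.* + featureOf (b′ v) ℤ.- publicWeight κ v ℤ.* + momentOf (b′ v))
    product-final = trans (foldFin-proj product (λ v x → x ℤ.+ term v) (λ _ _ → refl) committed)
      (trans (foldFin-+ term _)
        (trans (cong (ℤ._+ sum term) (trans (committed-constant product (λ v z → ℤ.+-identityʳ (product z)))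
            (readTally-constant product (λ z e → ℤ.+-identityʳ (product z)) τ zeroTally)))
          (ℤ.+-identityˡ _)))
      where
      term : Fin n → ℤ
      term v = ⟦ y v ⟧ ℤ.* + featureOf (b′ v) ℤ.- publicWeight κ v ℤ.* + momentOf (b′ v)

    roots-final : roots final ≡ sum (λ v → + indicator (labelOf (b′ v) ≟ toℕ v))
    roots-final = trans (foldFin-proj roots (λ v x → x ℤ.+ term v) (λ _ _ → refl) committed)
      (trans (foldFin-+ term _)
        (trans (cong (ℤ._+ sum term) (trans (committed-constant roots (λ v z → ℤ.+-identityʳ (roots z)))
            (readTally-constant roots (λ z e → ℤ.+-identityʳ (roots z)) τ zeroTally)))
          (ℤ.+-identityˡ _)))
      where
      term : Fin n → ℤ
      term v = + indicator (labelOf (b′ v) ≟ toℕ v)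

    valid-final : valid final ≡ foldFin n (λ v o → o ∧ does (Valid? v (b′ v))) true
    valid-final = trans (foldFin-proj valid (λ v o → o ∧ does (Valid? v (b′ v))) (λ _ _ → refl) committed)
      (cong (foldFin n (λ v o → o ∧ does (Valid? v (b′ v))))
        (trans (committed-constant valid (λ v z → Bool.∧-identityʳ (valid z)))
          (readTally-constant valid (λ z e → Bool.∧-identityʳ (valid z)) τ zeroTally)))

    pairing : List (EdgeUpdate n) → ℤ
    pairing τ = sum λ u → sum λ v → multiplicity τ u v ℤ.* (publicWeight κ u ℤ.* secretWeight κ v)

    pairing-[] : pairing [] ≡ 0ℤ
    pairing-[] = trans (sum-cong-≗ {n} (λ u → trans (sum-cong-≗ {n} (λ v → ℤ.*-zeroˡ (publicWeight κ u ℤ.* secretWeight κ v)))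
      (sum-replicate-zero n))) (sum-replicate-zero n)

    pairing-∷ : ∀ e τ → pairing (e ∷ τ) ≡ edgeTerm κ e ℤ.+ pairing τ
    pairing-∷ e τ = trans
      (sum-cong-≗ (λ u → trans
        (sum-cong-≗ (λ v → ℤ.*-distribʳ-+ (publicWeight κ u ℤ.* secretWeight κ v) (c u v) (multiplicity τ u v)))
        (∑-distrib-+ (λ v → c u v ℤ.* (publicWeight κ u ℤ.* secretWeight κ v)) (λ v → multiplicity τ u v ℤ.* (publicWeight κ u ℤ.* secretWeight κ v)))))
      (∑-distrib-+ (λ u → sum λ v → c u v ℤ.* (publicWeight κ u ℤ.* secretWeight κ v)) (λ u → sum λ v → multiplicity τ u v ℤ.* (publicWeight κ u ℤ.* secretWeight κ v)))
      where
      c : Fin n → Fin n → ℤ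
      c u v = if isEdge e u v then change {n} (EdgeUpdate.op e) else 0ℤ

    sketch-readTally : ∀ τ z → sketch (readTally τ z) ≡ sketch z ℤ.+ pairing τ
    sketch-readTally []      z = sym (trans (cong (λ x → sketch z ℤ.+ x) pairing-[]) (ℤ.+-identityʳ (sketch z)))
    sketch-readTally (e ∷ τ) z = trans (sketch-readTally τ (z ⊞ streamDelta κ e))
      (trans (ℤ.+-assoc (sketch z) (edgeTerm κ e) (pairing τ)) (cong (λ x → sketch z ℤ.+ x) (sym (pairing-∷ e τ))))

    -- The sketch hₛᵀ A hₜ is also the hash at t of the vector hₛᵀ A, which y claims to be.
    pairing-rowHash : pairing τ ≡ sum (λ v → secretWeight κ v ℤ.* row v)
    pairing-rowHash = trans (∑-comm (λ u v → A u v ℤ.* (publicWeight κ u ℤ.* secretWeight κ v)))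
      (sum-cong-≗ (λ v → trans (sum-cong-≗ (λ u → lemma (A u v) (publicWeight κ u) (secretWeight κ v)))
                               (sym (*-distribˡ-sum (secretWeight κ v) (λ u → A u v ℤ.* publicWeight κ u)))))
      where lemma : ∀ a p s → a ℤ.* (p ℤ.* s) ≡ s ℤ.* (a ℤ.* p)
            lemma = solve-∀

    sketch-final : sketch final ≡ hash (λ v → row v ℤ.- ⟦ y v ⟧) (map val t)
    sketch-final = begin
      sketch final
        ≡⟨ foldFin-proj sketch (λ v x → x ℤ.- secretWeight κ v ℤ.* ⟦ y v ⟧) (λ _ _ → refl) committed ⟩
      foldFin n (λ v x → x ℤ.- secretWeight κ v ℤ.* ⟦ y v ⟧) (sketch committed)
        ≡⟨ foldFin-+ (λ v → ℤ.- (secretWeight κ v ℤ.* ⟦ y v ⟧)) _ ⟩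
      sketch committed ℤ.+ sum (λ v → ℤ.- (secretWeight κ v ℤ.* ⟦ y v ⟧))
        ≡⟨ cong (ℤ._+ sum (λ v → ℤ.- (secretWeight κ v ℤ.* ⟦ y v ⟧))) before ⟩
      sum (λ v → secretWeight κ v ℤ.* row v) ℤ.+ sum (λ v → ℤ.- (secretWeight κ v ℤ.* ⟦ y v ⟧))
        ≡⟨ ∑-distrib-+ (λ v → secretWeight κ v ℤ.* row v) (λ v → ℤ.- (secretWeight κ v ℤ.* ⟦ y v ⟧)) ⟨
      sum (λ v → secretWeight κ v ℤ.* row v ℤ.- secretWeight κ v ℤ.* ⟦ y v ⟧)
        ≡⟨ sum-cong-≗ (λ v → lemma (secretWeight κ v) (row v) ⟦ y v ⟧) ⟩
      hash (λ v → row v ℤ.- ⟦ y v ⟧) (map val t) ∎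
      where
      open ≡-Reasoning
      lemma : ∀ h x y → h ℤ.* x ℤ.- h ℤ.* y ≡ h ℤ.* (x ℤ.- y)
      lemma = solve-∀
      before : sketch committed ≡ sum (λ v → secretWeight κ v ℤ.* row v)
      before = trans (committed-constant sketch (λ v z → ℤ.+-identityʳ (sketch z)))
        (trans (sketch-readTally τ zeroTally) (trans (ℤ.+-identityˡ (pairing τ)) pairing-rowHash))

    -- Exchanging the order of summation: Σ_v (Σ_u A(u,v) p(u)) x(v) = Σ_u p(u) (Σ_v A(u,v) x(v)).
    product-defect : (∀ v → ⟦ y v ⟧ ≋ row v) → (∀ v → b′ v ≡ b v) →
                     product final ≋ ℤ.- hash (defect τ b) (map val s)
    product-defect y≋ b′≡ = ≋-trans (≋-reflexive product-final) (≋-trans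
      (sum-≋ (λ v → +-cong (*-cong (y≋ v) (≋-reflexive (cong (λ c → + featureOf c) (b′≡ v))))
                           (≋-reflexive (cong (λ c → ℤ.- (publicWeight κ v ℤ.* + momentOf c)) (b′≡ v)))))
      (≋-reflexive (begin
        sum (λ v → row v ℤ.* x v ℤ.- p v ℤ.* z v)             ≡⟨ sum-− (λ v → row v ℤ.* x v) (λ v → p v ℤ.* z v) ⟩
        sum (λ v → row v ℤ.* x v) ℤ.- sum (λ v → p v ℤ.* z v) ≡⟨ cong (ℤ._- sum (λ v → p v ℤ.* z v)) swap ⟩
        sum (λ v → p v ℤ.* Ax v) ℤ.- sum (λ v → p v ℤ.* z v)       ≡⟨ flip (sum (λ v → p v ℤ.* z v)) (sum (λ v → p v ℤ.* Ax v)) ⟩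
        ℤ.- (sum (λ v → p v ℤ.* z v) ℤ.- sum (λ v → p v ℤ.* Ax v)) ≡⟨ cong ℤ.-_ (sum-− (λ v → p v ℤ.* z v) (λ v → p v ℤ.* Ax v)) ⟨
        ℤ.- sum (λ v → p v ℤ.* z v ℤ.- p v ℤ.* Ax v)               ≡⟨ cong ℤ.-_ (sum-cong-≗ (λ v → factor (p v) (z v) (Ax v))) ⟩
        ℤ.- hash (defect τ b) (map val s)                               ∎)))
      where
      open ≡-Reasoning
      p = publicWeight κ
      x z Ax : Fin n → ℤ
      x v = + featureOf (b v)
      z v = + momentOf (b v)
      Ax v = sum λ u → A v u ℤ.* x u
      flip : ∀ a b → b ℤ.- a ≡ ℤ.- (a ℤ.- b)
      flip = solve-∀
      factor : ∀ p z n → p ℤ.* z ℤ.- p ℤ.* n ≡ p ℤ.* (z ℤ.- n)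
      factor = solve-∀
      reorder : ∀ a p x → a ℤ.* p ℤ.* x ≡ p ℤ.* (a ℤ.* x)
      reorder = solve-∀
      swap : sum (λ v → row v ℤ.* x v) ≡ sum (λ v → p v ℤ.* Ax v)
      swap = begin
        sum (λ v → row v ℤ.* x v)                        ≡⟨ sum-cong-≗ (λ v → *-distribʳ-sum (x v) (λ u → A u v ℤ.* p u)) ⟩
        sum (λ v → sum λ u → A u v ℤ.* p u ℤ.* x v)          ≡⟨ ∑-comm (λ v u → A u v ℤ.* p u ℤ.* x v) ⟩
        sum (λ u → sum λ v → A u v ℤ.* p u ℤ.* x v)          ≡⟨ sum-cong-≗ (λ u → sum-cong-≗ (λ v → reorder (A u v) (p u) (x v))) ⟩
        sum (λ u → sum λ v → p u ℤ.* (A u v ℤ.* x v))        ≡⟨ sum-cong-≗ (λ u → sym (*-distribˡ-sum (p u) (λ v → A u v ℤ.* x v))) ⟩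
        sum (λ u → p u ℤ.* Ax u)                              ∎

-- Runs against an arbitrary prover, and soundness

≡ᵇ-refl : ∀ c → (c ≡ᵇ c) ≡ true
≡ᵇ-refl zero    = refl
≡ᵇ-refl (suc c) = ≡ᵇ-refl c

module Security (n L k : ℕ) (n≤2^L : n ≤ 2 ^ L) (large : 32 * suc L ≤ 2 ^ k) where

  open Protocol n L k n≤2^L large
  open Correctness n L k n≤2^L large
  open Hash k
  open Packing B

  hash-≋0 : (D : Fin n → ℤ) (rs : Vec ℕ L) → (∀ v → D v ≋ 0ℤ) → hash D rs ≋ 0ℤ
  hash-≋0 D rs D≋0 = ≋-trans
    (sum-≋ {g = λ _ → 0ℤ} (λ v → ≋-trans (*-cong (≋-refl {hashWeight rs v}) (D≋0 v)) (≋-reflexive (ℤ.*-zeroʳ (hashWeight rs v)))))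
    (≋-reflexive (sum-replicate-zero n))

  toℕ-red : ∀ {x} → x < m → toℕ (red (+ x)) ≡ x
  toℕ-red {x} x<m = small-≋⇒≡ (Fin.toℕ<n (red (+ x))) x<m (⟦red⟧ (+ x))

  module Run (p : Transcript → Bool) where

    commitSymbol : Fin n → Fin m
    commitSymbol v = first (wordAt p [] (toℕ v))

    afterReveal : Point k L → Transcript
    afterReveal s = writeWords (λ i → coordinateSymbol (lookup s i)) (afterWords p n [])

    -- The types record what the prover knows: commitments depend on no key and answers on s alone.
    -- The independence from t is what the error bound rests on.
    answerSymbol rowSymbol : Point k L → Fin n → Fin m
    answerSymbol s v = first (wordAt p (afterReveal s) (toℕ v))
    rowSymbol s v    = second (wordAt p (afterReveal s) (toℕ v))

    module Final (τ : List (EdgeUpdate n)) (κ : Key) =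
      Algebra τ κ commitSymbol (answerSymbol (proj₁ κ)) (rowSymbol (proj₁ κ))

    private
      module _ (κ : Key) where

        lift-commit : ∀ z → foldFin n (λ v → update (commit v) (wordAt p [] (toℕ v))) (κ , ⟪ z ⟫)
                          ≡ (κ , ⟪ foldFin n (λ v z → z ⊞ commitDelta κ v (commitSymbol v)) z ⟫)
        lift-commit z = sym (foldFin-proj (λ z → κ , ⟪ z ⟫) {λ v z → z ⊞ commitDelta κ v (commitSymbol v)}
          (λ v → update (commit v) (wordAt p [] (toℕ v)))
          (λ v z → cong (κ ,_) (sym (absorb z (commitDelta κ v (commitSymbol v))))) z)

        lift-answer : ∀ z → foldFin n (λ v → update (answer v) (wordAt p (afterReveal (proj₁ κ)) (toℕ v))) (κ , ⟪ z ⟫)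
                          ≡ (κ , ⟪ foldFin n (λ v z → z ⊞ answerDelta κ v (answerSymbol (proj₁ κ) v) (rowSymbol (proj₁ κ) v)) z ⟫)
        lift-answer z = sym (foldFin-proj (λ z → κ , ⟪ z ⟫) {λ v z → z ⊞ answerDelta κ v (answerSymbol (proj₁ κ) v) (rowSymbol (proj₁ κ) v)}
          (λ v → update (answer v) (wordAt p (afterReveal (proj₁ κ)) (toℕ v)))
          (λ v z → cong (κ ,_) (sym (absorb z (answerDelta κ v (answerSymbol (proj₁ κ) v) (rowSymbol (proj₁ κ) v))))) z)

        lift-reads : ∀ τ₀ τ z → reads τ (κ , ⟪ z ⟫) ≡ (κ , ⟪ Final.readTally τ₀ κ τ z ⟫)
        lift-reads τ₀ []      z = refl
        lift-reads τ₀ (e ∷ τ) z = trans (cong (λ y → reads τ (κ , y)) (absorb z (streamDelta κ e)))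
          (lift-reads τ₀ τ (z ⊞ streamDelta κ e))

    afterCommit : Data → Data
    afterCommit = foldFin n (λ v → update (commit v) (wordAt p [] (toℕ v)))

    run-sched : ∀ d → let t = afterReveal (proj₁ (proj₁ (afterCommit d))) in
      run p sched d [] ≡ (foldFin n (λ v → update (answer v) (wordAt p t (toℕ v))) (afterCommit d) , afterWords p n t)
    run-sched d = trans (run-receive p commit (λ _ → refl) (tabulate reveal ++ tabulate answer ++ []) d [])
      (trans (run-send p reveal (λ i d → coordinateSymbol (lookup (proj₁ (proj₁ d)) i)) (λ _ → refl) (λ _ _ _ → refl)
                (tabulate answer ++ []) (afterCommit d) (afterWords p n []))
             (run-receive p answer (λ _ → refl) [] (afterCommit d) (afterReveal (proj₁ (proj₁ (afterCommit d))))))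

    rounds-outcome : ∀ d → HaltsWithinRounds 3 (outcome p d)
    rounds-outcome d = subst (λ t → rounds t ≤ 3) (sym (cong proj₂ (run-sched d))) (within⇒rounds≤ P t₃ third-message)
      where
      s  = proj₁ (proj₁ (afterCommit d))
      t₁ = afterWords p n []
      t₂ = afterReveal s
      t₃ = afterWords p n t₂
      first-message : WithinRounds P 1 t₁
      first-message = within-afterWords p n [] (rounds≤⇒within P [] z≤n)
      second-message : WithinRounds V 2 t₂
      second-message = within-writeWords (λ i → coordinateSymbol (lookup s i)) t₁
        (rounds≤⇒within V t₁ (within⇒rounds≤ P t₁ first-message))
      third-message : WithinRounds P 3 t₃
      third-message = within-afterWords p n t₂ (rounds≤⇒within P t₂ (within⇒rounds≤ V t₂ second-message))

    outcome-final : ∀ τ κ → ∃ λ t → outcome p (reads τ (κ , ⟪ zeroTally ⟫)) ≡ (halted (verdict (κ , ⟪ Final.final τ κ ⟫)) , t)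
    outcome-final τ κ = _ , cong (λ d → halted (verdict d) , proj₂ (run p sched (reads τ (κ , ⟪ zeroTally ⟫)) []))
      (trans (cong proj₁ (run-sched (reads τ (κ , ⟪ zeroTally ⟫))))
        (trans (cong (λ d → foldFin n (λ v → update (answer v) (wordAt p (afterReveal (proj₁ (proj₁ d))) (toℕ v))) d) committed≡)
          (lift-answer κ (Final.committed τ κ))))
      where
      committed≡ : afterCommit (reads τ (κ , ⟪ zeroTally ⟫)) ≡ (κ , ⟪ Final.committed τ κ ⟫)
      committed≡ = trans (cong afterCommit (lift-reads κ τ τ zeroTally)) (lift-commit κ (Final.readTally τ κ τ zeroTally))

  module _ (τ : List (EdgeUpdate n)) (promise : FinalMultiplicities01 τ) where

    G : Graph n
    G = streamGraph τ

    open Certificate G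

    -- Here the promise enters: the stream yields multiplicities, whereas certificates count
    -- neighbours.
    multiplicity≡adjacency : ∀ v u → multiplicity τ v u ≡ + adjacency v u
    multiplicity≡adjacency v u with multiplicity τ v u | promise v u
    ... | _ | inj₁ refl = refl
    ... | _ | inj₂ refl = refl

    features-≤ : ∀ {ℓ d} → ℓ < n → d < n → All (_≤ n ^ 3) (features ℓ d)
    features-≤ {ℓ} {d} ℓ<n d<n = 1≤ ∷ linear ℓ<n ∷ quadratic ℓ<n ∷ linear d<n ∷ quadratic d<n ∷ cubic ∷ []
      where
      n≥1 : 1 ≤ n
      n≥1 = ≤-trans (s≤s z≤n) d<n
      power : ∀ {x} j → x < n → x ^ j ≤ n ^ j
      power j x<n = ^-monoˡ-≤ j (<⇒≤ x<n)
      grow : ∀ {i j} → i ≤ j → n ^ i ≤ n ^ j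
      grow = ^-monoʳ-≤ n {{>-nonZero n≥1}}
      1≤ : 1 ≤ n ^ 3
      1≤ = grow {0} {3} z≤n
      linear : ∀ {x} → x < n → x ≤ n ^ 3
      linear {x} x<n = ≤-trans (≤-reflexive (sym (^-identityʳ x))) (≤-trans (power 1 x<n) (grow {1} {3} (s≤s z≤n)))
      quadratic : ∀ {x} → x < n → x * x ≤ n ^ 3
      quadratic {x} x<n = ≤-trans (≤-reflexive (cong (x *_) (sym (^-identityʳ x)))) (≤-trans (power 2 x<n) (grow {2} {3} (s≤s (s≤s z≤n))))
      cubic : d * (d * d) ≤ n ^ 3
      cubic = ≤-trans (≤-reflexive (cong (λ x → d * (d * x)) (sym (^-identityʳ d)))) (power 3 d<n)

    module _ (ℓ d : Fin n → ℕ) (ℓ<n : ∀ v → ℓ v < n) (d<n : ∀ v → d v < n) where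

      moments-<B : ∀ v → All (_< B) (moments ℓ d v)
      moments-<B v = All.map (λ x≤ → ≤-<-trans x≤ n⁴<B)
        (weightedSum-≤ (adjacency v) (λ u → features (ℓ u) (d u)) (λ u → indicator≤1 (Graph.adj? G v u)) (λ u → features-≤ (ℓ<n u) (d<n u)))

      pack-moments : ∀ v → sum (λ u → multiplicity τ v u ℤ.* + pack (features (ℓ u) (d u))) ≡ + pack (moments ℓ d v)
      pack-moments v = trans (sum-cong-≗ (λ u → cong (ℤ._* + pack (features (ℓ u) (d u))) (multiplicity≡adjacency v u)))
        (sym (pack-weightedSum B (adjacency v) (λ u → features (ℓ u) (d u))))

    -- A count of vertices is at most n < m, so it survives the reduction modulo m.
    count-reduced : ∀ {R : Fin n → Set} (R? : ∀ v → Dec (R v)) {x c} → x ≡ sum (λ v → + indicator (R? v)) →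
                    sum (λ v → + indicator (R? v)) ≡ + c → toℕ (red x) ≡ c
    count-reduced R? {c = c} e e′ = trans (cong (λ x → toℕ (red x)) (trans e e′))
      (toℕ-red (≤-<-trans (ℤ.drop‿+≤+ (subst (ℤ._≤ + n) e′ (sum-indicator-≤ R?))) n<m))

    -- Validity bounds labels and depths by n, so the true moments pack to a number below m. The
    -- congruence with the claimed number is then an equality, and its digits are the six moments.
    no-defect⇒count : (b : Fin n → Fin m) → (∀ v → does (Valid? v (b v)) ≡ true) → (∀ v → defect τ b v ≋ 0ℤ) →
                      sum (λ v → + indicator (labelOf (b v) ≟ toℕ v)) ≡ + numComponents G
    no-defect⇒count b ok defect≋0 = certified-count G ℓ d valid-moments
      where
      ℓ d : Fin n → ℕ
      ℓ v = labelOf (b v)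
      d v = depthOf (b v)
      ok′ : ∀ v → LocallyValid v (ℓ v) (d v) (unpack 6 (momentOf (b v)))
      ok′ v = does-true (Valid? v (b v)) (ok v)
      ℓ<n : ∀ v → ℓ v < n
      ℓ<n v = proj₁ (ok′ v)
      d<n : ∀ v → d v < n
      d<n v = proj₁ (proj₂ (ok′ v))
      moment≡ : ∀ v → momentOf (b v) ≡ pack (moments ℓ d v)
      moment≡ v = small-≋⇒≡
        (≤-<-trans (≤-trans (m/n≤m (toℕ (b v) / B) B) (m/n≤m (toℕ (b v)) B)) (Fin.toℕ<n (b v)))
        (<-trans (pack-< (moments-<B ℓ d ℓ<n d<n v)) (B^j<m (m≤m+n 6 2)))
        (≋-trans (difference≋0⇒≋ (defect≋0 v)) (≋-reflexive (pack-moments ℓ d ℓ<n d<n v)))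
      valid-moments : ∀ v → LocallyValid v (ℓ v) (d v) (moments ℓ d v)
      valid-moments v = subst (LocallyValid v (ℓ v) (d v))
        (trans (cong (unpack 6) (moment≡ v)) (unpack-pack (moments-<B ℓ d ℓ<n d<n v))) (ok′ v)

    module _ (p : Transcript → Bool) where
      open Run p

      commitDifference rowDifference : Point k L → Fin n → ℤ
      commitDifference s v = ⟦ commitSymbol v ⟧ ℤ.- ⟦ answerSymbol s v ⟧
      rowDifference s v    = rowHash τ (map val s) v ℤ.- ⟦ rowSymbol s v ⟧

      -- The tests at t come first: they give b′ = b and the correct y. Only then is the product
      -- entry, up to sign, the hash at s of the defect.
      accepted⇒correct : ∀ κ → accepts ⟪ Final.final τ κ ⟫ ≡ true →
        hit (defect τ commitSymbol) (proj₁ κ) ≡ false →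
        hit (commitDifference (proj₁ κ)) (proj₂ κ) ≡ false → hit (rowDifference (proj₁ κ)) (proj₂ κ) ≡ false →
        toℕ (red (roots (Final.final τ κ))) ≡ numComponents G
      accepted⇒correct κ ok hit₁ hit₂ hit₃ =
        count-reduced (λ v → labelOf (answerSymbol (proj₁ κ) v) ≟ toℕ v) roots-final
          (trans (sum-cong-≗ (λ v → cong (λ b → + indicator (labelOf b ≟ toℕ v)) (same-symbol v)))
            (no-defect⇒count commitSymbol valid-symbols no-defect))
        where
        open Final τ κ
        checks = ∧-true {valid final} ok
        checks′ = ∧-true {isZero (commitment final)} (proj₂ checks)
        checks″ = ∧-true {isZero (product final)} (proj₂ checks′)
        same-symbol : ∀ v → answerSymbol (proj₁ κ) v ≡ commitSymbol v
        same-symbol v = sym (≋⇒≡ (difference≋0⇒≋ (no-hit (commitDifference (proj₁ κ)) (proj₂ κ) hit₂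
          (subst (_≋ 0ℤ) commitment-final (isZero-sound (commitment final) (proj₁ checks′))) v)))
        row≋ : ∀ v → ⟦ rowSymbol (proj₁ κ) v ⟧ ≋ rowHash τ (map val (proj₁ κ)) v
        row≋ v = ≋-sym (difference≋0⇒≋ (no-hit (rowDifference (proj₁ κ)) (proj₂ κ) hit₃
          (subst (_≋ 0ℤ) sketch-final (isZero-sound (sketch final) (proj₂ checks″))) v))
        no-defect : ∀ v → defect τ commitSymbol v ≋ 0ℤ
        no-defect = no-hit (defect τ commitSymbol) (proj₁ κ) hit₁
          (subst (_≋ 0ℤ) (ℤ.neg-involutive _)
            (neg-≋0 (≋-trans (≋-sym (product-defect row≋ same-symbol)) (isZero-sound (product final) (proj₁ checks″)))))
        valid-symbols : ∀ v → does (Valid? v (commitSymbol v)) ≡ true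
        valid-symbols v = trans (cong (λ b → does (Valid? v b)) (sym (same-symbol v)))
          (foldFin-∧ (λ v → does (Valid? v (answerSymbol (proj₁ κ) v))) true (trans (sym valid-final) (proj₁ checks)) v)

      good : Key → Bool
      good κ = outputsOrRejects (numComponents G) (outcome p (reads τ (κ , ⟪ zeroTally ⟫)))

      bad⇒hit : ∀ s t → hit (defect τ commitSymbol) s ≡ false → not (good (s , t)) ≡ true →
        hit (commitDifference s) t ∨ hit (rowDifference s) t ≡ true
      bad⇒hit s t hit₁ bad = Bool.¬-not λ none → true≢false (trans (sym bad) (cong not (good-when (∨-false none))))
        where
        κ = s , t
        c = numComponents G
        acceptance : ∀ a x → (a ≡ true → x ≡ c) → ∀ {t} → outputsOrRejects c (halted (if a then just x else nothing) , t) ≡ true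
        acceptance false x h = refl
        acceptance true  x h = subst (λ y → (y ≡ᵇ c) ≡ true) (sym (h refl)) (≡ᵇ-refl c)
        good-when : hit (commitDifference s) t ≡ false × hit (rowDifference s) t ≡ false → good κ ≡ true
        good-when (hit₂ , hit₃) = trans (cong (outputsOrRejects c) (proj₂ (outcome-final τ κ)))
          (acceptance (accepts ⟪ Final.final τ κ ⟫) (toℕ (red (roots (Final.final τ κ))))
            (λ ok → accepted⇒correct κ ok hit₁ hit₂ hit₃))

      -- The defect is fixed before s is drawn. Given s, the two differences tested at t are fixed
      -- as well, so each of the three hashes costs L units of 2^-k.
      bad-bound : Pr (not ∘ good) sampleKey ℚ.≤ (L + (L + L)) ×½^ k
      bad-bound = ℚ.≤-trans
        (Pr-bind (not ∘ good) _ (hit (defect τ commitSymbol)) (0≤×½^ (L + L) k) rest (samplePoint k L))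
        (ℚ.≤-trans (ℚ.+-monoˡ-≤ ((L + L) ×½^ k) (hit-bound (defect τ commitSymbol)))
          (ℚ.≤-reflexive (sym (×½^-+ L (L + L) k))))
        where
        rest : ∀ s → hit (defect τ commitSymbol) s ≡ false →
               Pr (not ∘ good) (samplePoint k L >>= λ t → return (s , t)) ℚ.≤ (L + L) ×½^ k
        rest s hit₁ = begin
          Pr (not ∘ good) (samplePoint k L >>= λ t → return (s , t))  ≡⟨ Pr-map (not ∘ good) _ (s ,_) (λ _ → refl) (samplePoint k L) ⟩
          Pr (not ∘ good ∘ (s ,_)) (samplePoint k L)                  ≤⟨ Pr-mono (λ t → bad⇒hit s t hit₁) (samplePoint k L) ⟩
          Pr (λ t → hit D₁ t ∨ hit D₂ t) (samplePoint k L)            ≤⟨ Pr-∨ (hit D₁) (hit D₂) (samplePoint k L) ⟩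
          Pr (hit D₁) (samplePoint k L) ℚ.+ Pr (hit D₂) (samplePoint k L) ≤⟨ ℚ.+-mono-≤ (hit-bound D₁) (hit-bound D₂) ⟩
          L ×½^ k ℚ.+ L ×½^ k                                         ≡⟨ ×½^-+ L L k ⟨
          (L + L) ×½^ k                                               ∎
          where
          open ℚ.≤-Reasoning
          D₁ = commitDifference s
          D₂ = rowDifference s

      good-bound : ⅔ ℚ.≤ Pr good sampleKey
      good-bound = complement (ℚ.≤-trans (ℚ.+-monoʳ-≤ ⅔ bad-bound) (third {L + (L + L)} {k} 9L≤2^k)) (Pr-not good sampleKey)
        where
        complement : ∀ {x y} → ⅔ ℚ.+ x ℚ.≤ 1ℚ → y ℚ.+ x ≡ 1ℚ → ⅔ ℚ.≤ y
        complement {x} {y} h e = subst₂ ℚ._≤_ (cancelʳ ⅔ x) (cancelʳ y x)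
          (ℚ.+-monoˡ-≤ (ℚ.- x) (ℚ.≤-trans h (ℚ.≤-reflexive (sym e))))
          where
          cancelʳ : ∀ a x → a ℚ.+ x ℚ.+ ℚ.- x ≡ a
          cancelʳ a x = trans (ℚ.+-assoc a x (ℚ.- x)) (trans (cong (ℚ._+_ a) (ℚ.+-inverseʳ x)) (ℚ.+-identityʳ a))
        9L≤2^k : 3 * (L + (L + L)) ≤ 2 ^ k
        9L≤2^k = ≤-trans (m≤m+n _ (23 * L + 32)) (≤-trans (≤-reflexive (expand L)) large)
          where expand : ∀ L → 3 * (L + (L + L)) + (23 * L + 32) ≡ 32 * suc L
                expand = ℕ-Solver.solve-∀

-- Completeness

module Completeness (n L k : ℕ) (n≤2^L : n ≤ 2 ^ L) (large : 32 * suc L ≤ 2 ^ k) where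

  open Protocol n L k n≤2^L large
  open Correctness n L k n≤2^L large
  open Security n L k n≤2^L large
  open Hash k
  open Packing B

  module Strategy (τ : List (EdgeUpdate n)) (ℓ d : Fin n → ℕ) where
    open Certificate (streamGraph τ)

    code : Fin n → ℕ
    code v = pack (ℓ v ∷ d v ∷ moments ℓ d v)

    symbol : Fin n → Fin m
    symbol v = red (+ code v)

    -- The replayed machine of the prover remembers only the revealed coordinates of s, which is all
    -- that its answers need.
    note : Item n L → Fin K → Vec ℕ L → Vec ℕ L
    note (commit v) a rs = rs
    note (reveal i) a rs = rs [ i ]≔ toℕ (first a)
    note (answer v) a rs = rs

    say : Item n L → Vec ℕ L → Fin K
    say (commit v) rs = pair (symbol v) (red 0ℤ)
    -- A filler: at this item the verifier speaks.
    say (reveal i) rs = pair (red 0ℤ) (red 0ℤ)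
    say (answer v) rs = pair (symbol v) (red (rowHash τ rs v))

    open Prove (replicate L 0) note say public

    open Run prover

    first-pair : ∀ x y → first (pair x y) ≡ x
    first-pair x y = cong proj₁ (Fin.remQuot-combine x y)

    second-pair : ∀ x y → second (pair x y) ≡ y
    second-pair x y = cong proj₂ (Fin.remQuot-combine x y)

    noted : ∀ s → foldFin L (λ i → note (reveal i) (coordinateSymbol (lookup s i))) (replicate L 0) ≡ map val s
    noted s = trans (foldFin-proj id (λ i rs → rs [ i ]≔ lookup (map val s) i) (λ i rs → cong (rs [ i ]≔_) (revealed i)) (replicate L 0))
      (foldFin-[]≔ (map val s) (replicate L 0))
      where
      revealed : ∀ i → toℕ (first (coordinateSymbol (lookup s i))) ≡ lookup (map val s) i
      revealed i = trans (cong toℕ (first-pair (red (+ val (lookup s i))) (red 0ℤ)))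
        (trans (toℕ-red (<-trans (val-< (lookup s i)) (m<n⇒m<1+n (n<2^n M)))) (sym (Vec.lookup-map i val s)))

    commit-phase : (∀ v → wordAt prover [] (toℕ v) ≡ say (commit v) (replicate L 0)) ×
                   Awaits (afterWords prover n []) (tabulate reveal ++ tabulate answer ++ []) (replicate L 0)
    commit-phase = awaits-receive commit (replicate L 0) (λ _ _ → refl) awaits-[]

    answer-phase : ∀ s v → wordAt prover (afterReveal s) (toℕ v) ≡ say (answer v) (map val s)
    answer-phase s = proj₁ (awaits-receive answer (map val s) (λ _ _ → refl) {[]}
      (subst (Awaits (afterReveal s) (tabulate answer ++ [])) (noted s)
        (awaits-send reveal (λ i → coordinateSymbol (lookup s i)) (proj₂ commit-phase))))

    commitSymbol≡ : ∀ v → commitSymbol v ≡ symbol v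
    commitSymbol≡ v = trans (cong first (proj₁ commit-phase v)) (first-pair (symbol v) (red 0ℤ))

    answerSymbol≡ : ∀ s v → answerSymbol s v ≡ symbol v
    answerSymbol≡ s v = trans (cong first (answer-phase s v)) (first-pair (symbol v) (red (rowHash τ (map val s) v)))

    rowSymbol≡ : ∀ s v → rowSymbol s v ≡ red (rowHash τ (map val s) v)
    rowSymbol≡ s v = trans (cong second (answer-phase s v)) (second-pair (symbol v) (red (rowHash τ (map val s) v)))

    module _ (promise : FinalMultiplicities01 τ) (locally : ∀ v → LocallyValid v (ℓ v) (d v) (moments ℓ d v)) where

      private
        ℓ<n : ∀ v → ℓ v < n
        ℓ<n v = proj₁ (locally v)
        d<n : ∀ v → d v < n
        d<n v = proj₁ (proj₂ (locally v))

        moments< : ∀ v → All (_< B) (moments ℓ d v)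
        moments< = moments-<B τ promise ℓ d ℓ<n d<n

        ℓ<B : ∀ v → ℓ v < B
        ℓ<B v = <-≤-trans (ℓ<n v) n≤B
        d<B : ∀ v → d v < B
        d<B v = <-≤-trans (d<n v) n≤B

        toℕ-symbol : ∀ v → toℕ (symbol v) ≡ code v
        toℕ-symbol v = toℕ-red (<-trans (pack-< (ℓ<B v ∷ d<B v ∷ moments< v)) B⁸<m)

        rest : Fin n → ℕ
        rest v = d v + B * pack (moments ℓ d v)

      labelOf-symbol : ∀ v → labelOf (symbol v) ≡ ℓ v
      labelOf-symbol v = trans (cong (_% B) (toℕ-symbol v)) (low (rest v) (ℓ<B v))

      depthOf-symbol : ∀ v → depthOf (symbol v) ≡ d v
      depthOf-symbol v = trans (cong (λ x → x / B % B) (toℕ-symbol v))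
        (trans (cong (_% B) (high (rest v) (ℓ<B v))) (low (pack (moments ℓ d v)) (d<B v)))

      momentOf-symbol : ∀ v → momentOf (symbol v) ≡ pack (moments ℓ d v)
      momentOf-symbol v = trans (cong (λ x → x / B / B) (toℕ-symbol v))
        (trans (cong (_/ B) (high (rest v) (ℓ<B v))) (high (pack (moments ℓ d v)) (d<B v)))

      valid-symbol : ∀ v → does (Valid? v (symbol v)) ≡ true
      valid-symbol v = true-does (Valid? v (symbol v)) (transport (labelOf-symbol v) (depthOf-symbol v)
        (trans (cong (unpack 6) (momentOf-symbol v)) (unpack-pack (moments< v))) (locally v))
        where
        transport : ∀ {ℓ ℓ′ d d′ z z′} → ℓ′ ≡ ℓ → d′ ≡ d → z′ ≡ z → LocallyValid v ℓ d z → LocallyValid v ℓ′ d′ z′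
        transport refl refl refl h = h

      no-defect : ∀ v → defect τ symbol v ≋ 0ℤ
      no-defect v = ≋-reflexive (ℤ.i≡j⇒i-j≡0 (trans (cong +_ (momentOf-symbol v))
        (trans (sym (pack-moments τ promise ℓ d ℓ<n d<n v))
          (sum-cong-≗ (λ u → cong (λ x → multiplicity τ v u ℤ.* + x)
            (cong₂ (λ ℓ d → pack (features ℓ d)) (sym (labelOf-symbol u)) (sym (depthOf-symbol u))))))))

      module _ (κ : Key) where
        open Final τ κ

        private
          s₀ = proj₁ κ

        commitment≋0 : commitment final ≋ 0ℤ
        commitment≋0 = subst (_≋ 0ℤ) (sym commitment-final) (hash-≋0 _ (map val (proj₂ κ)) λ v →
          ≋-reflexive (ℤ.i≡j⇒i-j≡0 (cong ⟦_⟧ (trans (commitSymbol≡ v) (sym (answerSymbol≡ s₀ v))))))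

        row≋ : ∀ v → ⟦ rowSymbol s₀ v ⟧ ≋ rowHash τ (map val s₀) v
        row≋ v = ≋-trans (≋-reflexive (cong ⟦_⟧ (rowSymbol≡ s₀ v))) (⟦red⟧ (rowHash τ (map val s₀) v))

        sketch≋0 : sketch final ≋ 0ℤ
        sketch≋0 = subst (_≋ 0ℤ) (sym sketch-final) (hash-≋0 _ (map val (proj₂ κ)) λ v →
          subst (rowHash τ (map val s₀) v ℤ.- ⟦ rowSymbol s₀ v ⟧ ≋_) (ℤ.+-inverseʳ (rowHash τ (map val s₀) v))
            (+-cong (≋-refl {rowHash τ (map val s₀) v}) (neg-cong (row≋ v))))
          where
          neg-cong : ∀ {x y} → x ≋ y → ℤ.- x ≋ ℤ.- y
          neg-cong {x} {y} p = subst₂ _≋_ (ℤ.-1*i≡-i x) (ℤ.-1*i≡-i y) (*-cong (≋-refl {ℤ.- 1ℤ}) p)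

        product≋0 : product final ≋ 0ℤ
        product≋0 = ≋-trans (product-defect row≋ (λ v → trans (answerSymbol≡ s₀ v) (sym (commitSymbol≡ v))))
          (neg-≋0 (hash-≋0 (defect τ commitSymbol) (map val s₀) λ v → subst (_≋ 0ℤ) (defect-cong v) (no-defect v)))
          where
          defect-cong : ∀ v → defect τ symbol v ≡ defect τ commitSymbol v
          defect-cong v = cong₂ ℤ._-_ (cong (λ b → + momentOf b) (sym (commitSymbol≡ v)))
            (sum-cong-≗ (λ u → cong (λ b → multiplicity τ v u ℤ.* + featureOf b) (sym (commitSymbol≡ u))))

        accepted : accepts ⟪ final ⟫ ≡ true
        accepted = ∧-intro
          (trans valid-final (foldFin-∧-true (λ v → does (Valid? v (answerSymbol s₀ v)))
            (λ v → trans (cong (λ b → does (Valid? v b)) (answerSymbol≡ s₀ v)) (valid-symbol v))))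
          (∧-intro (isZero-complete (commitment final) commitment≋0)
            (∧-intro (isZero-complete (product final) product≋0) (isZero-complete (sketch final) sketch≋0)))

        counted : toℕ (red (roots final)) ≡ numComponents (streamGraph τ)
        counted = count-reduced τ promise (λ v → labelOf (answerSymbol s₀ v) ≟ toℕ v) roots-final
          (trans (sum-cong-≗ (λ v → cong (λ ℓ → + indicator (ℓ ≟ toℕ v))
                   (trans (cong labelOf (answerSymbol≡ s₀ v)) (labelOf-symbol v))))
                 (certified-count (streamGraph τ) ℓ d locally))

        -- No assumption on the key: completeness is perfect.
        outputs-count : outputs (numComponents (streamGraph τ)) (outcome prover (reads τ (κ , ⟪ zeroTally ⟫))) ≡ true
        outputs-count = trans (cong (outputs (numComponents (streamGraph τ))) (proj₂ (outcome-final τ κ)))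
          (output (accepts ⟪ final ⟫) (toℕ (red (roots final))) accepted counted)
          where
          c = numComponents (streamGraph τ)
          output : ∀ a x → a ≡ true → x ≡ c → ∀ {t} → outputs c (halted (if a then just x else nothing) , t) ≡ true
          output true x refl e = subst (λ y → (y ≡ᵇ c) ≡ true) (sym e) (≡ᵇ-refl c)

-- Logarithms and the choice of k

n≤2^⌈log₂n⌉ : ∀ n → n ≤ 2 ^ ⌈log₂ n ⌉
n≤2^⌈log₂n⌉ n = go n (<-wellFounded n)
  where
  go : ∀ n → Acc _<_ n → n ≤ 2 ^ ⌈log₂ n ⌉
  go 0 _ = z≤n
  go 1 _ = m^n>0 2 ⌈log₂ 1 ⌉
  go n@(suc (suc j)) (acc rec) = begin
    n                               ≤⟨ n≤2*⌈n/2⌉ n ⟩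
    2 * ⌈ n /2⌉                     ≤⟨ *-monoʳ-≤ 2 (go ⌈ n /2⌉ (rec (⌈n/2⌉<n j))) ⟩
    2 ^ suc ⌈log₂ ⌈ n /2⌉ ⌉         ≡⟨ cong (λ e → 2 ^ suc e) (⌈log₂⌈n/2⌉⌉≡⌈log₂n⌉∸1 n) ⟩
    2 ^ suc (⌈log₂ n ⌉ ∸ 1)         ≡⟨ cong (2 ^_) (m+[n∸m]≡n (⌈log₂⌉-mono-≤ (s≤s (s≤s (z≤n {j}))))) ⟩
    2 ^ ⌈log₂ n ⌉                   ∎
    where
    open ≤-Reasoning
    n≤2*⌈n/2⌉ : ∀ n → n ≤ 2 * ⌈ n /2⌉
    n≤2*⌈n/2⌉ 0             = z≤n
    n≤2*⌈n/2⌉ 1             = s≤s z≤n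
    n≤2*⌈n/2⌉ (suc (suc n)) = ≤-trans (s≤s (s≤s (n≤2*⌈n/2⌉ n))) (≤-reflexive (sym (*-suc 2 ⌈ n /2⌉)))

⌈log₂n⌉≤n : ∀ n → ⌈log₂ n ⌉ ≤ n
⌈log₂n⌉≤n n = ≤-trans (⌈log₂⌉-mono-≤ (<⇒≤ (n<2^n n))) (≤-reflexive (⌈log₂2^n⌉≡n n))

-- The exponent grows only when x passes 2^k. The upper bound keeps M, and with it the word length,
-- linear in log n.
powerOfTwo : ∀ x → ∃ λ k → x ≤ 2 ^ k × 2 ^ k ≤ suc (2 * x)
powerOfTwo zero    = 0 , z≤n , ≤-refl
powerOfTwo (suc x) with powerOfTwo x
... | k , x≤ , ≤2x with m≤n⇒m<n∨m≡n x≤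
...   | inj₁ x<   = k , x< , ≤-trans ≤2x (s≤s (*-monoʳ-≤ 2 (n≤1+n x)))
...   | inj₂ refl = suc k , ≤-trans (+-monoˡ-≤ (2 ^ k) (m^n>0 2 k)) (≤-reflexive (cong (λ y → 2 ^ k + y) (sym (+-identityʳ (2 ^ k)))))
                  , ≤-trans (*-monoʳ-≤ 2 (n≤1+n (2 ^ k))) (n≤1+n (2 * suc (2 ^ k)))

-- Memory

Fin↣Bits : ∀ {x} b → x ≤ 2 ^ b → Fin x ↣ Vec Bool b
Fin↣Bits {x} b x≤ = mk↣ {to = λ i → bits b (toℕ i)} λ {i} {j} e → Fin.toℕ-injective
  (trans (sym (val-bits b _ (<-≤-trans (Fin.toℕ<n i) x≤)))
    (trans (cong val e) (val-bits b _ (<-≤-trans (Fin.toℕ<n j) x≤))))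

×↣Bits : ∀ {A B : Set} {a b} → A ↣ Vec Bool a → B ↣ Vec Bool b → (A × B) ↣ Vec Bool (a + b)
×↣Bits {a = a} f g = mk↣ {to = λ (x , y) → Injection.to f x Vec.++ Injection.to g y} λ {p} {q} e →
  cong₂ _,_ (Injection.injective f (Vec.++-injectiveˡ (Injection.to f (proj₁ p)) (Injection.to f (proj₁ q)) e))
            (Injection.injective g (Vec.++-injectiveʳ (Injection.to f (proj₁ p)) (Injection.to f (proj₁ q)) e))

retract↣Bits : ∀ {A B : Set} {b} (f : A → B) (g : B → A) → (∀ a → g (f a) ≡ a) → B ↣ Vec Bool b → A ↣ Vec Bool b
retract↣Bits f g gf h = mk↣ {to = λ a → Injection.to h (f a)} λ {a} {a′} e →
  trans (sym (gf a)) (trans (cong g (Injection.injective h e)) (gf a′))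

Vec↣Bits : ∀ {A : Set} {a} → A ↣ Vec Bool a → ∀ n → Vec A n ↣ Vec Bool (n * a)
Vec↣Bits f zero    = mk↣ {to = λ _ → []} λ { {[]} {[]} _ → refl }
Vec↣Bits f (suc n) = retract↣Bits (λ v → Vec.head v , Vec.tail v) (λ (x , xs) → x ∷ xs) (λ { (_ ∷ _) → refl })
  (×↣Bits f (Vec↣Bits f n))

Bool↣Bits : Bool ↣ Vec Bool 1
Bool↣Bits = mk↣ {to = _∷ []} λ { refl → refl }

Bits↣Bits : ∀ {k} → Vec Bool k ↣ Vec Bool k
Bits↣Bits = mk↣ {to = id} id

Tally↣Bits : ∀ {A : Set} {a} → A ↣ Vec Bool a → Tally A ↣ Vec Bool (a + (a + (a + (a + 1))))
Tally↣Bits f = retract↣Bits (λ (tally c p s r v) → c , p , s , r , v) (λ (c , p , s , r , v) → tally c p s r v) (λ _ → refl)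
  (×↣Bits f (×↣Bits f (×↣Bits f (×↣Bits f Bool↣Bits))))

length-tabulate-++ : ∀ {A : Set} n (f : Fin n → A) ys → length (tabulate f ++ ys) ≡ n + length ys
length-tabulate-++ n f ys = trans (List.length-++ (tabulate f)) (cong (_+ length ys) (List.length-tabulate f))

-- Cost bounds and the theorem

module Costs (n L k : ℕ) (n≤2^L : n ≤ 2 ^ L) (large : 32 * suc L ≤ 2 ^ k) where

  open Protocol n L k n≤2^L large
  open Correctness n L k n≤2^L large
  open Security n L k n≤2^L large
  open Completeness n L k n≤2^L large

  length-sched : N ≡ n + (L + (n + 0))
  length-sched = trans (length-tabulate-++ n commit _)
    (cong (λ x → n + x) (trans (length-tabulate-++ L reveal _) (cong (λ x → L + x) (length-tabulate-++ n answer []))))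

  space : ℕ
  space = (2 + L) + (suc w + (suc w + ((L * k + L * k) + (suc M + (suc M + (suc M + (suc M + 1)))))))

  fits : FitsIn verifier space
  fits = retract↣Bits (λ (state pos ctr word dat) → pos , ctr , word , dat) (λ (pos , ctr , word , dat) → state pos ctr word dat) (λ _ → refl)
    (×↣Bits (Fin↣Bits (2 + L) N<) (×↣Bits (Fin↣Bits (suc w) (<⇒≤ (n<2^n (suc w)))) (×↣Bits (Fin↣Bits (suc w) K≤2^W)
      (×↣Bits (×↣Bits point point) (Tally↣Bits (Fin↣Bits (suc M) m≤2^[1+M]))))))
    where
    point : Point k L ↣ Vec Bool (L * k)
    point = Vec↣Bits Bits↣Bits L
    N< : suc N ≤ 2 ^ (2 + L)
    N< = begin
      suc N                                   ≡⟨ cong suc length-sched ⟩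
      suc (n + (L + (n + 0)))                 ≤⟨ +-mono-≤ (m^n>0 2 L) (+-mono-≤ n≤2^L (+-mono-≤ (<⇒≤ (n<2^n L)) (+-monoˡ-≤ 0 n≤2^L))) ⟩
      2 ^ L + (2 ^ L + (2 ^ L + (2 ^ L + 0))) ≡⟨ four (2 ^ L) ⟩
      2 ^ (2 + L)                             ∎
      where
      open ≤-Reasoning
      four : ∀ x → x + (x + (x + (x + 0))) ≡ 2 * (2 * x)
      four = ℕ-Solver.solve-∀

  isSIP : ∀ len → IsSIP (λ τ → length τ ≤ len × FinalMultiplicities01 τ) (λ τ → numComponents (streamGraph τ))
                        verifier space (N * suc w) 3
  isSIP len = record
    { spaceBound    = fits
    ; communication = λ 𝒫 τ _ → execute-Surely 𝒫 τ (Run.rounds-outcome (𝒫 τ))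
    ; complete      = honest , λ τ (_ , promise) → ℚ.≤-trans ⅔≤1 (ℚ.≤-reflexive (sym (trans
        (execute-Pr (outputs (numComponents (streamGraph τ))) honest τ)
        (Pr-true (Strategy.outputs-count τ _ _ promise (Honest.locallyValid (streamGraph τ))) sampleKey))))
    ; sound         = λ 𝒫 τ (_ , promise) → subst (⅔ ℚ.≤_)
        (sym (execute-Pr (outputsOrRejects (numComponents (streamGraph τ))) 𝒫 τ))
        (good-bound τ promise (𝒫 τ))
    }
    where
    honest : Prover (EdgeUpdate n)
    honest τ = Strategy.prover τ (Honest.label (streamGraph τ)) (Honest.depth (streamGraph τ))
    ⅔≤1 : ⅔ ℚ.≤ 1ℚ
    ⅔≤1 = toWitness {a? = ⅔ ℚ.≤? 1ℚ} _

  module _ (L≥1 : 1 ≤ L) (tight : 2 ^ k ≤ suc (2 * (32 * suc L))) where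

    multiple : ∀ {x} a c → x ≤ a + c * L → x ≤ (a + c) * L
    multiple {x} a c x≤ = ≤-trans x≤ (≤-trans (+-monoˡ-≤ (c * L) (≤-trans (≤-reflexive (sym (*-identityʳ a))) (*-monoʳ-≤ a L≥1)))
      (≤-reflexive (sym (*-distribʳ-+ L a c))))

    M≤ : M ≤ 129 * L
    M≤ = multiple 65 64 (≤-trans tight (≤-reflexive (expand L)))
      where expand : ∀ L → suc (2 * (32 * suc L)) ≡ 65 + 64 * L
            expand = ℕ-Solver.solve-∀

    1+M≤ : suc M ≤ 130 * L
    1+M≤ = multiple 1 129 (s≤s M≤)

    W≤ : suc w ≤ 260 * L
    W≤ = multiple 2 258 (s≤s (s≤s (≤-trans (*-monoʳ-≤ 2 M≤) (≤-reflexive (sym (*-assoc 2 129 L))))))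

    -- The constant is 3 for the position, 260 each for the bit counter and the word, 2 · 129 for
    -- the key, 4 · 130 for the residues and 1 for the flag.
    space≤ : space ≤ 1302 * L ^ 2
    space≤ = ≤-trans
      (+-mono-≤ (quadratic 3 (multiple 2 1 (≤-reflexive (cong (λ x → 2 + x) (sym (*-identityˡ L)))))) (+-mono-≤ (quadratic 260 W≤) (+-mono-≤ (quadratic 260 W≤)
        (+-mono-≤ (+-mono-≤ points points)
          (+-mono-≤ (quadratic 130 1+M≤) (+-mono-≤ (quadratic 130 1+M≤) (+-mono-≤ (quadratic 130 1+M≤) (+-mono-≤ (quadratic 130 1+M≤)
            (≤-trans L≥1 (quadratic 1 (≤-reflexive (sym (*-identityˡ L)))))))))))))
      (≤-reflexive (total L))
      where
      quadratic : ∀ {x} a → x ≤ a * L → x ≤ a * (L * L)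
      quadratic a x≤ = ≤-trans x≤ (*-monoʳ-≤ a (≤-trans (≤-reflexive (sym (*-identityʳ L))) (*-monoʳ-≤ L L≥1)))
      points : L * k ≤ 129 * (L * L)
      -- The crude k < 2^k = M suffices for a bound quadratic in L.
      points = ≤-trans (*-monoʳ-≤ L (≤-trans (<⇒≤ (n<2^n k)) M≤)) (≤-reflexive (swap L))
        where swap : ∀ L → L * (129 * L) ≡ 129 * (L * L)
              swap = ℕ-Solver.solve-∀
      total : ∀ L → 3 * (L * L) + (260 * (L * L) + (260 * (L * L) + ((129 * (L * L) + 129 * (L * L)) + (130 * (L * L) + (130 * (L * L) +
              (130 * (L * L) + (130 * (L * L) + 1 * (L * L)))))))) ≡ 1302 * (L * (L * 1))
      total = ℕ-Solver.solve-∀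

    -- There are 2n + L ≤ 3n words of at most 260 L bits.
    comm≤ : L ≤ n → N * suc w ≤ 780 * (n * L)
    comm≤ L≤n = ≤-trans (*-mono-≤ (≤-trans (≤-reflexive length-sched) (+-monoʳ-≤ n (+-monoˡ-≤ (n + 0) L≤n))) W≤)
      (≤-reflexive (total n L))
      where
      total : ∀ n L → (n + (n + (n + 0))) * (260 * L) ≡ 780 * (n * L)
      total = ℕ-Solver.solve-∀

theorem8 : (len : ℕ → ℕ) → PolynomiallyBounded len →
    HasSIP (DynamicGraphStream len) (λ n τ → numComponents (streamGraph τ))
    (λ n → ⌈log₂ n ⌉) (λ n → ⌈log₂ n ⌉ ^ 2) (λ n → n * ⌈log₂ n ⌉)
theorem8 len _ = record
  { verifier = λ n → Protocol.verifier n (L n) (k n) (n≤2^⌈log₂n⌉ n) (large n)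
  ; space    = λ n → Costs.space n (L n) (k n) (n≤2^⌈log₂n⌉ n) (large n)
  ; comm     = λ n → Protocol.N n (L n) (k n) (n≤2^⌈log₂n⌉ n) (large n) * suc (Protocol.w n (L n) (k n) (n≤2^⌈log₂n⌉ n) (large n))
  ; rnds     = λ _ → 3
  ; isSIP    = λ n → Costs.isSIP n (L n) (k n) (n≤2^⌈log₂n⌉ n) (large n) (len n)
  -- The threshold 2 is needed because the logarithm of 1 is zero.
  ; rounds-O = 3 , 2 , λ n 2≤n → *-monoʳ-≤ 3 (L≥1 n 2≤n)
  ; space-O  = 1302 , 2 , λ n 2≤n → Costs.space≤ n (L n) (k n) (n≤2^⌈log₂n⌉ n) (large n) (L≥1 n 2≤n) (tight n)
  ; comm-O   = 780 , 2 , λ n 2≤n → Costs.comm≤ n (L n) (k n) (n≤2^⌈log₂n⌉ n) (large n) (L≥1 n 2≤n) (tight n) (⌈log₂n⌉≤n n)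
  }
  where
  L : ℕ → ℕ
  L n = ⌈log₂ n ⌉
  k : ℕ → ℕ
  k n = proj₁ (powerOfTwo (32 * suc (L n)))
  large : ∀ n → 32 * suc (L n) ≤ 2 ^ k n
  large n = proj₁ (proj₂ (powerOfTwo (32 * suc (L n))))
  tight : ∀ n → 2 ^ k n ≤ suc (2 * (32 * suc (L n)))
  tight n = proj₂ (proj₂ (powerOfTwo (32 * suc (L n))))
  L≥1 : ∀ n → 2 ≤ n → 1 ≤ L n
  L≥1 n 2≤n = ⌈log₂⌉-mono-≤ 2≤n
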